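{- Let $\alpha,\beta\ge1$ be real numbers and let $j\in\mathbb{Q}$. As $X\to\infty$, $$\frac{\#\mathcal{E}_j(X;H_{\alpha,\beta})}{\#\widetilde{\mathcal{E}}_j(X;H_{\alpha,\beta})}=\begin{cases}\dfrac{1}{\zeta(6)}+O(X^{ -5/12}) & \text{for } j=0,\\[6pt] \dfrac{1}{\zeta(4)}+O(X^{ -1/4}) & \text{for } j=1728,\\[6pt] \dfrac{1}{\zeta(2)}+O(X^{ -1/12}) & \text{for } j\neq0,1728.\end{cases}$$
   Context: For $(A,B)\in\mathbb{Z}^2$ let $E_{A,B}$ denote the curve $y^2=x^3+Ax+B$; curves are counted by their pairs $(A,B)$. Let $\widetilde{\mathcal{E}}$ be the set of all $E_{A,B}$ with $A,B\in\mathbb{Z}$ and $-16(4A^3+27B^2)\neq 0$. Let $\mathcal{E}$ be the set of $E_{A,B}\in\widetilde{\mathcal{E}}$ such that there is no prime $p$ with $p^4\mid A$ and $p^6\mid B$ (a complete set of representatives for the $\mathbb{Q}$-isomorphism classes of elliptic curves over $\mathbb{Q}$). The $j$-invariant is $j(E_{A,B})=1728\cdot\frac{4A^3}{4A^3+27B^2}$. For $j\in\mathbb{Q}$, $\widetilde{\mathcal{E}}_j:=\{E_{A,B}\in\widetilde{\mathcal{E}}: j(E_{A,B})=j\}$ and $\mathcal{E}_j:=\{E_{A,B}\in\mathcal{E}: j(E_{A,B})=j\}$. For real $\alpha,\beta\ge1$, $H_{\alpha,\beta}(E_{A,B}):=\max\{\alpha|A|^3,\beta B^2\}$, and for a family $\mathcal{F}$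 and $X>0$, $\mathcal{F}(X;H_{\alpha,\beta}):=\{E_{A,B}\in\mathcal{F}: H_{\alpha,\beta}(E_{A,B})\le X\}$. $\zeta$ is the Riemann zeta function. The parameters $\alpha,\beta,j$ are fixed; the implied constants may depend on them. -}

module Defs where

open import Level using (0ℓ)
open import Data.Nat.Base as ℕ using (ℕ; zero; suc; z≤n; s≤s)
import Data.Nat.Properties as ℕ
open import Data.Nat.Primality using (Prime)
open import Data.Integer.Base as ℤ using (ℤ; +_; -[1+_]; 0ℤ)
import Data.Integer.Properties as ℤ
import Data.Integer.Divisibility as ℤ
import Data.Integer.GCD as ℤ
import Data.Integer.Solver as ℤSolver
import Data.Nat.Solver as ℕSolver
open import Data.Rational.Unnormalised.Base as ℚᵘ using (mkℚᵘ)
import Data.Rational.Unnormalised.Properties as ℚᵘ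
open import Data.Rational.Base
open import Data.Rational.Properties
open import Data.Rational.Solver using (module +-*-Solver)
open import Data.List.Base using (List; []; _∷_; length; map; _++_; cartesianProduct; upTo)
open import Data.List.Membership.Propositional using (_∈_)
open import Data.List.Membership.Propositional.Properties using (∈-++⁺ˡ; ∈-++⁺ʳ; ∈-map⁺; ∈-upTo⁺; ∈-cartesianProduct⁺)
open import Data.List.Relation.Unary.All.Properties using (¬Any⇒All¬)
open import Data.List.Relation.Unary.AllPairs using ([]; _∷_)
open import Data.List.Relation.Unary.Any using (here; there)
open import Data.List.Relation.Unary.Unique.Propositional using (Unique)
open import Data.Product using (Σ; Σ-syntax; ∃; ∃-syntax; _×_; _,_; proj₁; proj₂)
open import Data.Sum.Base using (_⊎_; inj₁; inj₂; map₁)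
open import Function.Bundles using (_⇔_; mk⇔; module Equivalence)
open import Relation.Nullary.Decidable using (¬¬-excluded-middle)
open import Relation.Nullary using (¬_; yes; no; contradiction; Dec)
open import Relation.Unary using (Pred)
open import Relation.Binary.PropositionalEquality

open import Algebra.Definitions.RawSemiring +-*-rawSemiring using (_^_)

module ℤ+* = ℤSolver.+-*-Solver
module ℕ+* = ℕSolver.+-*-Solver

private
  variable
    p q r s e : ℚ

p≤∣p∣ : ∀ p → p ≤ ∣ p ∣
p≤∣p∣ p with ≤-total 0ℚ p
... | inj₁ 0≤p = ≤-reflexive (sym (0≤p⇒∣p∣≡p 0≤p))
... | inj₂ p≤0 = ≤-trans p≤0 (0≤∣p∣ p)

p≡q+[p-q] : ∀ p q → p ≡ q + (p - q)
p≡q+[p-q] = solve 2 (λ p q → p := q :+ (p :- q)) refl where open +-*-Solver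

[q+e]-q≡e : ∀ q e → (q + e) - q ≡ e
[q+e]-q≡e = solve 2 (λ q e → (q :+ e) :- q := e) refl where open +-*-Solver

-[p-q]≡q-p : ∀ p q → - (p - q) ≡ q - p
-[p-q]≡q-p = solve 2 (λ p q → :- (p :- q) := q :- p) refl where open +-*-Solver

p≤q+e⇒p-q≤e : p ≤ q + e → p - q ≤ e
p≤q+e⇒p-q≤e {p} {q} {e} h =
  subst (p - q ≤_) ([q+e]-q≡e q e) (+-monoˡ-≤ (- q) h)

∣-∣≤ : p ≤ q + e → q ≤ p + e → ∣ p - q ∣ ≤ e
∣-∣≤ {p} {q} {e} h k with ∣p∣≡p∨∣p∣≡-p (p - q)
... | inj₁ eq = subst (_≤ e) (sym eq) (p≤q+e⇒p-q≤e h)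
... | inj₂ eq = subst (_≤ e) (sym (trans eq (-[p-q]≡q-p p q))) (p≤q+e⇒p-q≤e k)

∣-∣≤⁻¹ : ∣ p - q ∣ ≤ e → p ≤ q + e
∣-∣≤⁻¹ {p} {q} {e} h = begin
  p               ≡⟨ p≡q+[p-q] p q ⟩
  q + (p - q)     ≤⟨ +-monoʳ-≤ q (p≤∣p∣ (p - q)) ⟩
  q + ∣ p - q ∣   ≤⟨ +-monoʳ-≤ q h ⟩
  q + e           ∎
  where open ≤-Reasoning

∣-∣-comm : ∀ p q → ∣ p - q ∣ ≡ ∣ q - p ∣
∣-∣-comm p q = trans (sym (∣-p∣≡∣p∣ (p - q))) (cong ∣_∣ (-[p-q]≡q-p p q))

p≤p+ : 0ℚ ≤ e → p ≤ p + e
p≤p+ {e} {p} h = subst (_≤ p + e) (+-identityʳ p) (+-monoʳ-≤ p h)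

half+half : ∀ ε → ε * ½ + ε * ½ ≡ ε
half+half ε = trans (sym (*-distribˡ-+ ε ½ ½)) (*-identityʳ ε)

0<* : 0ℚ < p → 0ℚ < q → 0ℚ < p * q
0<* {p} {q} h k = positive⁻¹ (p * q) {{pos*pos⇒pos p {{positive h}} q {{positive k}}}}

0≤* : 0ℚ ≤ p → 0ℚ ≤ q → 0ℚ ≤ p * q
0≤* {p} {q} h k =
  nonNegative⁻¹ (p * q) {{nonNeg*nonNeg⇒nonNeg p {{nonNegative h}} q {{nonNegative k}}}}

0≤+ : 0ℚ ≤ p → 0ℚ ≤ q → 0ℚ ≤ p + q
0≤+ h k = +-mono-≤ h k

0<1 : 0ℚ < 1ℚ
0<1 = positive⁻¹ 1ℚ

0<half : 0ℚ < p → 0ℚ < p * ½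
0<half h = 0<* h (positive⁻¹ ½)

*-mono : 0ℚ ≤ q → 0ℚ ≤ r → p ≤ q → r ≤ s → p * r ≤ q * s
*-mono {q} {r} 0≤q 0≤r h k =
  ≤-trans (*-monoʳ-≤-nonNeg r {{nonNegative 0≤r}} h) (*-monoˡ-≤-nonNeg q {{nonNegative 0≤q}} k)

shrink : ∀ B ε → 0ℚ < B → 0ℚ < ε → Σ[ δ ∈ ℚ ] (0ℚ < δ × B * δ ≡ ε)
shrink B ε 0<B 0<ε = ε * b , 0<* 0<ε 0<b , eq
  where
  instance
    posB = positive 0<B
    nzB  = pos⇒nonZero B
  b = 1/ B
  0<b : 0ℚ < b
  0<b = positive⁻¹ b {{1/pos⇒pos B}}
  eq : B * (ε * b) ≡ ε
  eq = begin
    B * (ε * b)  ≡⟨ cong (B *_) (*-comm ε b) ⟩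
    B * (b * ε)  ≡⟨ *-assoc B b ε ⟨
    B * b * ε    ≡⟨ cong (_* ε) (*-inverseʳ B) ⟩
    1ℚ * ε       ≡⟨ *-identityˡ ε ⟩
    ε            ∎
    where open ≡-Reasoning

-- A real is a Cauchy sequence of rationals together with a modulus of
-- convergence. Two sequences with the same limit count as the same real, but
-- that equality is never needed: all claims below are inequalities, and _≤ᴿ_
-- and _<ᴿ_ compare limits.
IsCauchy : (ℕ → ℚ) → Set
IsCauchy f = ∀ ε → 0ℚ < ε →
  Σ[ N ∈ ℕ ] ∀ m n → N ℕ.≤ m → N ℕ.≤ n → ∣ f m - f n ∣ ≤ ε

record ℝ : Set where
  constructor mkℝ
  field
    seq    : ℕ → ℚ
    cauchy : IsCauchy seq

open ℝ

infix 4 _≤ᴿ_ _<ᴿ_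

_≤ᴿ_ : ℝ → ℝ → Set
x ≤ᴿ y = ∀ ε → 0ℚ < ε → Σ[ N ∈ ℕ ] ∀ n → N ℕ.≤ n → seq x n ≤ seq y n + ε

_<ᴿ_ : ℝ → ℝ → Set
x <ᴿ y = Σ[ ε ∈ ℚ ] (0ℚ < ε × (Σ[ N ∈ ℕ ] ∀ n → N ℕ.≤ n → seq x n + ε ≤ seq y n))

abstract
  const-cauchy : ∀ q → IsCauchy (λ _ → q)
  const-cauchy q ε 0<ε = 0 , λ _ _ _ _ → ∣-∣≤ {q} {q} (p≤p+ (<⇒≤ 0<ε)) (p≤p+ (<⇒≤ 0<ε))

fromℚ : ℚ → ℝ
fromℚ q = mkℝ (λ _ → q) (const-cauchy q)

fromℤ : ℤ → ℝ
fromℤ i = fromℚ (i / 1)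

0ᴿ 1ᴿ : ℝ
0ᴿ = fromℚ 0ℚ
1ᴿ = fromℚ 1ℚ

abstract
  nonExpansive₂-cauchy : (_∙_ : ℚ → ℚ → ℚ) →
    (∀ a b c d {e₁ e₂} → ∣ a - c ∣ ≤ e₁ → ∣ b - d ∣ ≤ e₂ → (a ∙ b) ≤ (c ∙ d) + (e₁ + e₂)) →
    ∀ {f g} → IsCauchy f → IsCauchy g → IsCauchy (λ n → f n ∙ g n)
  nonExpansive₂-cauchy _∙_ lip {f} {g} cf cg ε 0<ε =
    let N₁ , H₁ = cf (ε * ½) (0<half 0<ε)
        N₂ , H₂ = cg (ε * ½) (0<half 0<ε)
    in N₁ ℕ.⊔ N₂ , λ m n hm hn →
      let am = H₁ m n (ℕ.≤-trans (ℕ.m≤m⊔n N₁ N₂) hm) (ℕ.≤-trans (ℕ.m≤m⊔n N₁ N₂) hn)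
          bm = H₂ m n (ℕ.≤-trans (ℕ.m≤n⊔m N₁ N₂) hm) (ℕ.≤-trans (ℕ.m≤n⊔m N₁ N₂) hn)
          am′ = subst (_≤ ε * ½) (∣-∣-comm (f m) (f n)) am
          bm′ = subst (_≤ ε * ½) (∣-∣-comm (g m) (g n)) bm
      in ∣-∣≤ (subst (λ t → (f m ∙ g m) ≤ (f n ∙ g n) + t) (half+half ε) (lip (f m) (g m) (f n) (g n) am bm))
              (subst (λ t → (f n ∙ g n) ≤ (f m ∙ g m) + t) (half+half ε) (lip (f n) (g n) (f m) (g m) am′ bm′))

  -ᴿ-lip : ∀ a b c d {e₁ e₂} → ∣ a - c ∣ ≤ e₁ → ∣ b - d ∣ ≤ e₂ → a - b ≤ (c - d) + (e₁ + e₂)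
  -ᴿ-lip a b c d {e₁} {e₂} h k = begin
    a - b                     ≡⟨ lem₁ a b c d ⟩
    (c - d) + ((a - c) + (d - b))
      ≤⟨ +-monoʳ-≤ (c - d) (+-mono-≤ (≤-trans (p≤∣p∣ _) h)
           (≤-trans (p≤∣p∣ _) (subst (_≤ e₂) (∣-∣-comm b d) k))) ⟩
    (c - d) + (e₁ + e₂)       ∎
    where
    open ≤-Reasoning
    lem₁ : ∀ a b c d → a - b ≡ (c - d) + ((a - c) + (d - b))
    lem₁ = solve 4 (λ a b c d → a :- b := (c :- d) :+ ((a :- c) :+ (d :- b))) refl
      where open +-*-Solver

  ⊔-lip : ∀ a b c d {e₁ e₂} → ∣ a - c ∣ ≤ e₁ → ∣ b - d ∣ ≤ e₂ → a ⊔ b ≤ (c ⊔ d) + (e₁ + e₂)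
  ⊔-lip a b c d {e₁} {e₂} h k = ⊔-lub
    (begin
      a                    ≤⟨ ∣-∣≤⁻¹ h ⟩
      c + e₁               ≤⟨ +-mono-≤ (p≤p⊔q c d) (p≤p+ (≤-trans (0≤∣p∣ _) k)) ⟩
      (c ⊔ d) + (e₁ + e₂)  ∎)
    (begin
      b                    ≤⟨ ∣-∣≤⁻¹ k ⟩
      d + e₂               ≤⟨ +-mono-≤ (p≤q⊔p c d) (subst (e₂ ≤_) (+-comm e₂ e₁) (p≤p+ (≤-trans (0≤∣p∣ _) h))) ⟩
      (c ⊔ d) + (e₁ + e₂)  ∎)
    where open ≤-Reasoning

  ∣∣-cauchy : ∀ {f} → IsCauchy f → IsCauchy (λ n → ∣ f n ∣)
  ∣∣-cauchy {f} cf ε 0<ε =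
    let N , H = cf ε 0<ε
    in N , λ m n hm hn → ∣-∣≤ (go (f m) (f n) (H m n hm hn)) (go (f n) (f m) (H n m hn hm))
    where
    go : ∀ a b → ∣ a - b ∣ ≤ ε → ∣ a ∣ ≤ ∣ b ∣ + ε
    go a b h = begin
      ∣ a ∣                ≡⟨ cong ∣_∣ (p≡q+[p-q] a b) ⟩
      ∣ b + (a - b) ∣      ≤⟨ ∣p+q∣≤∣p∣+∣q∣ b (a - b) ⟩
      ∣ b ∣ + ∣ a - b ∣    ≤⟨ +-monoʳ-≤ ∣ b ∣ h ⟩
      ∣ b ∣ + ε            ∎
      where open ≤-Reasoning

  bounded : ∀ {f} → IsCauchy f →
    Σ[ B ∈ ℚ ] (0ℚ < B × (Σ[ N ∈ ℕ ] ∀ n → N ℕ.≤ n → ∣ f n ∣ ≤ B))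
  bounded {f} cf = ∣ f N ∣ + 1ℚ , +-mono-≤-< (0≤∣p∣ (f N)) 0<1 , N , λ n hn → begin
      ∣ f n ∣                   ≡⟨ cong ∣_∣ (p≡q+[p-q] (f n) (f N)) ⟩
      ∣ f N + (f n - f N) ∣     ≤⟨ ∣p+q∣≤∣p∣+∣q∣ (f N) (f n - f N) ⟩
      ∣ f N ∣ + ∣ f n - f N ∣   ≤⟨ +-monoʳ-≤ ∣ f N ∣ (proj₂ (cf 1ℚ 0<1) n N hn ℕ.≤-refl) ⟩
      ∣ f N ∣ + 1ℚ              ∎
    where
    open ≤-Reasoning
    N : ℕ
    N = proj₁ (cf 1ℚ 0<1)

  *-cauchy : ∀ {f g} → IsCauchy f → IsCauchy g → IsCauchy (λ n → f n * g n)
  *-cauchy {f} {g} cf cg ε 0<ε =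
    let A , 0<A , N₁ , HA = bounded {f} cf
        B , 0<B , N₂ , HB = bounded {g} cg
        δ , 0<δ , Aδ      = shrink A (ε * ½) 0<A (0<half 0<ε)
        γ , 0<γ , Bγ      = shrink B (ε * ½) 0<B (0<half 0<ε)
        N₃ , Hg           = cg δ 0<δ
        N₄ , Hf           = cf γ 0<γ
    in (N₁ ℕ.⊔ N₂) ℕ.⊔ (N₃ ℕ.⊔ N₄) , λ m n hm hn →
      let hm₁₂ = ℕ.m⊔n≤o⇒m≤o (N₁ ℕ.⊔ N₂) (N₃ ℕ.⊔ N₄) hm
          hm₃₄ = ℕ.m⊔n≤o⇒n≤o (N₁ ℕ.⊔ N₂) (N₃ ℕ.⊔ N₄) hm
          hn₁₂ = ℕ.m⊔n≤o⇒m≤o (N₁ ℕ.⊔ N₂) (N₃ ℕ.⊔ N₄) hn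
          hn₃₄ = ℕ.m⊔n≤o⇒n≤o (N₁ ℕ.⊔ N₂) (N₃ ℕ.⊔ N₄) hn
      in go ε A B δ γ (f m) (g m) (f n) (g n) 0<A 0<B Aδ Bγ
           (HA m (ℕ.m⊔n≤o⇒m≤o N₁ N₂ hm₁₂))
           (Hg m n (ℕ.m⊔n≤o⇒m≤o N₃ N₄ hm₃₄) (ℕ.m⊔n≤o⇒m≤o N₃ N₄ hn₃₄))
           (HB n (ℕ.m⊔n≤o⇒n≤o N₁ N₂ hn₁₂))
           (Hf m n (ℕ.m⊔n≤o⇒n≤o N₃ N₄ hm₃₄) (ℕ.m⊔n≤o⇒n≤o N₃ N₄ hn₃₄))
    where
    lem : ∀ a b c d → a * b - c * d ≡ a * (b - d) + d * (a - c)
    lem = solve 4 (λ a b c d → a :* b :- c :* d := a :* (b :- d) :+ d :* (a :- c)) refl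
      where open +-*-Solver

    go : ∀ ε A B δ γ a b c d → 0ℚ < A → 0ℚ < B → A * δ ≡ ε * ½ → B * γ ≡ ε * ½ →
         ∣ a ∣ ≤ A → ∣ b - d ∣ ≤ δ → ∣ d ∣ ≤ B → ∣ a - c ∣ ≤ γ → ∣ a * b - c * d ∣ ≤ ε
    go ε A B δ γ a b c d 0<A 0<B Aδ Bγ h₁ h₂ h₃ h₄ = begin
      ∣ a * b - c * d ∣                          ≡⟨ cong ∣_∣ (lem a b c d) ⟩
      ∣ a * (b - d) + d * (a - c) ∣              ≤⟨ ∣p+q∣≤∣p∣+∣q∣ (a * (b - d)) (d * (a - c)) ⟩
      ∣ a * (b - d) ∣ + ∣ d * (a - c) ∣
        ≡⟨ cong₂ _+_ (∣p*q∣≡∣p∣*∣q∣ a (b - d)) (∣p*q∣≡∣p∣*∣q∣ d (a - c)) ⟩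
      ∣ a ∣ * ∣ b - d ∣ + ∣ d ∣ * ∣ a - c ∣
        ≤⟨ +-mono-≤ (*-mono (<⇒≤ 0<A) (0≤∣p∣ (b - d)) h₁ h₂)
                    (*-mono (<⇒≤ 0<B) (0≤∣p∣ (a - c)) h₃ h₄) ⟩
      A * δ + B * γ                              ≡⟨ cong₂ _+_ Aδ Bγ ⟩
      ε * ½ + ε * ½                              ≡⟨ half+half ε ⟩
      ε                                          ∎
      where open ≤-Reasoning

infixl 6 _-ᴿ_ _⊔ᴿ_
infixl 7 _*ᴿ_
infixr 8 _^ᴿ_

_-ᴿ_ _⊔ᴿ_ _*ᴿ_ : ℝ → ℝ → ℝ
x -ᴿ y = mkℝ (λ n → seq x n - seq y n) (nonExpansive₂-cauchy _-_ -ᴿ-lip {seq x} {seq y} (cauchy x) (cauchy y))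
x ⊔ᴿ y = mkℝ (λ n → seq x n ⊔ seq y n) (nonExpansive₂-cauchy _⊔_ ⊔-lip {seq x} {seq y} (cauchy x) (cauchy y))
x *ᴿ y = mkℝ (λ n → seq x n * seq y n) (*-cauchy {seq x} {seq y} (cauchy x) (cauchy y))

∣_∣ᴿ : ℝ → ℝ
∣ x ∣ᴿ = mkℝ (λ n → ∣ seq x n ∣) (∣∣-cauchy {seq x} (cauchy x))

_^ᴿ_ : ℝ → ℕ → ℝ
x ^ᴿ zero  = 1ᴿ
x ^ᴿ suc n = x *ᴿ x ^ᴿ n

-- Junk value 0 at 0, which only finitely many terms of a positive real can hit.
recipℚ : ℚ → ℚ
recipℚ p with p ≟ 0ℚ
... | yes _  = 0ℚ
... | no p≢0 = (1/ p) {{≢-nonZero p≢0}}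

abstract
  p*recip : 0ℚ < p → p * recipℚ p ≡ 1ℚ
  p*recip {p} 0<p with p ≟ 0ℚ
  ... | yes p≡0 = contradiction (sym p≡0) (<⇒≢ 0<p)
  ... | no p≢0  = *-inverseʳ p {{≢-nonZero p≢0}}

  0<recip : 0ℚ < p → 0ℚ < recipℚ p
  0<recip {p} 0<p with p ≟ 0ℚ
  ... | yes p≡0 = contradiction (sym p≡0) (<⇒≢ 0<p)
  ... | no p≢0  = positive⁻¹ _ {{1/pos⇒pos p {{positive 0<p}}}}

  recip-anti : 0ℚ < p → p ≤ q → recipℚ q ≤ recipℚ p
  recip-anti {p} {q} 0<p p≤q = *-cancelˡ-≤-pos p {{positive 0<p}} (begin
      p * recipℚ q   ≤⟨ *-monoʳ-≤-nonNeg (recipℚ q) {{nonNegative (<⇒≤ (0<recip 0<q))}} p≤q ⟩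
      q * recipℚ q   ≡⟨ p*recip 0<q ⟩
      1ℚ             ≡⟨ p*recip 0<p ⟨
      p * recipℚ p   ∎)
    where
    open ≤-Reasoning
    0<q : 0ℚ < q
    0<q = <-≤-trans 0<p p≤q

  recip-cauchy : ∀ {f} → IsCauchy f →
    Σ[ ε ∈ ℚ ] (0ℚ < ε × (Σ[ N ∈ ℕ ] ∀ n → N ℕ.≤ n → 0ℚ + ε ≤ f n)) →
    IsCauchy (λ n → recipℚ (f n))
  recip-cauchy {f} cf (η , 0<η , N₁ , Hη) ε 0<ε =
    let δ , 0<δ , eq = shrink (recipℚ η * recipℚ η) ε (0<* (0<recip 0<η) (0<recip 0<η)) 0<ε
        N₂ , Hf      = cf δ 0<δ
    in N₁ ℕ.⊔ N₂ , λ m n hm hn →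
      subst (∣ recipℚ (f m) - recipℚ (f n) ∣ ≤_) eq
        (go δ (f m) (f n)
          (subst (_≤ f m) (+-identityˡ η) (Hη m (ℕ.m⊔n≤o⇒m≤o N₁ N₂ hm)))
          (subst (_≤ f n) (+-identityˡ η) (Hη n (ℕ.m⊔n≤o⇒m≤o N₁ N₂ hn)))
          (Hf m n (ℕ.m⊔n≤o⇒n≤o N₁ N₂ hm) (ℕ.m⊔n≤o⇒n≤o N₁ N₂ hn)))
    where
    lem : ∀ a b c d → c * (b * d) - d * (a * c) ≡ c * d * (b - a)
    lem = solve 4 (λ a b c d → c :* (b :* d) :- d :* (a :* c) := c :* d :* (b :- a)) refl
      where open +-*-Solver

    x≡x*[y*y⁻¹] : ∀ x {y} → 0ℚ < y → x ≡ x * (y * recipℚ y)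
    x≡x*[y*y⁻¹] x 0<y = trans (sym (*-identityʳ x)) (cong (x *_) (sym (p*recip 0<y)))

    go : ∀ δ a b → η ≤ a → η ≤ b → ∣ a - b ∣ ≤ δ →
         ∣ recipℚ a - recipℚ b ∣ ≤ recipℚ η * recipℚ η * δ
    go δ a b η≤a η≤b h = begin
      ∣ a⁻¹ - b⁻¹ ∣
        ≡⟨ cong ∣_∣ (cong₂ _-_ (x≡x*[y*y⁻¹] a⁻¹ 0<b) (x≡x*[y*y⁻¹] b⁻¹ 0<a)) ⟩
      ∣ a⁻¹ * (b * b⁻¹) - b⁻¹ * (a * a⁻¹) ∣  ≡⟨ cong ∣_∣ (lem a b a⁻¹ b⁻¹) ⟩
      ∣ a⁻¹ * b⁻¹ * (b - a) ∣               ≡⟨ ∣p*q∣≡∣p∣*∣q∣ (a⁻¹ * b⁻¹) (b - a) ⟩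
      ∣ a⁻¹ * b⁻¹ ∣ * ∣ b - a ∣
        ≡⟨ cong₂ _*_ (0≤p⇒∣p∣≡p (<⇒≤ (0<* (0<recip 0<a) (0<recip 0<b)))) (∣-∣-comm b a) ⟩
      a⁻¹ * b⁻¹ * ∣ a - b ∣
        ≤⟨ *-mono (<⇒≤ (0<* (0<recip 0<η) (0<recip 0<η))) (0≤∣p∣ (a - b))
             (*-mono (<⇒≤ (0<recip 0<η)) (<⇒≤ (0<recip 0<b)) (recip-anti 0<η η≤a) (recip-anti 0<η η≤b))
             h ⟩
      recipℚ η * recipℚ η * δ               ∎
      where
      open ≤-Reasoning
      a⁻¹ b⁻¹ : ℚ
      a⁻¹ = recipℚ a
      b⁻¹ = recipℚ b
      0<a : 0ℚ < a
      0<a = <-≤-trans 0<η η≤a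
      0<b : 0ℚ < b
      0<b = <-≤-trans 0<η η≤b

recip : (x : ℝ) → 0ᴿ <ᴿ x → ℝ
recip x 0<x = mkℝ (λ n → recipℚ (seq x n)) (recip-cauchy {seq x} (cauchy x) 0<x)

abstract
  fromℚᵘ-mono-≤ : ∀ {p q} → p ℚᵘ.≤ q → fromℚᵘ p ≤ fromℚᵘ q
  fromℚᵘ-mono-≤ {p} {q} h = toℚᵘ-cancel-≤
    (ℚᵘ.≤-respˡ-≃ (ℚᵘ.≃-sym (toℚᵘ-fromℚᵘ p)) (ℚᵘ.≤-respʳ-≃ (ℚᵘ.≃-sym (toℚᵘ-fromℚᵘ q)) h))

  fromℚᵘ-homo-+ : ∀ p q → fromℚᵘ (p ℚᵘ.+ q) ≡ fromℚᵘ p + fromℚᵘ q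
  fromℚᵘ-homo-+ p q = toℚᵘ-injective (ℚᵘ.≃-trans (toℚᵘ-fromℚᵘ (p ℚᵘ.+ q))
    (ℚᵘ.≃-sym (ℚᵘ.≃-trans (toℚᵘ-homo-+ (fromℚᵘ p) (fromℚᵘ q))
      (ℚᵘ.+-cong (toℚᵘ-fromℚᵘ p) (toℚᵘ-fromℚᵘ q)))))

  fromℚᵘ-homo-* : ∀ p q → fromℚᵘ (p ℚᵘ.* q) ≡ fromℚᵘ p * fromℚᵘ q
  fromℚᵘ-homo-* p q = toℚᵘ-injective (ℚᵘ.≃-trans (toℚᵘ-fromℚᵘ (p ℚᵘ.* q))
    (ℚᵘ.≃-sym (ℚᵘ.≃-trans (toℚᵘ-homo-* (fromℚᵘ p) (fromℚᵘ q))
      (ℚᵘ.*-cong (toℚᵘ-fromℚᵘ p) (toℚᵘ-fromℚᵘ q)))))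

  suc/ : ∀ i k → + suc i / suc k ≡ + i / suc k + + 1 / suc k
  suc/ i k = trans (fromℚᵘ-cong {mkℚᵘ (+ suc i) k} {mkℚᵘ (+ i) k ℚᵘ.+ mkℚᵘ (+ 1) k} (ℚᵘ.*≡* (lem (+ i) (+ suc k))))
                   (fromℚᵘ-homo-+ (mkℚᵘ (+ i) k) (mkℚᵘ (+ 1) k))
    where
    lem : ∀ i k → (+ 1 ℤ.+ i) ℤ.* (k ℤ.* k) ≡ (i ℤ.* k ℤ.+ + 1 ℤ.* k) ℤ.* k
    lem = ℤ+*.solve 2 (λ i k → (con (+ 1) :+ i) :* (k :* k) := (i :* k :+ con (+ 1) :* k) :* k) refl
      where open ℤ+*

  0≤/ : ∀ i k → 0ℚ ≤ + i / suc k
  0≤/ i k = nonNegative⁻¹ _ {{normalize-nonNeg i (suc k)}}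

  ≤∣↥∣ : ∀ q → q ≤ + ℤ.∣ ↥ q ∣ / 1
  ≤∣↥∣ q = subst (_≤ + ℤ.∣ ↥ q ∣ / 1) (fromℚᵘ-toℚᵘ q) (fromℚᵘ-mono-≤ (lem q))
    where
    lem : ∀ q → toℚᵘ q ℚᵘ.≤ mkℚᵘ (+ ℤ.∣ ↥ q ∣) 0
    lem (mkℚ (+ n) d _) = ℚᵘ.*≤* (subst₂ ℤ._≤_ (ℤ.pos-* n 1) (ℤ.pos-* n (suc d))
      (ℤ.+≤+ (ℕ.*-monoʳ-≤ n (s≤s z≤n))))
    lem (mkℚ -[1+ n ] d _) = ℚᵘ.*≤* ℤ.-≤+

  archimedes : ∀ ε → 0ℚ < ε → ∀ n → ↧ₙ ε ℕ.≤ n → + 1 / suc n ≤ ε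
  archimedes ε 0<ε n h = subst (+ 1 / suc n ≤_) (fromℚᵘ-toℚᵘ ε) (fromℚᵘ-mono-≤ (lem ε (positive 0<ε) h))
    where
    lem : ∀ ε → Positive ε → ↧ₙ ε ℕ.≤ n → mkℚᵘ (+ 1) n ℚᵘ.≤ toℚᵘ ε
    lem (mkℚ (+ suc a) d _) _ h = ℚᵘ.*≤* (subst₂ ℤ._≤_ (ℤ.pos-* 1 (suc d)) (ℤ.pos-* (suc a) (suc n))
      (ℤ.+≤+ (ℕ.*-mono-≤ {1} {suc a} (s≤s z≤n) (ℕ.m≤n⇒m≤1+n h))))

  0≤^ : ∀ n → 0ℚ ≤ p → 0ℚ ≤ p ^ n
  0≤^ zero    h = <⇒≤ 0<1
  0≤^ (suc n) h = 0≤* h (0≤^ n h)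

  0<^ : ∀ n → 0ℚ < p → 0ℚ < p ^ n
  0<^ zero    h = 0<1
  0<^ (suc n) h = 0<* h (0<^ n h)

  ^-mono : ∀ n → 0ℚ ≤ p → p ≤ q → p ^ n ≤ q ^ n
  ^-mono zero    h k = ≤-refl
  ^-mono (suc n) h k = *-mono (≤-trans h k) (0≤^ n h) k (^-mono n h k)

  ^-super : ∀ n → 0ℚ ≤ p → 0ℚ ≤ q → p ^ suc n + q ^ suc n ≤ (p + q) ^ suc n
  ^-super {p} {q} zero    h k = ≤-reflexive (sym (*-distribʳ-+ 1ℚ p q))
  ^-super {p} {q} (suc n) h k = begin
    p * p ^ suc n + q * q ^ suc n
      ≤⟨ +-mono-≤ (*-monoˡ-≤-nonNeg p {{nonNegative h}} (p≤p+ (0≤^ (suc n) k)))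
                  (*-monoˡ-≤-nonNeg q {{nonNegative k}}
                    (subst (q ^ suc n ≤_) (+-comm (q ^ suc n) (p ^ suc n)) (p≤p+ (0≤^ (suc n) h)))) ⟩
    p * (p ^ suc n + q ^ suc n) + q * (p ^ suc n + q ^ suc n)
      ≡⟨ *-distribʳ-+ (p ^ suc n + q ^ suc n) p q ⟨
    (p + q) * (p ^ suc n + q ^ suc n)
      ≤⟨ *-monoˡ-≤-nonNeg (p + q) {{nonNegative (0≤+ h k)}} (^-super n h k) ⟩
    (p + q) * (p + q) ^ suc n ∎
    where open ≤-Reasoning

  1≤^ : ∀ n → 1ℚ ≤ p → 1ℚ ≤ p ^ n
  1≤^ zero h = ≤-refl
  1≤^ {p} (suc n) h = ≤-trans (1≤^ n h)
    (subst (_≤ p * p ^ n) (*-identityˡ (p ^ n))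
      (*-monoʳ-≤-nonNeg (p ^ n) {{nonNegative (≤-trans (<⇒≤ 0<1) (1≤^ n h))}} h))

  p≤p^ : ∀ n → 1ℚ ≤ p → p ≤ p ^ suc n
  p≤p^ {p} n h = subst (_≤ p * p ^ n) (*-identityʳ p)
    (*-monoˡ-≤-nonNeg p {{nonNegative (≤-trans (<⇒≤ 0<1) h)}} (1≤^ n h))

greatest : {P : ℕ → Set} → (∀ i → Dec (P i)) → ℕ → ℕ
greatest P? zero    = zero
greatest P? (suc b) with P? (suc b)
... | yes _ = suc b
... | no  _ = greatest P? b

-- The numerator of rootℚ; the search bound b has (b/(k+1))ⁿ > q for n ≥ 1.
rootNum : (n k : ℕ) → ℚ → ℕ
rootNum n k q = greatest (λ i → (+ i / suc k) ^ n ≤? q) (suc ℤ.∣ ↥ q ∣ ℕ.* suc k)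

-- For n ≥ 1, the largest multiple r of 1/(k+1) with rⁿ ≤ q, or 0 if q < 0.
rootℚ : (n k : ℕ) → ℚ → ℚ
rootℚ n k q = + rootNum n k q / suc k

abstract
  greatest-holds : {P : ℕ → Set} (P? : ∀ i → Dec (P i)) (b : ℕ) →
    greatest P? b ≡ 0 ⊎ P (greatest P? b)
  greatest-holds P? zero    = inj₁ refl
  greatest-holds P? (suc b) with P? (suc b)
  ... | yes h = inj₂ h
  ... | no  _ = greatest-holds P? b

  greatest-max : {P : ℕ → Set} (P? : ∀ i → Dec (P i)) (b : ℕ) →
    ¬ P (suc b) → ¬ P (suc (greatest P? b))
  greatest-max P? zero    h = h
  greatest-max P? (suc b) h with P? (suc b)
  ... | yes _ = h
  ... | no ¬p = greatest-max P? b ¬p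

  0≤rootℚ : ∀ n k q → 0ℚ ≤ rootℚ n k q
  0≤rootℚ n k q = 0≤/ (rootNum n k q) k

  rootℚ-lower : ∀ n k q → rootℚ n k q ≡ 0ℚ ⊎ rootℚ n k q ^ n ≤ q
  rootℚ-lower n k q =
    map₁ (λ eq → trans (cong (λ i → + i / suc k) eq) (0/n≡0 (suc k))) (num n k q)
    where
    num : ∀ n k q → rootNum n k q ≡ 0 ⊎ (+ rootNum n k q / suc k) ^ n ≤ q
    num n k q = greatest-holds (λ i → (+ i / suc k) ^ n ≤? q) (suc ℤ.∣ ↥ q ∣ ℕ.* suc k)

  rootℚ-upper : ∀ n k q → q < (rootℚ (suc n) k q + + 1 / suc k) ^ suc n
  rootℚ-upper n k q = subst (λ t → q < t ^ suc n) (suc/ (rootNum (suc n) k q) k)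
      (≰⇒> (greatest-max P? b (λ h → <-irrefl refl (<-≤-trans top h))))
    where
    P? : ∀ i → Dec ((+ i / suc k) ^ suc n ≤ q)
    P? i = (+ i / suc k) ^ suc n ≤? q
    N b : ℕ
    N = ℤ.∣ ↥ q ∣
    b = suc N ℕ.* suc k
    M : ℚ
    M = + suc N / 1
    1≤M : 1ℚ ≤ M
    1≤M = subst₂ _≤_ (+-identityˡ 1ℚ) (sym (suc/ N 0)) (+-monoˡ-≤ 1ℚ (0≤/ N 0))
    M≤ : M ≤ + suc b / suc k
    M≤ = fromℚᵘ-mono-≤ {mkℚᵘ (+ suc N) 0} {mkℚᵘ (+ suc b) k} (ℚᵘ.*≤*
           (subst₂ ℤ._≤_ (ℤ.pos-* (suc N) (suc k)) (ℤ.pos-* (suc b) 1)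
             (ℤ.+≤+ (subst (b ℕ.≤_) (sym (ℕ.*-identityʳ (suc b))) (ℕ.n≤1+n b)))))
    top : q < (+ suc b / suc k) ^ suc n
    top = begin-strict
      q                          ≤⟨ ≤∣↥∣ q ⟩
      + N / 1                    ≡⟨ +-identityʳ (+ N / 1) ⟨
      + N / 1 + 0ℚ               <⟨ +-monoʳ-< (+ N / 1) 0<1 ⟩
      + N / 1 + 1ℚ               ≡⟨ suc/ N 0 ⟨
      M                          ≤⟨ p≤p^ n 1≤M ⟩
      M ^ suc n                  ≤⟨ ^-mono (suc n) (≤-trans (<⇒≤ 0<1) 1≤M) M≤ ⟩
      (+ suc b / suc k) ^ suc n  ∎
      where open ≤-Reasoning

  root-close : ∀ n {p q r t} δ → 0ℚ ≤ δ → 0ℚ ≤ t → p ≤ q + δ ^ suc n →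
    r ≡ 0ℚ ⊎ r ^ suc n ≤ p → q < t ^ suc n → r ≤ t + δ
  root-close n δ 0≤δ 0≤t h (inj₁ refl) q<tⁿ = 0≤+ 0≤t 0≤δ
  root-close n {p} {q} {r} {t} δ 0≤δ 0≤t h (inj₂ rⁿ≤p) q<tⁿ = ≮⇒≥ λ t+δ<r →
    <-irrefl refl (begin-strict
      q + δ ^ suc n          <⟨ +-monoˡ-< (δ ^ suc n) q<tⁿ ⟩
      t ^ suc n + δ ^ suc n  ≤⟨ ^-super n 0≤t 0≤δ ⟩
      (t + δ) ^ suc n        ≤⟨ ^-mono (suc n) (0≤+ 0≤t 0≤δ) (<⇒≤ t+δ<r) ⟩
      r ^ suc n              ≤⟨ rⁿ≤p ⟩
      p                      ≤⟨ h ⟩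
      q + δ ^ suc n          ∎)
    where open ≤-Reasoning

  rootℚ-close : ∀ n k l {p q} δ → 0ℚ ≤ δ → p ≤ q + δ ^ suc n →
    rootℚ (suc n) k p ≤ rootℚ (suc n) l q + + 1 / suc l + δ
  rootℚ-close n k l {p} {q} δ 0≤δ h =
    root-close n {p} {q} δ 0≤δ (0≤+ (0≤rootℚ (suc n) l q) (0≤/ 1 l)) h
      (rootℚ-lower (suc n) k p) (rootℚ-upper n l q)

  root-cauchy : ∀ n .{{_ : ℕ.NonZero n}} {f} → IsCauchy f → IsCauchy (λ k → rootℚ n k (f k))
  root-cauchy (suc n) {f} cf ε 0<ε =
      ↧ₙ δ ℕ.⊔ N , λ k l hk hl →
        ∣-∣≤ {g k} {g l} {ε} (close k l hk hl) (close l k hl hk)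
    where
    δ : ℚ
    δ = ε * ½
    0<δ : 0ℚ < δ
    0<δ = 0<half 0<ε
    g : ℕ → ℚ
    g k = rootℚ (suc n) k (f k)
    N : ℕ
    N = proj₁ (cf (δ ^ suc n) (0<^ (suc n) 0<δ))
    f-close : ∀ k l → N ℕ.≤ k → N ℕ.≤ l → ∣ f k - f l ∣ ≤ δ ^ suc n
    f-close = proj₂ (cf (δ ^ suc n) (0<^ (suc n) 0<δ))

    widen : ∀ {x y u} → u ≤ δ → x ≤ y + u + δ → x ≤ y + ε
    widen {x} {y} {u} u≤δ h = begin
      x            ≤⟨ h ⟩
      y + u + δ    ≡⟨ +-assoc y u δ ⟩
      y + (u + δ)  ≤⟨ +-monoʳ-≤ y (+-monoˡ-≤ δ u≤δ) ⟩
      y + (δ + δ)  ≡⟨ cong (λ t → y + t) (half+half ε) ⟩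
      y + ε        ∎
      where open ≤-Reasoning

    close : ∀ k l → ↧ₙ δ ℕ.⊔ N ℕ.≤ k → ↧ₙ δ ℕ.⊔ N ℕ.≤ l → g k ≤ g l + ε
    close k l hk hl = widen {g k} {g l} {+ 1 / suc l}
      (archimedes δ 0<δ l (ℕ.m⊔n≤o⇒m≤o (↧ₙ δ) N hl))
      (rootℚ-close n k l {f k} {f l} δ (<⇒≤ 0<δ)
        (∣-∣≤⁻¹ {f k} {f l} (f-close k l (ℕ.m⊔n≤o⇒n≤o (↧ₙ δ) N hk) (ℕ.m⊔n≤o⇒n≤o (↧ₙ δ) N hl))))

-- The nonnegative n-th root of x ≥ 0 (and 0 for x ≤ 0).
root : (n : ℕ) .{{_ : ℕ.NonZero n}} → ℝ → ℝ
root n x = mkℝ (λ k → rootℚ n k (seq x k)) (root-cauchy n {seq x} (cauchy x))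

zpow : (x : ℝ) → 0ᴿ <ᴿ x → ℤ → ℝ
zpow x 0<x (+ n)    = x ^ᴿ n
zpow x 0<x -[1+ n ] = recip x 0<x ^ᴿ suc n

rpow : (x : ℝ) → 0ᴿ <ᴿ x → ℚ → ℝ
rpow x 0<x q = root (↧ₙ q) (zpow x 0<x (↥ q))

ζ-sum : ℕ → ℕ → ℚ
ζ-sum s zero    = 0ℚ
ζ-sum s (suc n) = ζ-sum s n + (+ 1 / suc n) ^ s

abstract
  1/suc≤1 : ∀ n → + 1 / suc n ≤ 1ℚ
  1/suc≤1 n = fromℚᵘ-mono-≤ {mkℚᵘ (+ 1) n} {mkℚᵘ (+ 1) 0} (ℚᵘ.*≤* (ℤ.+≤+ (s≤s z≤n)))

  ^≤1 : ∀ n → 0ℚ ≤ p → p ≤ 1ℚ → p ^ n ≤ 1ℚ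
  ^≤1 zero    h k = ≤-refl
  ^≤1 (suc n) h k = *-mono (<⇒≤ 0<1) (0≤^ n h) k (^≤1 n h k)

  telescope : ∀ n → (+ 1 / suc (suc n)) * (+ 1 / suc (suc n)) + + 1 / suc (suc n) ≤ + 1 / suc n
  telescope n = subst (_≤ + 1 / suc n)
      (trans (fromℚᵘ-homo-+ (u ℚᵘ.* u) u) (cong (_+ + 1 / suc (suc n)) (fromℚᵘ-homo-* u u)))
      (fromℚᵘ-mono-≤ {(u ℚᵘ.* u) ℚᵘ.+ u} {mkℚᵘ (+ 1) n} (ℚᵘ.*≤* (ℤ.+≤+
        (subst (a ℕ.≤_) (sym (lem n)) (ℕ.m≤m+n a (suc (suc n)))))))
    where
    u : ℚᵘ.ℚᵘ
    u = mkℚᵘ (+ 1) (suc n)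
    a : ℕ
    a = (1 ℕ.* suc (suc n) ℕ.+ 1 ℕ.* (suc (suc n) ℕ.* suc (suc n))) ℕ.* suc n
    lem : ∀ n → 1 ℕ.* ((suc (suc n) ℕ.* suc (suc n)) ℕ.* suc (suc n)) ≡
          (1 ℕ.* suc (suc n) ℕ.+ 1 ℕ.* (suc (suc n) ℕ.* suc (suc n))) ℕ.* suc n ℕ.+ suc (suc n)
    lem = ℕ+*.solve 1 (λ n →
      con 1 :* (((con 2 :+ n) :* (con 2 :+ n)) :* (con 2 :+ n)) :=
      (con 1 :* (con 2 :+ n) :+ con 1 :* ((con 2 :+ n) :* (con 2 :+ n))) :* (con 1 :+ n) :+ (con 2 :+ n)) refl
      where open ℕ+*

  ζ-sum-mono : ∀ s {m n} → m ℕ.≤ n → ζ-sum s m ≤ ζ-sum s n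
  ζ-sum-mono s m≤n = go (ℕ.≤⇒≤′ m≤n)
    where
    go : ∀ {m n} → m ℕ.≤′ n → ζ-sum s m ≤ ζ-sum s n
    go (ℕ.≤′-reflexive refl) = ≤-refl
    go {m} {suc n} (ℕ.≤′-step h) = ≤-trans (go h) (p≤p+ (0≤^ s (0≤/ 1 n)))

  ζ-sum-tail : ∀ s {m n} → m ℕ.≤ n →
    ζ-sum (2 ℕ.+ s) (suc n) + + 1 / suc n ≤ ζ-sum (2 ℕ.+ s) (suc m) + + 1 / suc m
  ζ-sum-tail s m≤n = go (ℕ.≤⇒≤′ m≤n)
    where
    open ≤-Reasoning
    go : ∀ {m n} → m ℕ.≤′ n →
      ζ-sum (2 ℕ.+ s) (suc n) + + 1 / suc n ≤ ζ-sum (2 ℕ.+ s) (suc m) + + 1 / suc m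
    go (ℕ.≤′-reflexive refl) = ≤-refl
    go {m} {suc n} (ℕ.≤′-step h) = begin
      ζ-sum (2 ℕ.+ s) (suc n) + u ^ (2 ℕ.+ s) + u
        ≡⟨ +-assoc (ζ-sum (2 ℕ.+ s) (suc n)) (u ^ (2 ℕ.+ s)) u ⟩
      ζ-sum (2 ℕ.+ s) (suc n) + (u ^ (2 ℕ.+ s) + u)
        ≤⟨ +-monoʳ-≤ (ζ-sum (2 ℕ.+ s) (suc n)) (≤-trans (+-monoˡ-≤ u u^≤) (telescope n)) ⟩
      ζ-sum (2 ℕ.+ s) (suc n) + + 1 / suc n
        ≤⟨ go h ⟩
      ζ-sum (2 ℕ.+ s) (suc m) + + 1 / suc m ∎
      where
      u : ℚ
      u = + 1 / suc (suc n)
      u^≤ : u ^ (2 ℕ.+ s) ≤ u * u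
      u^≤ = *-monoˡ-≤-nonNeg u {{nonNegative (0≤/ 1 (suc n))}}
              (subst (u * u ^ s ≤_) (*-identityʳ u)
                (*-monoˡ-≤-nonNeg u {{nonNegative (0≤/ 1 (suc n))}}
                  (^≤1 s (0≤/ 1 (suc n)) (1/suc≤1 (suc n)))))

  ζ-cauchy : ∀ s .{{_ : ℕ.NonTrivial s}} → IsCauchy (λ n → ζ-sum s (suc n))
  ζ-cauchy (suc (suc s)) ε 0<ε = ↧ₙ ε , λ m n hm hn → ∣-∣≤ (go n m hn) (go m n hm)
    where
    open ≤-Reasoning
    go : ∀ m n → ↧ₙ ε ℕ.≤ m → ζ-sum (2 ℕ.+ s) (suc n) ≤ ζ-sum (2 ℕ.+ s) (suc m) + ε
    go m n hm with ℕ.≤-total m n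
    ... | inj₁ m≤n = begin
      ζ-sum (2 ℕ.+ s) (suc n)               ≤⟨ p≤p+ (0≤/ 1 n) ⟩
      ζ-sum (2 ℕ.+ s) (suc n) + + 1 / suc n ≤⟨ ζ-sum-tail s m≤n ⟩
      ζ-sum (2 ℕ.+ s) (suc m) + + 1 / suc m ≤⟨ +-monoʳ-≤ (ζ-sum (2 ℕ.+ s) (suc m)) (archimedes ε 0<ε m hm) ⟩
      ζ-sum (2 ℕ.+ s) (suc m) + ε           ∎
    ... | inj₂ n≤m = ≤-trans (ζ-sum-mono (2 ℕ.+ s) (s≤s n≤m)) (p≤p+ (<⇒≤ 0<ε))

  1^ : ∀ s → 1ℚ ^ s ≡ 1ℚ
  1^ zero    = refl
  1^ (suc s) = trans (*-identityˡ (1ℚ ^ s)) (1^ s)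

ζ : (s : ℕ) .{{_ : ℕ.NonTrivial s}} → ℝ
ζ s = mkℝ (λ n → ζ-sum s (suc n)) (ζ-cauchy s)

abstract
  0<ζ : ∀ s .{{_ : ℕ.NonTrivial s}} → 0ᴿ <ᴿ ζ s
  0<ζ s = 1ℚ , 0<1 , 0 , λ n _ →
    subst (_≤ ζ-sum s (suc n)) (cong (λ t → 0ℚ + t) (1^ s)) (ζ-sum-mono s {1} {suc n} (s≤s z≤n))

Curve : Set
Curve = ℤ × ℤ

Δ : Curve → ℤ
Δ (A , B) = ℤ.- (+ 16) ℤ.* (+ 4 ℤ.* A ℤ.^ 3 ℤ.+ + 27 ℤ.* B ℤ.^ 2)

ℰ~ : Pred Curve 0ℓ
ℰ~ E = Δ E ≢ 0ℤ

ℰ : Pred Curve 0ℓ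
ℰ E@(A , B) = ℰ~ E × ¬ (∃[ p ] Prime p × (+ (p ℕ.^ 4)) ℤ.∣ A × (+ (p ℕ.^ 6)) ℤ.∣ B)

abstract
  i/1≡0⇒i≡0 : ∀ i → i / 1 ≡ 0ℚ → i ≡ 0ℤ
  i/1≡0⇒i≡0 i eq = trans (sym (↥-/ i 1)) (cong (λ t → ↥ t ℤ.* ℤ.gcd i (+ 1)) eq)

  Δ≢0⇒nonZero : ∀ A B → ℰ~ (A , B) → NonZero ((+ 4 ℤ.* A ℤ.^ 3 ℤ.+ + 27 ℤ.* B ℤ.^ 2) / 1)
  Δ≢0⇒nonZero A B Δ≢0 = ≢-nonZero λ eq →
    Δ≢0 (trans (cong (ℤ.- (+ 16) ℤ.*_) (i/1≡0⇒i≡0 (+ 4 ℤ.* A ℤ.^ 3 ℤ.+ + 27 ℤ.* B ℤ.^ 2) eq)) refl)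

jInv : (E : Curve) → ℰ~ E → ℚ
jInv (A , B) Δ≢0 = (+ 1728 / 1) *
  (((+ 4 ℤ.* A ℤ.^ 3) / 1) ÷ ((+ 4 ℤ.* A ℤ.^ 3 ℤ.+ + 27 ℤ.* B ℤ.^ 2) / 1)) {{Δ≢0⇒nonZero A B Δ≢0}}

ℰ~[_] ℰ[_] : ℚ → Pred Curve 0ℓ
ℰ~[ j ] E = Σ[ Δ≢0 ∈ ℰ~ E ] jInv E Δ≢0 ≡ j
ℰ[ j ]  E = Σ[ E∈ℰ ∈ ℰ E ] jInv E (proj₁ E∈ℰ) ≡ j

H : ℝ → ℝ → Curve → ℝ
H α β (A , B) = α *ᴿ fromℤ (+ (ℤ.∣ A ∣ ℕ.^ 3)) ⊔ᴿ β *ᴿ fromℤ (B ℤ.^ 2)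

_⟨_⨾_⟩ : Pred Curve 0ℓ → ℝ → (Curve → ℝ) → Pred Curve 0ℓ
(F ⟨ X ⨾ h ⟩) E = F E × h E ≤ᴿ X

-- "#P = n". Comparing reals is undecidable, so for real α, β, X the cardinality
-- is a relation and not a function of the set. By ¬¬-card below, it is
-- contradictory for one of the sets counted here not to have a cardinality.
HasCard : Pred Curve 0ℓ → ℕ → Set
HasCard P n = Σ[ Es ∈ List Curve ] (Unique Es × (∀ E → (E ∈ Es) ⇔ P E) × length Es ≡ n)

-- #F(X; h) / #G(X; h) = L + O(X^e) as X → ∞; for X ≥ X₀ the denominator is
-- asserted to be nonzero, so that the quotient makes sense.
RatioAsymptotic : Pred Curve 0ℓ → Pred Curve 0ℓ → (Curve → ℝ) → ℝ → ℚ → Set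
RatioAsymptotic F G h L e =
  Σ[ C ∈ ℝ ] Σ[ X₀ ∈ ℝ ] ∀ (X : ℝ) (0<X : 0ᴿ <ᴿ X) → X₀ ≤ᴿ X →
    ∀ m n → HasCard (F ⟨ X ⨾ h ⟩) m → HasCard (G ⟨ X ⨾ h ⟩) n →
      Σ[ n≢0 ∈ ℕ.NonZero n ]
        ∣ fromℚ ((+ m / n) {{n≢0}}) -ᴿ L ∣ᴿ ≤ᴿ C *ᴿ rpow X 0<X e

abstract
  ¬¬-card-of-bounded : ∀ {P} (L : List Curve) → (∀ E → P E → E ∈ L) → ¬ ¬ (∃[ n ] HasCard P n)
  ¬¬-card-of-bounded {P} L P⊆L ¬card = go L λ (Es , u , h) →
      ¬card (length Es , Es , u ,
        (λ E → mk⇔ (λ E∈ → proj₂ (Equivalence.to (h E) E∈))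
                   (λ PE → Equivalence.from (h E) (P⊆L E PE , PE))) , refl)
    where
    go : ∀ L → ¬ ¬ (Σ[ Es ∈ List Curve ] (Unique Es × (∀ E → (E ∈ Es) ⇔ (E ∈ L × P E))))
    go []      k = k ([] , [] , λ E → mk⇔ (λ ()) (λ ()))
    go (E ∷ L) k = go L λ (Es , u , h) → ¬¬-excluded-middle {A = P E} λ where
      (no ¬PE) → k (Es , u , λ E′ → mk⇔
        (λ E′∈ → let E′∈L , PE′ = Equivalence.to (h E′) E′∈ in there E′∈L , PE′)
        λ { (here refl , PE′) → contradiction PE′ ¬PE
          ; (there E′∈L , PE′) → Equivalence.from (h E′) (E′∈L , PE′) })
      (yes PE) → ¬¬-excluded-middle {A = E ∈ Es} λ where
        (yes E∈Es) → k (Es , u , λ E′ → mk⇔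
          (λ E′∈ → let E′∈L , PE′ = Equivalence.to (h E′) E′∈ in there E′∈L , PE′)
          λ { (here refl , _) → E∈Es
            ; (there E′∈L , PE′) → Equivalence.from (h E′) (E′∈L , PE′) })
        (no E∉Es) → k (E ∷ Es , ¬Any⇒All¬ Es E∉Es ∷ u , λ E′ → mk⇔
          (λ { (here refl) → here refl , PE
             ; (there E′∈) → let E′∈L , PE′ = Equivalence.to (h E′) E′∈ in there E′∈L , PE′ })
          λ { (here refl , _) → here refl
            ; (there E′∈L , PE′) → there (Equivalence.from (h E′) (E′∈L , PE′)) })

  coefficient-bound : ∀ X → Σ[ M ∈ ℕ ] ∀ α c → 1ᴿ ≤ᴿ α → α *ᴿ fromℤ (+ c) ≤ᴿ X → c ℕ.≤ M
  coefficient-bound X =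
    let B , _ , N₁ , hB = bounded {seq X} (cauchy X)
    in ℤ.∣ ↥ (two * (B + 1ℚ)) ∣ , λ α c 1≤α h →
      let N₂ , hα = 1≤α ½ (positive⁻¹ ½)
          N₃ , hX = h 1ℚ 0<1
          n       = N₁ ℕ.⊔ (N₂ ℕ.⊔ N₃)
      in go B c (seq α n) (seq X n)
           (hα n (ℕ.≤-trans (ℕ.m≤m⊔n N₂ N₃) (ℕ.m≤n⊔m N₁ (N₂ ℕ.⊔ N₃))))
           (hX n (ℕ.≤-trans (ℕ.m≤n⊔m N₂ N₃) (ℕ.m≤n⊔m N₁ (N₂ ℕ.⊔ N₃))))
           (hB n (ℕ.m≤m⊔n N₁ (N₂ ℕ.⊔ N₃)))
    where
    two : ℚ
    two = + 2 / 1

    unfrac : ∀ m n → + m / 1 ≤ + n / 1 → m ℕ.≤ n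
    unfrac m n h with ℚᵘ.≤-respˡ-≃ (toℚᵘ-fromℚᵘ (mkℚᵘ (+ m) 0))
                       (ℚᵘ.≤-respʳ-≃ (toℚᵘ-fromℚᵘ (mkℚᵘ (+ n) 0)) (toℚᵘ-mono-≤ h))
    ... | ℚᵘ.*≤* k = ℤ.drop‿+≤+ (subst₂ ℤ._≤_ (ℤ.*-identityʳ (+ m)) (ℤ.*-identityʳ (+ n)) k)

    go : ∀ B c a x → 1ℚ ≤ a + ½ → a * (+ c / 1) ≤ x + 1ℚ → ∣ x ∣ ≤ B → c ℕ.≤ ℤ.∣ ↥ (two * (B + 1ℚ)) ∣
    go B c a x h₁ h₂ h₃ = unfrac c _ (begin
      + c / 1                  ≡⟨ *-identityˡ (+ c / 1) ⟨
      1ℚ * (+ c / 1)           ≡⟨ *-assoc two ½ (+ c / 1) ⟩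
      two * (½ * (+ c / 1))    ≤⟨ *-monoˡ-≤-nonNeg two (begin
        ½ * (+ c / 1)            ≤⟨ *-monoʳ-≤-nonNeg (+ c / 1) {{nonNegative (0≤/ c 0)}} ½≤a ⟩
        a * (+ c / 1)            ≤⟨ h₂ ⟩
        x + 1ℚ                   ≤⟨ +-monoˡ-≤ 1ℚ (≤-trans (p≤∣p∣ x) h₃) ⟩
        B + 1ℚ                   ∎) ⟩
      two * (B + 1ℚ)           ≤⟨ ≤∣↥∣ (two * (B + 1ℚ)) ⟩
      + ℤ.∣ ↥ (two * (B + 1ℚ)) ∣ / 1 ∎)
      where
      open ≤-Reasoning
      ½≤a : ½ ≤ a
      ½≤a = subst (½ ≤_) ([q+e]-q≡e′ a) (+-monoˡ-≤ (- ½) h₁)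
        where
        [q+e]-q≡e′ : ∀ a → (a + ½) - ½ ≡ a
        [q+e]-q≡e′ a = trans (+-assoc a ½ (- ½)) (+-identityʳ a)

  ⊔ᴿ-≤ : ∀ x y z → x ⊔ᴿ y ≤ᴿ z → x ≤ᴿ z × y ≤ᴿ z
  ⊔ᴿ-≤ x y z h =
    (λ ε 0<ε → let N , k = h ε 0<ε in N , λ n hn → ≤-trans (p≤p⊔q (seq x n) (seq y n)) (k n hn)) ,
    (λ ε 0<ε → let N , k = h ε 0<ε in N , λ n hn → ≤-trans (p≤q⊔p (seq x n) (seq y n)) (k n hn))

  ¬¬-card : ∀ α β → 1ᴿ ≤ᴿ α → 1ᴿ ≤ᴿ β → ∀ F X → ¬ ¬ (∃[ n ] HasCard (F ⟨ X ⨾ H α β ⟩) n)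
  ¬¬-card α β 1≤α 1≤β F X = ¬¬-card-of-bounded (cartesianProduct box box) λ (A , B) (_ , h) →
      let hA , hB = ⊔ᴿ-≤ (α *ᴿ fromℤ (+ (ℤ.∣ A ∣ ℕ.^ 3))) (β *ᴿ fromℤ (B ℤ.^ 2)) X h
      in ∈-cartesianProduct⁺
           (∈-box A (ℕ.≤-trans (n≤n^ ℤ.∣ A ∣ 2) (M-bound α (ℤ.∣ A ∣ ℕ.^ 3) 1≤α hA)))
           (∈-box B (ℕ.≤-trans (n≤n^ ℤ.∣ B ∣ 1) (M-bound β (ℤ.∣ B ∣ ℕ.^ 2) 1≤β
             (subst (λ t → β *ᴿ fromℤ t ≤ᴿ X) (square B) hB))))
    where
    M : ℕ
    M = proj₁ (coefficient-bound X)
    M-bound : ∀ α c → 1ᴿ ≤ᴿ α → α *ᴿ fromℤ (+ c) ≤ᴿ X → c ℕ.≤ M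
    M-bound = proj₂ (coefficient-bound X)

    box : List ℤ
    box = map +_ (upTo (suc M)) ++ map -[1+_] (upTo M)

    ∈-box : ∀ i → ℤ.∣ i ∣ ℕ.≤ M → i ∈ box
    ∈-box (+ n)    h = ∈-++⁺ˡ (∈-map⁺ +_ (∈-upTo⁺ (s≤s h)))
    ∈-box -[1+ n ] h = ∈-++⁺ʳ (map +_ (upTo (suc M))) (∈-map⁺ -[1+_] (∈-upTo⁺ h))

    n≤n^ : ∀ n k → n ℕ.≤ n ℕ.^ suc k
    n≤n^ zero    k = z≤n
    n≤n^ (suc n) k = subst (ℕ._≤ suc n ℕ.* suc n ℕ.^ k) (ℕ.*-identityʳ (suc n))
      (ℕ.*-monoʳ-≤ (suc n) (ℕ.m^n>0 (suc n) k))

    square : ∀ B → B ℤ.^ 2 ≡ + (ℤ.∣ B ∣ ℕ.^ 2)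
    square (+ n) = trans (cong (+ n ℤ.*_) (ℤ.*-identityʳ (+ n)))
      (trans (sym (ℤ.pos-* n n)) (cong (λ t → + (n ℕ.* t)) (sym (ℕ.*-identityʳ n))))
    square -[1+ n ] = refl

{-# OPTIONS --safe #-}
-- For fixed j, the curves with invariant j are twists c t of one curve by nonzero integers t,
-- with height proportional to |t|^w, and c t lies in ℰ exactly when t is k-free; here (k, w) is
-- (6, 2) for j = 0, (4, 3) for j = 1728 and (2, 6) otherwise. So the ratio is Q/N, with Q the
-- number of k-free n ≤ N and N of order X^(1/w).
--
-- Sieving [1, N] by the p^k for all primes p ≤ z, one prime at a time, gives
-- |Q - N P| ≤ ∑_d min(1, N/d^k) = O(N^(1/k)) with P = ∏_{p≤z} (1 - p^(-k)) and z ≥ N, because the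
-- squarefree z-smooth numbers d are distinct. Sieving the partial sums of ∑ n^(-k) by
-- the same primes shows that P ζ(k) is within 1/z of 1.
module Submission where

open import Data.Nat using (nonTrivial)
open import Data.Integer using (+_)
open import Data.Product using (_×_)
open import Data.Rational using (ℚ; 0ℚ; _/_; -_)
open import Relation.Binary.PropositionalEquality using (_≡_; _≢_)
open import Defs using (ℝ; 1ᴿ; _≤ᴿ_; recip; ζ; 0<ζ; ℰ[_]; ℰ~[_]; H; RatioAsymptotic)

open import Data.Nat.Base as ℕ using (ℕ; zero; suc; z≤n; s≤s)
import Data.Nat.Properties as ℕ
import Data.Nat.DivMod as ℕ
import Data.Nat.Divisibility as ℕ
open import Data.Nat.Divisibility using () renaming (_∣_ to _∣ℕ_; _∣?_ to _∣ℕ?_)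
open import Data.Nat.Coprimality as Coprimality using (Coprime)
open import Data.Nat.Primality
open import Data.Nat.GCD using (gcd; gcd[m,n]∣m; gcd[m,n]∣n; gcd[m,n]≢0)
open import Data.Integer.Base as ℤ using (ℤ; +_; -[1+_]; 0ℤ)
import Data.Integer.Properties as ℤ
import Data.Integer.Divisibility as ℤ
import Data.Integer.Divisibility.Signed as ℤ-Signed
open import Data.Rational.Unnormalised.Base as ℚᵘ using (mkℚᵘ)
import Data.Rational.Unnormalised.Properties as ℚᵘ
open import Data.Rational.Base
open import Data.Rational.Properties
open import Data.Rational.Solver using (module +-*-Solver)
open import Data.List.Base using (List; []; _∷_; length; map; _++_; filter; downFrom)
open import Data.Nat.ListAction using (product)
open import Data.List.Membership.Propositional using (_∈_)
open import Data.List.Membership.Propositional.Properties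
open import Data.List.Membership.Propositional.Properties.WithK using (unique∧set⇒bag)
open import Data.List.Relation.Binary.BagAndSetEquality using (∼bag⇒↭)
open import Data.List.Relation.Binary.Permutation.Propositional.Properties using (↭-length)
import Data.List.Properties as List
import Data.List.Membership.DecPropositional as DecMembership
open import Data.Product.Properties using (≡-dec)
import Data.List.Relation.Unary.Unique.Propositional.Properties as Unique
open import Data.Nat.Primality.Factorisation using (factorise; module PrimeFactorisation)
open import Data.List.Relation.Unary.All as All using (All; []; _∷_)
import Data.List.Relation.Unary.All.Properties as All
open import Data.List.Relation.Unary.AllPairs using (AllPairs; []; _∷_)
open import Data.List.Relation.Unary.Any using (here; there)
open import Data.List.Relation.Unary.Unique.Propositional using (Unique)
open import Data.Product using (Σ-syntax; ∃-syntax; _×_; _,_; proj₁; proj₂)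
open import Data.Sum.Base using (_⊎_; inj₁; inj₂)
open import Function.Base using (_∘_)
open import Function.Bundles using (_⇔_; mk⇔; module Equivalence)
open import Relation.Nullary using (¬_; yes; no; contradiction; Dec; ¬?; _×-dec_)
open import Relation.Nullary.Decidable using (map′; decidable-stable)
open import Relation.Unary using (Pred; Decidable)
open import Level using (0ℓ)
open import Relation.Binary.PropositionalEquality
open import Algebra.Definitions.RawSemiring +-*-rawSemiring using (_^_)
open import Defs
open ℝ

-- The exponents come from comparing scales. With X of order N^w, the relative sieve error N^(1/k) /
-- N is of order X^(-(k-1)/(k w)), which is 5/12, 3/12 and 1/12 for the three pairs.
--
-- The number of squarefree products d is exponential in the number of primes up to z, so a bound
-- that charges 1 to each of them is useless. Charging min(1, N/d^k) and extending the sum to all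
-- integers d makes the bound independent of the primes used. This also frees z: with N fixed, it
-- can grow until 1/z drops below any ε.
--
-- The Euler product is never passed to a limit. All estimates are between rationals at a late index
-- of the Cauchy sequences involved, and 1/ζ(k) enters through the reciprocals of its partial sums.
--
-- Comparing reals is undecidable, so N cannot be computed from X. It is read off from the list of
-- curves that the cardinality of the denominator supplies.

fromℕ rec : ℕ → ℚ
fromℕ n = + n / 1
-- The value 0 at 0 keeps `rec` multiplicative on all of ℕ, so `rec-*` and `rec-^` need no side
-- condition.
rec zero    = 0ℚ
rec (suc n) = + 1 / suc n

abstract
  fromℕ-+ : ∀ m n → fromℕ (m ℕ.+ n) ≡ fromℕ m + fromℕ n
  fromℕ-+ m n = trans
    (fromℚᵘ-cong {mkℚᵘ (+ (m ℕ.+ n)) 0} {mkℚᵘ (+ m) 0 ℚᵘ.+ mkℚᵘ (+ n) 0} (ℚᵘ.*≡* (lem (+ m) (+ n))))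
    (fromℚᵘ-homo-+ (mkℚᵘ (+ m) 0) (mkℚᵘ (+ n) 0))
    where
    lem : ∀ i j → (i ℤ.+ j) ℤ.* + 1 ≡ (i ℤ.* + 1 ℤ.+ j ℤ.* + 1) ℤ.* + 1
    lem = ℤ+*.solve 2 (λ i j → (i :+ j) :* con (+ 1) := (i :* con (+ 1) :+ j :* con (+ 1)) :* con (+ 1)) refl
      where open ℤ+*

  fromℕ-* : ∀ m n → fromℕ (m ℕ.* n) ≡ fromℕ m * fromℕ n
  fromℕ-* m n = trans (cong (_/ 1) (ℤ.pos-* m n)) (fromℚᵘ-homo-* (mkℚᵘ (+ m) 0) (mkℚᵘ (+ n) 0))

  fromℕ-^ : ∀ m k → fromℕ (m ℕ.^ k) ≡ fromℕ m ^ k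
  fromℕ-^ m zero    = refl
  fromℕ-^ m (suc k) = trans (fromℕ-* m (m ℕ.^ k)) (cong (fromℕ m *_) (fromℕ-^ m k))

  0≤fromℕ : ∀ n → 0ℚ ≤ fromℕ n
  0≤fromℕ n = 0≤/ n 0

  fromℕ-mono-≤ : ∀ {m n} → m ℕ.≤ n → fromℕ m ≤ fromℕ n
  fromℕ-mono-≤ {m} {n} h = fromℚᵘ-mono-≤ {mkℚᵘ (+ m) 0} {mkℚᵘ (+ n) 0}
    (ℚᵘ.*≤* (subst₂ ℤ._≤_ (ℤ.pos-* m 1) (ℤ.pos-* n 1) (ℤ.+≤+ (ℕ.*-monoˡ-≤ 1 h))))

  0<fromℕ : ∀ n .{{_ : ℕ.NonZero n}} → 0ℚ < fromℕ n
  0<fromℕ (suc n) = <-≤-trans 0<1 (fromℕ-mono-≤ {1} {suc n} (s≤s z≤n))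

  1≤fromℕ : ∀ n .{{_ : ℕ.NonZero n}} → 1ℚ ≤ fromℕ n
  1≤fromℕ (suc n) = fromℕ-mono-≤ {1} {suc n} (s≤s z≤n)

  0≤rec : ∀ n → 0ℚ ≤ rec n
  0≤rec zero    = ≤-refl
  0≤rec (suc n) = 0≤/ 1 n

  rec≤1 : ∀ n → rec n ≤ 1ℚ
  rec≤1 zero    = <⇒≤ 0<1
  rec≤1 (suc n) = 1/suc≤1 n

  rec-* : ∀ m n → rec (m ℕ.* n) ≡ rec m * rec n
  rec-* zero    n       = sym (*-zeroˡ (rec n))
  rec-* (suc m) zero    = trans (cong rec (ℕ.*-zeroʳ m)) (sym (*-zeroʳ (rec (suc m))))
  rec-* (suc m) (suc n) = fromℚᵘ-homo-* (mkℚᵘ (+ 1) m) (mkℚᵘ (+ 1) n)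

  rec-^ : ∀ n k → rec (n ℕ.^ k) ≡ rec n ^ k
  rec-^ n zero    = refl
  rec-^ n (suc k) = trans (rec-* n (n ℕ.^ k)) (cong (rec n *_) (rec-^ n k))

  fromℕ*rec : ∀ n .{{_ : ℕ.NonZero n}} → fromℕ n * rec n ≡ 1ℚ
  fromℕ*rec (suc n) = trans (sym (fromℚᵘ-homo-* (mkℚᵘ (+ suc n) 0) (mkℚᵘ (+ 1) n)))
    (fromℚᵘ-cong {mkℚᵘ (+ suc n) 0 ℚᵘ.* mkℚᵘ (+ 1) n} {mkℚᵘ (+ 1) 0} (ℚᵘ.*≡* (cong +_ (lem n))))
    where
    lem : ∀ n → suc n ℕ.* 1 ℕ.* 1 ≡ 1 ℕ.* (1 ℕ.* suc n)
    lem = ℕ+*.solve 1 (λ n → (con 1 :+ n) :* con 1 :* con 1 := con 1 :* (con 1 :* (con 1 :+ n))) refl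
      where open ℕ+*

  /≡*rec : ∀ m n .{{_ : ℕ.NonZero n}} → + m / n ≡ fromℕ m * rec n
  /≡*rec m (suc n) = trans
    (fromℚᵘ-cong {mkℚᵘ (+ m) n} {mkℚᵘ (+ m) 0 ℚᵘ.* mkℚᵘ (+ 1) n}
      (ℚᵘ.*≡* (lem (+ m) (+ suc n))))
    (fromℚᵘ-homo-* (mkℚᵘ (+ m) 0) (mkℚᵘ (+ 1) n))
    where
    lem : ∀ m n → m ℤ.* (+ 1 ℤ.* n) ≡ m ℤ.* + 1 ℤ.* n
    lem = ℤ+*.solve 2 (λ m n → m :* (con (+ 1) :* n) := m :* con (+ 1) :* n) refl
      where open ℤ+*

  *-monoˡ : ∀ {p q} r → 0ℚ ≤ r → p ≤ q → r * p ≤ r * q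
  *-monoˡ r h = *-monoˡ-≤-nonNeg r {{nonNegative h}}

  *-monoʳ : ∀ {p q} r → 0ℚ ≤ r → p ≤ q → p * r ≤ q * r
  *-monoʳ r h = *-monoʳ-≤-nonNeg r {{nonNegative h}}

  p≤q*p : ∀ {p q} → 0ℚ ≤ p → 1ℚ ≤ q → p ≤ q * p
  p≤q*p {p} {q} 0≤p 1≤q = subst (_≤ q * p) (*-identityˡ p) (*-monoʳ p 0≤p 1≤q)

  q*p≤p : ∀ {p q} → 0ℚ ≤ p → q ≤ 1ℚ → q * p ≤ p
  q*p≤p {p} {q} 0≤p q≤1 = subst (q * p ≤_) (*-identityˡ p) (*-monoʳ p 0≤p q≤1)

  rec-anti : ∀ {m n} .{{_ : ℕ.NonZero m}} → m ℕ.≤ n → rec n ≤ rec m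
  rec-anti {suc m} {suc n} h = fromℚᵘ-mono-≤ {mkℚᵘ (+ 1) n} {mkℚᵘ (+ 1) m}
    (ℚᵘ.*≤* (subst₂ ℤ._≤_ (ℤ.pos-* 1 (suc m)) (ℤ.pos-* 1 (suc n)) (ℤ.+≤+ (ℕ.*-monoʳ-≤ 1 h))))

  ^-distribʳ-* : ∀ n p q → (p * q) ^ n ≡ p ^ n * q ^ n
  ^-distribʳ-* zero    p q = refl
  ^-distribʳ-* (suc n) p q = trans (cong (p * q *_) (^-distribʳ-* n p q)) (lem p q (p ^ n) (q ^ n))
    where
    lem : ∀ p q r s → p * q * (r * s) ≡ p * r * (q * s)
    lem = solve 4 (λ p q r s → p :* q :* (r :* s) := p :* r :* (q :* s)) refl where open +-*-Solver

  ^-+ : ∀ p m n → p ^ (m ℕ.+ n) ≡ p ^ m * p ^ n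
  ^-+ p zero    n = sym (*-identityˡ (p ^ n))
  ^-+ p (suc m) n = trans (cong (p *_) (^-+ p m n)) (sym (*-assoc p (p ^ m) (p ^ n)))

  ^-* : ∀ p m n → p ^ (m ℕ.* n) ≡ (p ^ n) ^ m
  ^-* p zero    n = refl
  ^-* p (suc m) n = trans (^-+ p n (m ℕ.* n)) (cong (p ^ n *_) (^-* p m n))

-- Finite sums and the removal of multiples

∑ : (ℕ → ℚ) → ℕ → ℚ
∑ f zero    = 0ℚ
∑ f (suc n) = ∑ f n + f (suc n)

abstract
  ∑-cong : ∀ {f g} n → (∀ i → f i ≡ g i) → ∑ f n ≡ ∑ g n
  ∑-cong zero    h = refl
  ∑-cong (suc n) h = cong₂ _+_ (∑-cong n h) (h (suc n))

  ∑-mono : ∀ {f g} n → (∀ i → f i ≤ g i) → ∑ f n ≤ ∑ g n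
  ∑-mono zero    h = ≤-refl
  ∑-mono (suc n) h = +-mono-≤ (∑-mono n h) (h (suc n))

  ∑-+ : ∀ f g n → ∑ (λ i → f i + g i) n ≡ ∑ f n + ∑ g n
  ∑-+ f g zero    = refl
  ∑-+ f g (suc n) = trans (cong (_+ (f (suc n) + g (suc n))) (∑-+ f g n))
    (lem (∑ f n) (∑ g n) (f (suc n)) (g (suc n)))
    where
    lem : ∀ a b c d → a + b + (c + d) ≡ a + c + (b + d)
    lem = solve 4 (λ a b c d → a :+ b :+ (c :+ d) := a :+ c :+ (b :+ d)) refl where open +-*-Solver

  ∑-*ˡ : ∀ c f n → ∑ (λ i → c * f i) n ≡ c * ∑ f n
  ∑-*ˡ c f zero    = sym (*-zeroʳ c)
  ∑-*ˡ c f (suc n) = trans (cong (_+ c * f (suc n)) (∑-*ˡ c f n)) (sym (*-distribˡ-+ c (∑ f n) (f (suc n))))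

  ∑-const : ∀ c n → ∑ (λ _ → c) n ≡ fromℕ n * c
  ∑-const c zero    = sym (*-zeroˡ c)
  ∑-const c (suc n) = begin
    ∑ (λ _ → c) n + c        ≡⟨ cong₂ _+_ (∑-const c n) (sym (*-identityˡ c)) ⟩
    fromℕ n * c + 1ℚ * c     ≡⟨ *-distribʳ-+ c (fromℕ n) 1ℚ ⟨
    (fromℕ n + 1ℚ) * c       ≡⟨ cong (_* c) (suc/ n 0) ⟨
    fromℕ (suc n) * c        ∎
    where open ≡-Reasoning

  ∑-split : ∀ f m n → ∑ f (m ℕ.+ n) ≡ ∑ f m + ∑ (λ i → f (m ℕ.+ i)) n
  ∑-split f m zero    = trans (cong (∑ f) (ℕ.+-identityʳ m)) (sym (+-identityʳ (∑ f m)))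
  ∑-split f m (suc n) = begin
    ∑ f (m ℕ.+ suc n)                         ≡⟨ cong (∑ f) (ℕ.+-suc m n) ⟩
    ∑ f (m ℕ.+ n) + f (suc (m ℕ.+ n))
      ≡⟨ cong₂ _+_ (∑-split f m n) (cong f (sym (ℕ.+-suc m n))) ⟩
    ∑ f m + ∑ (λ i → f (m ℕ.+ i)) n + f (m ℕ.+ suc n)
      ≡⟨ +-assoc (∑ f m) (∑ (λ i → f (m ℕ.+ i)) n) (f (m ℕ.+ suc n)) ⟩
    ∑ f m + ∑ (λ i → f (m ℕ.+ i)) (suc n)     ∎
    where open ≡-Reasoning

  0≤∑ : ∀ {f} n → (∀ i → 0ℚ ≤ f i) → 0ℚ ≤ ∑ f n
  0≤∑ zero    h = ≤-refl
  0≤∑ (suc n) h = 0≤+ (0≤∑ n h) (h (suc n))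

  ∑-monoʳ : ∀ {f m n} → (∀ i → 0ℚ ≤ f i) → m ℕ.≤ n → ∑ f m ≤ ∑ f n
  ∑-monoʳ {f} {m} {n} h m≤n = subst (λ t → ∑ f m ≤ ∑ f t) (ℕ.m+[n∸m]≡n m≤n)
    (subst (∑ f m ≤_) (sym (∑-split f m (n ℕ.∸ m))) (p≤p+ (0≤∑ (n ℕ.∸ m) (λ i → h (m ℕ.+ i)))))

  -- Meant for a sifted f and the unsifted g: the Cauchy property of the sums of g then controls the
  -- increments of the sums of f.
  ∑-increment : ∀ {f g m n} → (∀ i → 0ℚ ≤ f i) → (∀ i → f i ≤ g i) → m ℕ.≤ n →
    ∑ f n - ∑ f m ≤ ∑ g n - ∑ g m
  ∑-increment {f} {g} {m} {n} 0≤f f≤g m≤n = subst (λ t → ∑ f t - ∑ f m ≤ ∑ g t - ∑ g m) (ℕ.m+[n∸m]≡n m≤n)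
    (subst₂ _≤_ (sym (eq f)) (sym (eq g)) (∑-mono (n ℕ.∸ m) (λ i → f≤g (m ℕ.+ i))))
    where
    eq : ∀ f → ∑ f (m ℕ.+ (n ℕ.∸ m)) - ∑ f m ≡ ∑ (λ i → f (m ℕ.+ i)) (n ℕ.∸ m)
    eq f = trans (cong (_- ∑ f m) (∑-split f m (n ℕ.∸ m))) ([q+e]-q≡e (∑ f m) _)

_∤·_ : ℕ → (ℕ → ℚ) → ℕ → ℚ
(q ∤· f) n with q ∣ℕ? n
... | yes _ = 0ℚ
... | no  _ = f n

abstract
  ∤·-yes : ∀ {q n} f → q ∣ℕ n → (q ∤· f) n ≡ 0ℚ
  ∤·-yes {q} {n} f h with q ∣ℕ? n
  ... | yes _ = refl
  ... | no  k = contradiction h k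

  ∤·-no : ∀ {q n} f → ¬ q ∣ℕ n → (q ∤· f) n ≡ f n
  ∤·-no {q} {n} f h with q ∣ℕ? n
  ... | yes k = contradiction k h
  ... | no  _ = refl

  ∤·-0≤ : ∀ {q f} → (∀ i → 0ℚ ≤ f i) → ∀ n → 0ℚ ≤ (q ∤· f) n
  ∤·-0≤ {q} h n with q ∣ℕ? n
  ... | yes _ = ≤-refl
  ... | no  _ = h n

  ∤·-≤ : ∀ {q f} → (∀ i → 0ℚ ≤ f i) → ∀ n → (q ∤· f) n ≤ f n
  ∤·-≤ {q} h n with q ∣ℕ? n
  ... | yes _ = h n
  ... | no  _ = ≤-refl

  -- Induction along division with remainder: raising r adds a nonmultiple of q, and passing from r
  -- = q - 1 to the next y adds the multiple q (y + 1). In this form no floor has to be unfolded.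
  ∑-multiples-block : ∀ q f y r → r ℕ.< q →
    ∑ f (y ℕ.* q ℕ.+ r) ≡ ∑ (q ∤· f) (y ℕ.* q ℕ.+ r) + ∑ (λ i → f (q ℕ.* i)) y
  ∑-multiples-block q f zero zero h = refl
  ∑-multiples-block (suc q) f (suc y) zero h =
    trans (cong (∑ f) eq) (trans step (cong (λ t → ∑ (suc q ∤· f) t + ∑ (λ i → f (suc q ℕ.* i)) (suc y)) (sym eq)))
    where
    open ≡-Reasoning
    x : ℕ
    x = y ℕ.* suc q ℕ.+ q
    eq : suc y ℕ.* suc q ℕ.+ 0 ≡ suc x
    eq = trans (ℕ.+-identityʳ _) (cong suc (ℕ.+-comm q (y ℕ.* suc q)))
    eq′ : suc x ≡ suc q ℕ.* suc y
    eq′ = trans (sym eq) (trans (ℕ.+-identityʳ _) (ℕ.*-comm (suc y) (suc q)))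
    lem : ∀ a b c → a + b + c ≡ a + 0ℚ + (b + c)
    lem = solve 3 (λ a b c → a :+ b :+ c := a :+ con 0ℚ :+ (b :+ c)) refl where open +-*-Solver
    step : ∑ f (suc x) ≡ ∑ (suc q ∤· f) (suc x) + ∑ (λ i → f (suc q ℕ.* i)) (suc y)
    step = begin
      ∑ f x + f (suc x)
        ≡⟨ cong₂ _+_ (∑-multiples-block (suc q) f y q ℕ.≤-refl) (cong f eq′) ⟩
      ∑ (suc q ∤· f) x + ∑ (λ i → f (suc q ℕ.* i)) y + f (suc q ℕ.* suc y)
        ≡⟨ lem (∑ (suc q ∤· f) x) _ _ ⟩
      ∑ (suc q ∤· f) x + 0ℚ + ∑ (λ i → f (suc q ℕ.* i)) (suc y)
        ≡⟨ cong (λ t → ∑ (suc q ∤· f) x + t + ∑ (λ i → f (suc q ℕ.* i)) (suc y))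
             (∤·-yes f (subst (suc q ∣ℕ_) (sym eq′) (ℕ.m∣m*n (suc y)))) ⟨
      ∑ (suc q ∤· f) (suc x) + ∑ (λ i → f (suc q ℕ.* i)) (suc y) ∎
  ∑-multiples-block q f y (suc r) h =
    trans (cong (∑ f) eq) (trans step (cong (λ t → ∑ (q ∤· f) t + ∑ (λ i → f (q ℕ.* i)) y) (sym eq)))
    where
    open ≡-Reasoning
    x : ℕ
    x = y ℕ.* q ℕ.+ r
    eq : y ℕ.* q ℕ.+ suc r ≡ suc x
    eq = ℕ.+-suc (y ℕ.* q) r
    q∤ : ¬ q ∣ℕ suc x
    q∤ d = ℕ.>⇒∤ h (ℕ.∣m+n∣m⇒∣n (subst (q ∣ℕ_) (sym eq) d) (ℕ.n∣m*n y))
    lem : ∀ a b c → a + b + c ≡ a + c + b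
    lem = solve 3 (λ a b c → a :+ b :+ c := a :+ c :+ b) refl where open +-*-Solver
    step : ∑ f (suc x) ≡ ∑ (q ∤· f) (suc x) + ∑ (λ i → f (q ℕ.* i)) y
    step = begin
      ∑ f x + f (suc x)
        ≡⟨ cong (_+ f (suc x)) (∑-multiples-block q f y r (ℕ.<⇒≤ h)) ⟩
      ∑ (q ∤· f) x + ∑ (λ i → f (q ℕ.* i)) y + f (suc x)
        ≡⟨ lem (∑ (q ∤· f) x) _ _ ⟩
      ∑ (q ∤· f) x + f (suc x) + ∑ (λ i → f (q ℕ.* i)) y
        ≡⟨ cong (λ t → ∑ (q ∤· f) x + t + ∑ (λ i → f (q ℕ.* i)) y) (∤·-no f q∤) ⟨
      ∑ (q ∤· f) (suc x) + ∑ (λ i → f (q ℕ.* i)) y ∎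

  ∑-multiples : ∀ q .{{_ : ℕ.NonZero q}} f x →
    ∑ f x ≡ ∑ (q ∤· f) x + ∑ (λ i → f (q ℕ.* i)) (x ℕ./ q)
  ∑-multiples q f x = subst (λ t → ∑ f t ≡ ∑ (q ∤· f) t + ∑ (λ i → f (q ℕ.* i)) (x ℕ./ q))
    (trans (ℕ.+-comm (x ℕ./ q ℕ.* q) (x ℕ.% q)) (sym (ℕ.m≡m%n+[m/n]*n x q)))
    (∑-multiples-block q f (x ℕ./ q) (x ℕ.% q) (ℕ.m%n<n x q))

-- Sieving by pairwise coprime moduli

nonZero-^ : ∀ {p} → ℕ.NonZero p → ∀ k → ℕ.NonZero (p ℕ.^ k)
nonZero-^ {p} h k = ℕ.m^n≢0 p k {{h}}

^ℕ-distribʳ-* : ∀ k m n → (m ℕ.* n) ℕ.^ k ≡ m ℕ.^ k ℕ.* n ℕ.^ k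
^ℕ-distribʳ-* zero    m n = refl
^ℕ-distribʳ-* (suc k) m n = trans (cong (m ℕ.* n ℕ.*_) (^ℕ-distribʳ-* k m n))
  (ℕ.[m*n]*[o*p]≡[m*o]*[n*p] m n (m ℕ.^ k) (n ℕ.^ k))

coprime-* : ∀ {m n o} → Coprime m o → Coprime n o → Coprime (m ℕ.* n) o
coprime-* {m} {n} {o} c c′ {d} (d∣mn , d∣o) = c′ (Coprimality.coprime-divisor d⊥m d∣mn , d∣o)
  where
  d⊥m : Coprime d m
  d⊥m (e∣d , e∣m) = c (e∣m , ℕ.∣-trans e∣d d∣o)

coprime-^ˡ : ∀ {m n} k → Coprime m n → Coprime (m ℕ.^ k) n
coprime-^ˡ {n = n} zero    c = Coprimality.1-coprimeTo n
coprime-^ˡ         (suc k) c = coprime-* c (coprime-^ˡ k c)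

coprime-^ : ∀ {m n} k l → Coprime m n → Coprime (m ℕ.^ k) (n ℕ.^ l)
coprime-^ k l c = coprime-^ˡ k (Coprimality.sym (coprime-^ˡ l (Coprimality.sym c)))

-- The sieve acts on weights and not on sets of integers, so that one operator serves both the count
-- of k-free integers (weight 1) and the partial sums of ζ(k) (weight i^(-k)).
sift : List ℕ → (ℕ → ℚ) → ℕ → ℚ
sift []      w = w
sift (q ∷ L) w = q ∤· sift L w

abstract
  sift-0≤ : ∀ L {w} → (∀ i → 0ℚ ≤ w i) → ∀ n → 0ℚ ≤ sift L w n
  sift-0≤ []      h = h
  sift-0≤ (q ∷ L) h = ∤·-0≤ {q} (sift-0≤ L h)

  sift-≤ : ∀ L {w} → (∀ i → 0ℚ ≤ w i) → ∀ n → sift L w n ≤ w n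
  sift-≤ []      h n = ≤-refl
  sift-≤ (q ∷ L) h n = ≤-trans (∤·-≤ {q} (sift-0≤ L h) n) (sift-≤ L h n)

  sift-scale : ∀ L c w n → sift L (λ i → c * w i) n ≡ c * sift L w n
  sift-scale []      c w n = refl
  sift-scale (q ∷ L) c w n with q ∣ℕ? n
  ... | yes _ = sym (*-zeroʳ c)
  ... | no  _ = sift-scale L c w n

  sift-cong : ∀ L {v w} → (∀ i → v i ≡ w i) → ∀ n → sift L v n ≡ sift L w n
  sift-cong []      h n = h n
  sift-cong (q ∷ L) h n with q ∣ℕ? n
  ... | yes _ = refl
  ... | no  _ = sift-cong L h n

  -- For r coprime to q, r divides q n exactly when it divides n. Hence the removed multiples of q
  -- form a sieve problem of the same kind.
  sift-dilate : ∀ {q} L w → All (Coprime q) L →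
    ∀ n → sift L w (q ℕ.* n) ≡ sift L (λ i → w (q ℕ.* i)) n
  sift-dilate     []      w []      n = refl
  sift-dilate {q} (r ∷ L) w (c ∷ cs) n with r ∣ℕ? n
  ... | yes r∣n = ∤·-yes {r} (sift L w) (ℕ.∣n⇒∣m*n q r∣n)
  ... | no  r∤n = trans
    (∤·-no {r} (sift L w) (λ r∣qn → r∤n (Coprimality.coprime-divisor (Coprimality.sym c) r∣qn)))
    (sift-dilate L w cs n)

  -- One inclusion-exclusion step of Legendre's sieve. Iterating it over the primes takes the place
  -- of the Möbius function, both for the counts and for the Euler product.
  ∑-sift-∷ : ∀ q .{{_ : ℕ.NonZero q}} L w x → All (Coprime q) L →
    ∑ (sift (q ∷ L) w) x ≡ ∑ (sift L w) x - ∑ (sift L (λ i → w (q ℕ.* i))) (x ℕ./ q)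
  ∑-sift-∷ q L w x cs = begin
    a                    ≡⟨ lem a b ⟩
    a + b - b            ≡⟨ cong₂ _-_ (sym (∑-multiples q (sift L w) x)) (∑-cong (x ℕ./ q) (sift-dilate L w cs)) ⟩
    ∑ (sift L w) x - ∑ (sift L (λ i → w (q ℕ.* i))) (x ℕ./ q) ∎
    where
    open ≡-Reasoning
    a b : ℚ
    a = ∑ (sift (q ∷ L) w) x
    b = ∑ (λ i → sift L w (q ℕ.* i)) (x ℕ./ q)
    lem : ∀ a b → a ≡ a + b - b
    lem = solve 2 (λ a b → a := a :+ b :- b) refl where open +-*-Solver

eulerProduct : ℕ → List ℕ → ℚ
eulerProduct k []      = 1ℚ
eulerProduct k (p ∷ L) = (1ℚ - rec p ^ k) * eulerProduct k L

-- For distinct primes this is the sum over the squarefree d composed of them. The recursion follows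
-- the sieve, where each prime doubles the number of terms.
subproductSum : List ℕ → (ℕ → ℚ) → ℚ
subproductSum []      f = f 1
subproductSum (p ∷ L) f = subproductSum L f + subproductSum L (λ d → f (p ℕ.* d))

-- The error of replacing ⌊N/D⌋ by N/D. The bound N/D matters for large D, where the floor is 0:
-- without it the errors could not be summed over all d.
roundingBound : ℕ → ℕ → ℚ
roundingBound N D = 1ℚ ⊓ (fromℕ N * rec D)

abstract
  subproductSum-cong : ∀ L {f g} → (∀ n → f n ≡ g n) → subproductSum L f ≡ subproductSum L g
  subproductSum-cong []      h = h 1
  subproductSum-cong (p ∷ L) h = cong₂ _+_ (subproductSum-cong L h) (subproductSum-cong L (λ d → h (p ℕ.* d)))

  subproductSum-cong-∤ : ∀ {q} L {f g} → q ≢ 1 → All (Coprime q) L →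
    (∀ n → ¬ q ∣ℕ n → f n ≡ g n) → subproductSum L f ≡ subproductSum L g
  subproductSum-cong-∤ []      q≢1 []       h = h 1 (λ q∣1 → q≢1 (ℕ.∣1⇒≡1 q∣1))
  subproductSum-cong-∤ (p ∷ L) q≢1 (c ∷ cs) h = cong₂ _+_ (subproductSum-cong-∤ L q≢1 cs h)
    (subproductSum-cong-∤ L q≢1 cs (λ n q∤n → h (p ℕ.* n) (λ q∣pn → q∤n (Coprimality.coprime-divisor c q∣pn))))

  -- This is the distinctness of the subproducts, without listing them. Those that omit p are not
  -- divisible by p, those that contain p are multiples of p, and `∑-multiples` splits the sum over
  -- all integers in the same way.
  subproductSum-≤ : ∀ L {f} → (∀ n → 0ℚ ≤ f n) → All ℕ.NonZero L → All (_≢ 1) L → AllPairs Coprime L →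
    subproductSum L f ≤ ∑ f (product L)
  subproductSum-≤ []      {f} h []        []        []       = ≤-reflexive (sym (+-identityˡ (f 1)))
  subproductSum-≤ (p ∷ L) {f} h (nz ∷ nzs) (p≢1 ∷ ≢1s) (c ∷ cs) = begin
    subproductSum L f + subproductSum L (λ d → f (p ℕ.* d))
      ≡⟨ cong (_+ subproductSum L (λ d → f (p ℕ.* d)))
           (subproductSum-cong-∤ L p≢1 c (λ n p∤n → sym (∤·-no f p∤n))) ⟩
    subproductSum L (p ∤· f) + subproductSum L (λ d → f (p ℕ.* d))
      ≤⟨ +-mono-≤ (subproductSum-≤ L (∤·-0≤ {p} h) nzs ≢1s cs)
                  (subproductSum-≤ L (λ n → h (p ℕ.* n)) nzs ≢1s cs) ⟩
    ∑ (p ∤· f) (product L) + ∑ (λ d → f (p ℕ.* d)) (product L)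
      ≤⟨ +-monoˡ-≤ _ (∑-monoʳ (∤·-0≤ {p} h) (ℕ.m≤n*m (product L) p)) ⟩
    ∑ (p ∤· f) (p ℕ.* product L) + ∑ (λ d → f (p ℕ.* d)) (product L)
      ≡⟨ cong (λ t → ∑ (p ∤· f) (p ℕ.* product L) + ∑ (λ d → f (p ℕ.* d)) t)
           (trans (cong (ℕ._/ p) (ℕ.*-comm p (product L))) (ℕ.m*n/n≡m (product L) p)) ⟨
    ∑ (p ∤· f) (p ℕ.* product L) + ∑ (λ d → f (p ℕ.* d)) ((p ℕ.* product L) ℕ./ p)
      ≡⟨ ∑-multiples p f (p ℕ.* product L) ⟨
    ∑ f (p ℕ.* product L) ∎
    where
    open ≤-Reasoning
    instance
      p≢0 : ℕ.NonZero p
      p≢0 = nz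

  rounding : ∀ N D .{{_ : ℕ.NonZero D}} → ∣ fromℕ (N ℕ./ D) - fromℕ N * rec D ∣ ≤ roundingBound N D
  rounding N D = ∣-∣≤
    (≤-trans floor≤ (p≤p+ (⊓-glb (<⇒≤ 0<1) (0≤* (0≤fromℕ N) (0≤rec D)))))
    -- Here x ≤ y + 1 by division with remainder and x ≤ y + x as y ≥ 0, so x ≤ y + min(1, x).
    (subst (x ≤_) (sym (mono-≤-distrib-⊓ (+-monoʳ-≤ y) 1ℚ x)) (⊓-glb x≤floor+1
      (subst (_≤ y + x) (+-identityˡ x) (+-monoˡ-≤ x (0≤fromℕ (N ℕ./ D))))))
    where
    open ≤-Reasoning
    x y : ℚ
    x = fromℕ N * rec D
    y = fromℕ (N ℕ./ D)
    unscale : ∀ m → fromℕ (m ℕ.* D) * rec D ≡ fromℕ m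
    unscale m = trans (cong (_* rec D) (fromℕ-* m D)) (trans (*-assoc (fromℕ m) (fromℕ D) (rec D))
      (trans (cong (fromℕ m *_) (fromℕ*rec D)) (*-identityʳ (fromℕ m))))
    floor≤ : y ≤ x
    floor≤ = subst (_≤ x) (unscale (N ℕ./ D)) (*-monoʳ (rec D) (0≤rec D) (fromℕ-mono-≤ (ℕ.m/n*n≤m N D)))
    N≤ : N ℕ.≤ suc (N ℕ./ D) ℕ.* D
    N≤ = subst (ℕ._≤ suc (N ℕ./ D) ℕ.* D) (sym (ℕ.m≡m%n+[m/n]*n N D))
      (ℕ.+-monoˡ-≤ (N ℕ./ D ℕ.* D) (ℕ.<⇒≤ (ℕ.m%n<n N D)))
    x≤floor+1 : x ≤ y + 1ℚ
    x≤floor+1 = subst (x ≤_) (trans (unscale (suc (N ℕ./ D))) (suc/ (N ℕ./ D) 0))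
      (*-monoʳ (rec D) (0≤rec D) (fromℕ-mono-≤ N≤))

  -- The divisor D serves the induction: removing multiples of p^k leaves the same problem at
  -- ⌊⌊N/D⌋/p^k⌋ = ⌊N/(D p^k)⌋. The main terms combine exactly, as P x - P x p^(-k) = (1 - p^(-k)) P
  -- x, so only rounding errors remain, one for each subproduct d.
  sift-error : ∀ k N L → All ℕ.NonZero L → AllPairs Coprime L → ∀ D .{{_ : ℕ.NonZero D}} →
    ∣ ∑ (sift (map (ℕ._^ k) L) (λ _ → 1ℚ)) (N ℕ./ D) - eulerProduct k L * (fromℕ N * rec D) ∣
      ≤ subproductSum L (λ d → roundingBound N (D ℕ.* d ℕ.^ k))
  sift-error k N [] [] [] D = subst₂ (λ s t → ∣ s - t ∣ ≤ roundingBound N (D ℕ.* 1 ℕ.^ k))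
    (sym (trans (∑-const 1ℚ (N ℕ./ D)) (*-identityʳ (fromℕ (N ℕ./ D)))))
    (sym (*-identityˡ (fromℕ N * rec D)))
    (subst (λ t → ∣ fromℕ (N ℕ./ D) - fromℕ N * rec D ∣ ≤ roundingBound N t)
      (sym (trans (cong (D ℕ.*_) (ℕ.^-zeroˡ k)) (ℕ.*-identityʳ D))) (rounding N D))
  sift-error k N (p ∷ L) (nz ∷ nzs) (c ∷ cs) D = begin
    ∣ ∑ (sift (q ∷ L′) (λ _ → 1ℚ)) (N ℕ./ D) - (1ℚ - u) * P * x ∣
      ≡⟨ cong (λ t → ∣ t - (1ℚ - u) * P * x ∣) (trans (∑-sift-∷ q L′ (λ _ → 1ℚ) (N ℕ./ D) c′)
           (cong (λ t → S - ∑ (sift L′ (λ _ → 1ℚ)) t) (ℕ.m/n/o≡m/[n*o] N D q))) ⟩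
    ∣ S - S′ - (1ℚ - u) * P * x ∣               ≡⟨ cong ∣_∣ (lem S S′ u P x) ⟩
    ∣ (S - P * x) - (S′ - P * (x * u)) ∣        ≤⟨ ∣p-q∣≤∣p∣+∣q∣ (S - P * x) (S′ - P * (x * u)) ⟩
    ∣ S - P * x ∣ + ∣ S′ - P * (x * u) ∣
      ≤⟨ +-mono-≤ (sift-error k N L nzs cs D)
           (subst (λ t → ∣ S′ - P * t ∣ ≤ subproductSum L (λ d → roundingBound N (D ℕ.* q ℕ.* d ℕ.^ k))) xu
             (sift-error k N L nzs cs (D ℕ.* q))) ⟩
    subproductSum L (λ d → roundingBound N (D ℕ.* d ℕ.^ k)) + subproductSum L (λ d → roundingBound N (D ℕ.* q ℕ.* d ℕ.^ k))
      ≡⟨ cong (λ t → subproductSum L (λ d → roundingBound N (D ℕ.* d ℕ.^ k)) + t)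
           (subproductSum-cong L (λ d → cong (roundingBound N) (trans (ℕ.*-assoc D q (d ℕ.^ k))
             (cong (D ℕ.*_) (sym (^ℕ-distribʳ-* k p d)))))) ⟩
    subproductSum (p ∷ L) (λ d → roundingBound N (D ℕ.* d ℕ.^ k)) ∎
    where
    open ≤-Reasoning
    q : ℕ
    q = p ℕ.^ k
    instance
      q≢0 : ℕ.NonZero q
      q≢0 = nonZero-^ nz k
      Dq≢0 : ℕ.NonZero (D ℕ.* q)
      Dq≢0 = ℕ.m*n≢0 D q
    L′ : List ℕ
    L′ = map (ℕ._^ k) L
    c′ : All (Coprime q) L′
    c′ = All.map⁺ (All.map (coprime-^ k k) c)
    u P x S S′ : ℚ
    u = rec p ^ k
    P = eulerProduct k L
    x = fromℕ N * rec D
    S = ∑ (sift L′ (λ _ → 1ℚ)) (N ℕ./ D)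
    S′ = ∑ (sift L′ (λ _ → 1ℚ)) (N ℕ./ (D ℕ.* q))
    xu : fromℕ N * rec (D ℕ.* q) ≡ x * u
    xu = trans (cong (fromℕ N *_) (trans (rec-* D q) (cong (rec D *_) (rec-^ p k))))
      (sym (*-assoc (fromℕ N) (rec D) u))
    lem : ∀ S S′ u P x → S - S′ - (1ℚ - u) * P * x ≡ (S - P * x) - (S′ - P * (x * u))
    lem = solve 5 (λ S S′ u P x → S :- S′ :- (con 1ℚ :- u) :* P :* x := (S :- P :* x) :- (S′ :- P :* (x :* u))) refl
      where open +-*-Solver

  ζ-sum≡∑ : ∀ k n → ζ-sum k n ≡ ∑ (λ i → rec i ^ k) n
  ζ-sum≡∑ k zero    = refl
  ζ-sum≡∑ k (suc n) = cong (_+ rec (suc n) ^ k) (ζ-sum≡∑ k n)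

  0≤rec^ : ∀ k i → 0ℚ ≤ rec i ^ k
  0≤rec^ k i = 0≤^ k (0≤rec i)

  -- By `ζ-sum-tail`, the partial sum up to n plus 1/n is nonincreasing in n.
  ∑-rec²-tail : ∀ R .{{_ : ℕ.NonZero R}} M → ∑ (λ i → rec (R ℕ.+ i) ^ 2) M ≤ rec R
  ∑-rec²-tail (suc r) M = begin
    T                                   ≡⟨ [q+e]-q≡e Z T ⟨
    (Z + T) - Z                         ≡⟨ cong (_- Z) (∑-split (λ i → rec i ^ 2) (suc r) M) ⟨
    ∑ (λ i → rec i ^ 2) (suc r ℕ.+ M) - Z
      ≤⟨ p≤q+e⇒p-q≤e {∑ (λ i → rec i ^ 2) (suc r ℕ.+ M)} {Z} (≤-trans (p≤p+ {rec (suc r ℕ.+ M)} (0≤rec (suc r ℕ.+ M)))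
           (subst₂ (λ s t → s + rec (suc r ℕ.+ M) ≤ t + rec (suc r)) (ζ-sum≡∑ 2 (suc r ℕ.+ M)) (ζ-sum≡∑ 2 (suc r))
             (ζ-sum-tail 0 (ℕ.m≤m+n r M)))) ⟩
    rec (suc r)                         ∎
    where
    open ≤-Reasoning
    Z T : ℚ
    Z = ∑ (λ i → rec i ^ 2) (suc r)
    T = ∑ (λ i → rec (suc r ℕ.+ i) ^ 2) M

  ∑-rec^-tail : ∀ s R .{{_ : ℕ.NonZero R}} M → ∑ (λ i → rec (R ℕ.+ i) ^ (2 ℕ.+ s)) M ≤ rec R ^ suc s
  ∑-rec^-tail s R M = begin
    ∑ (λ i → rec (R ℕ.+ i) ^ (2 ℕ.+ s)) M
      ≤⟨ ∑-mono M (λ i → subst (_≤ rec R ^ s * rec (R ℕ.+ i) ^ 2) (eq i)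
           (*-monoʳ (rec (R ℕ.+ i) ^ 2) (0≤rec^ 2 (R ℕ.+ i))
             (^-mono s (0≤rec (R ℕ.+ i)) (rec-anti (ℕ.m≤m+n R i))))) ⟩
    ∑ (λ i → rec R ^ s * rec (R ℕ.+ i) ^ 2) M  ≡⟨ ∑-*ˡ (rec R ^ s) (λ i → rec (R ℕ.+ i) ^ 2) M ⟩
    rec R ^ s * ∑ (λ i → rec (R ℕ.+ i) ^ 2) M  ≤⟨ *-monoˡ (rec R ^ s) (0≤rec^ s R) (∑-rec²-tail R M) ⟩
    rec R ^ s * rec R                          ≡⟨ *-comm (rec R ^ s) (rec R) ⟩
    rec R ^ suc s                              ∎
    where
    open ≤-Reasoning
    eq : ∀ i → rec (R ℕ.+ i) ^ s * rec (R ℕ.+ i) ^ 2 ≡ rec (R ℕ.+ i) ^ (2 ℕ.+ s)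
    eq i = lem (rec (R ℕ.+ i)) (rec (R ℕ.+ i) ^ s)
      where
      lem : ∀ r t → t * (r * (r * 1ℚ)) ≡ r * (r * t)
      lem = solve 2 (λ r t → t :* (r :* (r :* con 1ℚ)) := r :* (r :* t)) refl where open +-*-Solver

  -- The first R terms are at most 1, the others sum to at most N / R^(k-1).
  ∑-roundingBound : ∀ s N R .{{_ : ℕ.NonZero R}} M → N ℕ.≤ suc R ℕ.^ (2 ℕ.+ s) →
    ∑ (λ d → roundingBound N (d ℕ.^ (2 ℕ.+ s))) M ≤ (1ℚ + fromℕ 2 ^ (2 ℕ.+ s)) * fromℕ R
  ∑-roundingBound s N R M N≤ = begin
    ∑ φ M                                  ≤⟨ ∑-monoʳ 0≤φ (ℕ.m≤n+m M R) ⟩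
    ∑ φ (R ℕ.+ M)                          ≡⟨ ∑-split φ R M ⟩
    ∑ φ R + ∑ (λ i → φ (R ℕ.+ i)) M
      ≤⟨ +-mono-≤ (∑-mono R (λ d → p⊓q≤p 1ℚ (fromℕ N * rec (d ℕ.^ k))))
           (∑-mono M (λ i → subst (φ (R ℕ.+ i) ≤_) (cong (fromℕ N *_) (rec-^ (R ℕ.+ i) k))
             (p⊓q≤q 1ℚ (fromℕ N * rec ((R ℕ.+ i) ℕ.^ k))))) ⟩
    ∑ (λ _ → 1ℚ) R + ∑ (λ i → fromℕ N * rec (R ℕ.+ i) ^ k) M
      ≡⟨ cong₂ _+_ (∑-const 1ℚ R) (∑-*ˡ (fromℕ N) (λ i → rec (R ℕ.+ i) ^ k) M) ⟩
    fromℕ R * 1ℚ + fromℕ N * ∑ (λ i → rec (R ℕ.+ i) ^ k) M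
      -- From N ≤ (R + 1)^k ≤ (2 R)^k one gets N / R^(k-1) ≤ 2^k R, the origin of the constant 2^k.
      ≤⟨ +-monoʳ-≤ (fromℕ R * 1ℚ) (*-mono (0≤fromℕ ((2 ℕ.* R) ℕ.^ k)) (0≤∑ M (λ i → 0≤rec^ k (R ℕ.+ i)))
           (fromℕ-mono-≤ (ℕ.≤-trans N≤ (ℕ.^-monoˡ-≤ k sucR≤2R))) (∑-rec^-tail s R M)) ⟩
    fromℕ R * 1ℚ + fromℕ ((2 ℕ.* R) ℕ.^ k) * rec R ^ suc s
      ≡⟨ cong (λ t → fromℕ R * 1ℚ + t * rec R ^ suc s)
           (trans (fromℕ-^ (2 ℕ.* R) k) (trans (cong (_^ k) (fromℕ-* 2 R)) (^-distribʳ-* k (fromℕ 2) (fromℕ R)))) ⟩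
    fromℕ R * 1ℚ + fromℕ 2 ^ k * fromℕ R ^ k * rec R ^ suc s
      ≡⟨ cong (λ t → fromℕ R * 1ℚ + t) (lem₁ (fromℕ 2 ^ k) (fromℕ R) (fromℕ R ^ suc s) (rec R ^ suc s)) ⟩
    fromℕ R * 1ℚ + fromℕ 2 ^ k * (fromℕ R * (fromℕ R ^ suc s * rec R ^ suc s))
      ≡⟨ cong (λ t → fromℕ R * 1ℚ + fromℕ 2 ^ k * (fromℕ R * t))
           (trans (sym (^-distribʳ-* (suc s) (fromℕ R) (rec R))) (trans (cong (_^ suc s) (fromℕ*rec R)) (1^ (suc s)))) ⟩
    fromℕ R * 1ℚ + fromℕ 2 ^ k * (fromℕ R * 1ℚ)
      ≡⟨ lem₂ (fromℕ R) (fromℕ 2 ^ k) ⟩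
    (1ℚ + fromℕ 2 ^ k) * fromℕ R           ∎
    where
    open ≤-Reasoning
    k : ℕ
    k = 2 ℕ.+ s
    φ : ℕ → ℚ
    φ d = roundingBound N (d ℕ.^ k)
    0≤φ : ∀ d → 0ℚ ≤ φ d
    0≤φ d = ⊓-glb (<⇒≤ 0<1) (0≤* (0≤fromℕ N) (0≤rec (d ℕ.^ k)))
    sucR≤2R : suc R ℕ.≤ 2 ℕ.* R
    sucR≤2R = subst (suc R ℕ.≤_) (cong (R ℕ.+_) (sym (ℕ.+-identityʳ R))) (ℕ.+-monoˡ-≤ R (ℕ.>-nonZero⁻¹ R))
    lem₁ : ∀ c r x y → c * (r * x) * y ≡ c * (r * (x * y))
    lem₁ = solve 4 (λ c r x y → c :* (r :* x) :* y := c :* (r :* (x :* y))) refl where open +-*-Solver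
    lem₂ : ∀ r c → r * 1ℚ + c * (r * 1ℚ) ≡ (1ℚ + c) * r
    lem₂ = solve 2 (λ r c → r :* con 1ℚ :+ c :* (r :* con 1ℚ) := (con 1ℚ :+ c) :* r) refl where open +-*-Solver

  -- `∑-roundingBound` is uniform in the length of its sum, so the enormous range up to `product L`
  -- costs nothing and the bound does not depend on L.
  sift-count : ∀ s N R .{{_ : ℕ.NonZero R}} L → N ℕ.≤ suc R ℕ.^ (2 ℕ.+ s) →
    All ℕ.NonZero L → All (_≢ 1) L → AllPairs Coprime L →
    ∣ ∑ (sift (map (ℕ._^ (2 ℕ.+ s)) L) (λ _ → 1ℚ)) N - eulerProduct (2 ℕ.+ s) L * fromℕ N ∣
      ≤ (1ℚ + fromℕ 2 ^ (2 ℕ.+ s)) * fromℕ R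
  sift-count s N R L N≤ nzs ≢1s cs = begin
    ∣ ∑ (sift (map (ℕ._^ k) L) (λ _ → 1ℚ)) N - eulerProduct k L * fromℕ N ∣
      ≡⟨ cong₂ (λ m x → ∣ ∑ (sift (map (ℕ._^ k) L) (λ _ → 1ℚ)) m - eulerProduct k L * x ∣)
           (ℕ.n/1≡n N) (*-identityʳ (fromℕ N)) ⟨
    ∣ ∑ (sift (map (ℕ._^ k) L) (λ _ → 1ℚ)) (N ℕ./ 1) - eulerProduct k L * (fromℕ N * rec 1) ∣
      ≤⟨ sift-error k N L nzs cs 1 ⟩
    subproductSum L (λ d → roundingBound N (1 ℕ.* d ℕ.^ k))
      ≡⟨ subproductSum-cong L (λ d → cong (roundingBound N) (ℕ.*-identityˡ (d ℕ.^ k))) ⟩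
    subproductSum L (λ d → roundingBound N (d ℕ.^ k))
      ≤⟨ subproductSum-≤ L (λ d → ⊓-glb (<⇒≤ 0<1) (0≤* (0≤fromℕ N) (0≤rec (d ℕ.^ k)))) nzs ≢1s cs ⟩
    ∑ (λ d → roundingBound N (d ℕ.^ k)) (product L)
      ≤⟨ ∑-roundingBound s N R (product L) N≤ ⟩
    (1ℚ + fromℕ 2 ^ k) * fromℕ R ∎
    where
    open ≤-Reasoning
    k : ℕ
    k = 2 ℕ.+ s

-- Euler products

primeDivisor : ∀ n → .{{_ : ℕ.NonZero n}} → n ≢ 1 → ∃[ p ] Prime p × p ∣ℕ n
primeDivisor n n≢1 = go (PrimeFactorisation.factors f) (PrimeFactorisation.isFactorisation f) (PrimeFactorisation.factorsPrime f)
  where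
  f = factorise n
  go : ∀ ps → n ≡ product ps → All Prime ps → ∃[ p ] Prime p × p ∣ℕ n
  go []       eq _          = contradiction eq n≢1
  go (p ∷ ps) eq (pr ∷ prs) = p , pr , subst (p ∣ℕ_) (sym eq) (ℕ.m∣m*n (product ps))

prime⇒≢1 : ∀ {p} → Prime p → p ≢ 1
prime⇒≢1 pr refl = ¬prime[1] pr

distinct-primes-coprime : ∀ {p q} → Prime p → Prime q → p ≢ q → Coprime p q
distinct-primes-coprime pp pq p≢q (d∣p , d∣q) with prime⇒irreducible pp d∣p
... | inj₁ d≡1 = d≡1
... | inj₂ refl with prime⇒irreducible pq d∣q
...   | inj₁ d≡1  = d≡1
...   | inj₂ p≡q = contradiction p≡q p≢q

unique-primes-coprime : ∀ {L} → All Prime L → Unique L → AllPairs Coprime L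
unique-primes-coprime []         []       = []
unique-primes-coprime (pp ∷ pps) (h ∷ hs) =
  All.zipWith (λ (pq , p≢q) {_} → distinct-primes-coprime pp pq p≢q) (pps , h) ∷ unique-primes-coprime pps hs

primes : ℕ → List ℕ
primes z = filter prime? (downFrom (suc z))

abstract
  primes-prime : ∀ z → All Prime (primes z)
  primes-prime z = All.all-filter prime? (downFrom (suc z))

  primes-nonZero : ∀ z → All ℕ.NonZero (primes z)
  primes-nonZero z = All.map prime⇒nonZero (primes-prime z)

  primes-coprime : ∀ z → AllPairs Coprime (primes z)
  primes-coprime z = unique-primes-coprime (primes-prime z) (Unique.filter⁺ prime? (Unique.downFrom⁺ (suc z)))

  ∈-primes : ∀ {p z} → Prime p → p ℕ.≤ z → p ∈ primes z
  ∈-primes pp p≤z = ∈-filter⁺ prime? (∈-downFrom⁺ (s≤s p≤z)) pp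

  sift-hit : ∀ {q L n} w → q ∈ L → q ∣ℕ n → sift L w n ≡ 0ℚ
  sift-hit {q} {_ ∷ L} w (here refl) h = ∤·-yes {q} (sift L w) h
  sift-hit {q} {r ∷ L} {n} w (there q∈L) h with r ∣ℕ? n
  ... | yes _ = refl
  ... | no  _ = sift-hit w q∈L h

  sift-miss : ∀ {L n} w → (∀ {q} → q ∈ L → ¬ q ∣ℕ n) → sift L w n ≡ w n
  sift-miss {[]}        w h = refl
  sift-miss {r ∷ L} {n} w h with r ∣ℕ? n
  ... | yes r∣n = contradiction r∣n (h (here refl))
  ... | no  _   = sift-miss w (λ q∈L → h (there q∈L))

  1≤∑-sift : ∀ k L → All (_≢ 1) L → ∀ m → 1ℚ ≤ ∑ (sift L (λ i → rec i ^ k)) (suc m)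
  1≤∑-sift k L ≢1s m = begin
    1ℚ                  ≡⟨ trans (+-identityˡ (w 1)) (1^ k) ⟨
    0ℚ + w 1            ≡⟨ cong (λ t → 0ℚ + t) (sift-miss w λ q∈L q∣1 → All.lookup ≢1s q∈L (ℕ.∣1⇒≡1 q∣1)) ⟨
    ∑ (sift L w) 1      ≤⟨ ∑-monoʳ {sift L w} {1} {suc m} (sift-0≤ L (0≤rec^ k)) (s≤s z≤n) ⟩
    ∑ (sift L w) (suc m) ∎
    where
    open ≤-Reasoning
    w : ℕ → ℚ
    w i = rec i ^ k

  -- An integer n with 2 ≤ n ≤ z has a prime divisor up to z, so below z only the term at 1
  -- survives; beyond z the unsifted tail is at most 1/z. With `1≤∑-sift` this pins the sifted sum
  -- between 1 and 1 + 1/z.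
  ∑-sift-primes≤ : ∀ s z .{{_ : ℕ.NonZero z}} M →
    ∑ (sift (primes z) (λ i → rec i ^ (2 ℕ.+ s))) M ≤ 1ℚ + rec z
  ∑-sift-primes≤ s z M = begin
    ∑ f M                                    ≤⟨ ∑-monoʳ 0≤f (ℕ.m≤n+m M z) ⟩
    ∑ f (z ℕ.+ M)                            ≡⟨ ∑-split f z M ⟩
    ∑ f z + ∑ (λ i → f (z ℕ.+ i)) M
      ≤⟨ +-mono-≤ (head≤1 z ℕ.≤-refl) (∑-mono M (λ i → sift-≤ (primes z) (0≤rec^ k) (z ℕ.+ i))) ⟩
    1ℚ + ∑ (λ i → rec (z ℕ.+ i) ^ k) M       ≤⟨ +-monoʳ-≤ 1ℚ (∑-rec^-tail s z M) ⟩
    1ℚ + rec z * rec z ^ s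
      ≤⟨ +-monoʳ-≤ 1ℚ (subst (rec z * rec z ^ s ≤_) (*-identityʳ (rec z))
           (*-monoˡ (rec z) (0≤rec z) (^≤1 s (0≤rec z) (rec≤1 z)))) ⟩
    1ℚ + rec z                               ∎
    where
    open ≤-Reasoning
    k : ℕ
    k = 2 ℕ.+ s
    f : ℕ → ℚ
    f = sift (primes z) (λ i → rec i ^ k)
    0≤f : ∀ i → 0ℚ ≤ f i
    0≤f = sift-0≤ (primes z) (0≤rec^ k)
    head≤1 : ∀ n → n ℕ.≤ z → ∑ f n ≤ 1ℚ
    head≤1 zero    h = <⇒≤ 0<1
    head≤1 (suc zero) h = subst (_≤ 1ℚ) (sym (+-identityˡ (f 1)))
      (≤-trans (sift-≤ (primes z) (0≤rec^ k) 1) (^≤1 k (0≤rec 1) (rec≤1 1)))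
    head≤1 (suc n@(suc _)) h =
      let p , pp , p∣ = primeDivisor (suc n) (λ ())
      in subst (_≤ 1ℚ) (sym (trans (cong (λ t → ∑ f n + t)
           (sift-hit (λ i → rec i ^ k) (∈-primes pp (ℕ.≤-trans (ℕ.∣⇒≤ p∣) h)) p∣)) (+-identityʳ (∑ f n))))
           (head≤1 n (ℕ.<⇒≤ h))

  ∑-sift-dilate : ∀ k q .{{_ : ℕ.NonZero q}} L x → All (Coprime q) L →
    ∑ (sift (q ∷ L) (λ i → rec i ^ k)) x ≡
      ∑ (sift L (λ i → rec i ^ k)) x - rec q ^ k * ∑ (sift L (λ i → rec i ^ k)) (x ℕ./ q)
  ∑-sift-dilate k q L x cs = trans (∑-sift-∷ q L (λ i → rec i ^ k) x cs) (cong (λ t → ∑ (sift L (λ i → rec i ^ k)) x - t)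
    (trans (∑-cong (x ℕ./ q) λ n → trans
        (sift-cong L (λ i → trans (cong (_^ k) (rec-* q i)) (^-distribʳ-* k (rec q) (rec i))) n)
        (sift-scale L (rec q ^ k) (λ i → rec i ^ k) n))
      (∑-*ˡ (rec q ^ k) (sift L (λ i → rec i ^ k)) (x ℕ./ q))))

  1-u≥0 : ∀ {u} → u ≤ 1ℚ → 0ℚ ≤ 1ℚ - u
  1-u≥0 {u} h = subst (_≤ 1ℚ - u) (+-inverseʳ u) (+-monoˡ-≤ (- u) h)

  rec^≤1 : ∀ k i → rec i ^ k ≤ 1ℚ
  rec^≤1 k i = ^≤1 k (0≤rec i) (rec≤1 i)

  -‿antiʳ-≤ : ∀ {p q} r → p ≤ q → r - q ≤ r - p
  -‿antiʳ-≤ r h = +-monoʳ-≤ r (neg-antimono-≤ h)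

  -- In T(M) - q^(-k) T(M/q), the sifted sum after one more prime, replacing M/q by the larger M
  -- only subtracts more.
  eulerProduct-lower : ∀ k L → All ℕ.NonZero L → AllPairs Coprime L → ∀ M →
    eulerProduct k L * ∑ (λ i → rec i ^ k) M ≤ ∑ (sift L (λ i → rec i ^ k)) M
  eulerProduct-lower k []      []         []       M = ≤-reflexive (*-identityˡ _)
  eulerProduct-lower k (q ∷ L) (nz ∷ nzs) (c ∷ cs) M = begin
    (1ℚ - u) * P * Z           ≡⟨ *-assoc (1ℚ - u) P Z ⟩
    (1ℚ - u) * (P * Z)         ≤⟨ *-monoˡ (1ℚ - u) (1-u≥0 (rec^≤1 k q)) (eulerProduct-lower k L nzs cs M) ⟩
    (1ℚ - u) * T M             ≡⟨ lem u (T M) ⟩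
    T M - u * T M              ≤⟨ -‿antiʳ-≤ (T M) (*-monoˡ u (0≤rec^ k q) (∑-monoʳ (sift-0≤ L (0≤rec^ k)) (ℕ.m/n≤m M q))) ⟩
    T M - u * T (M ℕ./ q)      ≡⟨ ∑-sift-dilate k q L M c ⟨
    ∑ (sift (q ∷ L) (λ i → rec i ^ k)) M ∎
    where
    open ≤-Reasoning
    instance
      q≢0 : ℕ.NonZero q
      q≢0 = nz
    u P Z : ℚ
    u = rec q ^ k
    P = eulerProduct k L
    Z = ∑ (λ i → rec i ^ k) M
    T : ℕ → ℚ
    T = ∑ (sift L (λ i → rec i ^ k))
    lem : ∀ u t → (1ℚ - u) * t ≡ t - u * t
    lem = solve 2 (λ u t → (con 1ℚ :- u) :* t := t :- u :* t) refl where open +-*-Solver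

  ∑-rec^-cauchy : ∀ s ε → 0ℚ < ε → Σ[ K ∈ ℕ ] ∀ m n → K ℕ.≤ m → K ℕ.≤ n →
    ∑ (λ i → rec i ^ (2 ℕ.+ s)) m - ∑ (λ i → rec i ^ (2 ℕ.+ s)) n ≤ ε
  ∑-rec^-cauchy s ε 0<ε = let K , h = ζ-cauchy (2 ℕ.+ s) ε 0<ε in suc K , λ where
    (suc m) (suc n) (s≤s hm) (s≤s hn) → subst₂ (λ x y → x - y ≤ ε) (ζ-sum≡∑ (2 ℕ.+ s) (suc m)) (ζ-sum≡∑ (2 ℕ.+ s) (suc n))
      (≤-trans (p≤∣p∣ _) (h m n hm hn))

  -- What `eulerProduct-lower` gives away at the prime q is q^(-k) (T(M) - T(M/q)). This increment
  -- is at most that of the unsifted sum, which is small once M/q is large; hence the threshold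
  -- depends on L and ε.
  eulerProduct-upper : ∀ s L → All ℕ.NonZero L → AllPairs Coprime L → ∀ ε → 0ℚ < ε → Σ[ M₀ ∈ ℕ ] ∀ M → M₀ ℕ.≤ M →
    ∑ (sift L (λ i → rec i ^ (2 ℕ.+ s))) M ≤ eulerProduct (2 ℕ.+ s) L * ∑ (λ i → rec i ^ (2 ℕ.+ s)) M + ε
  eulerProduct-upper s []      []         []       ε 0<ε = 0 , λ M _ →
    ≤-trans (≤-reflexive (sym (*-identityˡ (∑ (λ i → rec i ^ (2 ℕ.+ s)) M)))) (p≤p+ (<⇒≤ 0<ε))
  eulerProduct-upper s (q ∷ L) (nz ∷ nzs) (c ∷ cs) ε 0<ε =
    let M₀ , h = eulerProduct-upper s L nzs cs (ε * ½) (0<half 0<ε)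
        K , h′ = ∑-rec^-cauchy s (ε * ½) (0<half 0<ε)
    -- M ≥ K q ensures that M/q, too, is in the Cauchy range starting at K.
    in M₀ ℕ.⊔ (K ℕ.* q) , λ M hM →
      let K≤M/q = subst (ℕ._≤ M ℕ./ q) (ℕ.m*n/n≡m K q) (ℕ./-monoˡ-≤ q (ℕ.m⊔n≤o⇒n≤o M₀ (K ℕ.* q) hM))
      in step M (h M (ℕ.m⊔n≤o⇒m≤o M₀ (K ℕ.* q) hM)) (h′ M (M ℕ./ q) (ℕ.≤-trans K≤M/q (ℕ.m/n≤m M q)) K≤M/q)
    where
    open ≤-Reasoning
    instance
      q≢0 : ℕ.NonZero q
      q≢0 = nz
    k : ℕ
    k = 2 ℕ.+ s
    u P : ℚ
    u = rec q ^ k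
    P = eulerProduct k L
    Z T : ℕ → ℚ
    Z = ∑ (λ i → rec i ^ k)
    T = ∑ (sift L (λ i → rec i ^ k))
    lem : ∀ u a b → a - u * b ≡ (1ℚ - u) * a + u * (a - b)
    lem = solve 3 (λ u a b → a :- u :* b := (con 1ℚ :- u) :* a :+ u :* (a :- b)) refl where open +-*-Solver
    1-u≤1 : 1ℚ - u ≤ 1ℚ
    1-u≤1 = -‿antiʳ-≤ 1ℚ (0≤rec^ k q)
    step : ∀ M → T M ≤ P * Z M + ε * ½ → Z M - Z (M ℕ./ q) ≤ ε * ½ →
      ∑ (sift (q ∷ L) (λ i → rec i ^ k)) M ≤ (1ℚ - u) * P * Z M + ε
    step M hT hZ = begin
      ∑ (sift (q ∷ L) (λ i → rec i ^ k)) M              ≡⟨ ∑-sift-dilate k q L M c ⟩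
      T M - u * T (M ℕ./ q)                             ≡⟨ lem u (T M) (T (M ℕ./ q)) ⟩
      (1ℚ - u) * T M + u * (T M - T (M ℕ./ q))
        ≤⟨ +-mono-≤ (*-monoˡ (1ℚ - u) (1-u≥0 (rec^≤1 k q)) hT)
             (≤-trans (*-monoˡ u (0≤rec^ k q) (≤-trans (∑-increment (sift-0≤ L (0≤rec^ k)) (sift-≤ L (0≤rec^ k)) (ℕ.m/n≤m M q)) hZ))
               (q*p≤p (<⇒≤ (0<half 0<ε)) (rec^≤1 k q))) ⟩
      (1ℚ - u) * (P * Z M + ε * ½) + ε * ½
        ≡⟨ cong (λ t → t + ε * ½) (*-distribˡ-+ (1ℚ - u) (P * Z M) (ε * ½)) ⟩
      (1ℚ - u) * (P * Z M) + (1ℚ - u) * (ε * ½) + ε * ½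
        ≤⟨ +-monoˡ-≤ (ε * ½) (+-monoʳ-≤ ((1ℚ - u) * (P * Z M)) (q*p≤p (<⇒≤ (0<half 0<ε)) 1-u≤1)) ⟩
      (1ℚ - u) * (P * Z M) + ε * ½ + ε * ½
        ≡⟨ +-assoc ((1ℚ - u) * (P * Z M)) (ε * ½) (ε * ½) ⟩
      (1ℚ - u) * (P * Z M) + (ε * ½ + ε * ½)
        ≡⟨ cong₂ _+_ (sym (*-assoc (1ℚ - u) P (Z M))) (half+half ε) ⟩
      (1ℚ - u) * P * Z M + ε ∎

  -- With Z the partial sum of ζ(k), Z ≥ 1 gives |P - 1/Z| ≤ |P Z - 1|. The sifted sum S then
  -- brackets P Z: P Z ≤ S ≤ 1 + 1/z from one side, 1 ≤ S ≤ P Z + ε from the other.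
  eulerProduct≈1/ζ : ∀ s z .{{_ : ℕ.NonZero z}} ε → 0ℚ < ε → Σ[ M₀ ∈ ℕ ] ∀ M → M₀ ℕ.≤ M →
    ∣ eulerProduct (2 ℕ.+ s) (primes z) - recipℚ (ζ-sum (2 ℕ.+ s) (suc M)) ∣ ≤ rec z + ε
  eulerProduct≈1/ζ s z ε 0<ε =
    let M₀ , h = eulerProduct-upper s L (primes-nonZero z) (primes-coprime z) ε 0<ε
    in M₀ , λ M hM → final M (h (suc M) (ℕ.m≤n⇒m≤1+n hM))
    where
    open ≤-Reasoning
    k : ℕ
    k = 2 ℕ.+ s
    L : List ℕ
    L = primes z
    P δ : ℚ
    P = eulerProduct k L
    δ = rec z + ε
    w : ℕ → ℚ
    w i = rec i ^ k
    final : ∀ M → ∑ (sift L w) (suc M) ≤ P * ∑ w (suc M) + ε → ∣ P - recipℚ (ζ-sum k (suc M)) ∣ ≤ δ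
    final M h = begin
      ∣ P - y ∣               ≡⟨ cong ∣_∣ (trans (cong (_- y) (trans (sym (*-identityʳ P)) (cong (P *_) (sym (p*recip 0<Z))))) (lem P Z y)) ⟩
      ∣ y * (P * Z - 1ℚ) ∣    ≡⟨ ∣p*q∣≡∣p∣*∣q∣ y (P * Z - 1ℚ) ⟩
      ∣ y ∣ * ∣ P * Z - 1ℚ ∣  ≡⟨ cong (_* ∣ P * Z - 1ℚ ∣) (0≤p⇒∣p∣≡p (<⇒≤ (0<recip 0<Z))) ⟩
      y * ∣ P * Z - 1ℚ ∣      ≤⟨ q*p≤p (0≤∣p∣ (P * Z - 1ℚ)) y≤1 ⟩
      ∣ P * Z - 1ℚ ∣          ≤⟨ ∣-∣≤ PZ≤ 1≤ ⟩
      δ                       ∎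
      where
      Z y : ℚ
      Z = ζ-sum k (suc M)
      y = recipℚ Z
      Z≡ : Z ≡ ∑ w (suc M)
      Z≡ = ζ-sum≡∑ k (suc M)
      1≤Z : 1ℚ ≤ Z
      1≤Z = subst (_≤ Z) (trans (+-identityˡ (1ℚ ^ k)) (1^ k)) (ζ-sum-mono k {1} {suc M} (s≤s z≤n))
      0<Z : 0ℚ < Z
      0<Z = <-≤-trans 0<1 1≤Z
      y≤1 : y ≤ 1ℚ
      y≤1 = subst (y ≤_) (p*recip 0<Z) (p≤q*p (<⇒≤ (0<recip 0<Z)) 1≤Z)
      lem : ∀ P Z y → P * (Z * y) - y ≡ y * (P * Z - 1ℚ)
      lem = solve 3 (λ P Z y → P :* (Z :* y) :- y := y :* (P :* Z :- con 1ℚ)) refl where open +-*-Solver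
      PZ≤ : P * Z ≤ 1ℚ + δ
      PZ≤ = begin
        P * Z                  ≡⟨ cong (P *_) Z≡ ⟩
        P * ∑ w (suc M)        ≤⟨ eulerProduct-lower k L (primes-nonZero z) (primes-coprime z) (suc M) ⟩
        ∑ (sift L w) (suc M)   ≤⟨ ∑-sift-primes≤ s z (suc M) ⟩
        1ℚ + rec z             ≤⟨ +-monoʳ-≤ 1ℚ (p≤p+ {ε} {rec z} (<⇒≤ 0<ε)) ⟩
        1ℚ + δ                 ∎
      1≤ : 1ℚ ≤ P * Z + δ
      1≤ = begin
        1ℚ                     ≤⟨ 1≤∑-sift k L (All.map prime⇒≢1 (primes-prime z)) M ⟩
        ∑ (sift L w) (suc M)   ≤⟨ h ⟩
        P * ∑ w (suc M) + ε    ≡⟨ cong (λ t → P * t + ε) (sym Z≡) ⟩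
        P * Z + ε              ≤⟨ +-monoʳ-≤ (P * Z) (subst (_≤ δ) (+-identityˡ ε) (+-monoˡ-≤ ε (0≤rec z))) ⟩
        P * Z + δ              ∎

-- Density of the k-free integers

KFree : ℕ → ℕ → Set
KFree k n = ∀ p → Prime p → ¬ p ℕ.^ k ∣ℕ n

abstract
  p^k∣n⇒p≤n : ∀ {p n} k .{{_ : ℕ.NonZero k}} .{{_ : ℕ.NonZero n}} → Prime p → p ℕ.^ k ∣ℕ n → p ℕ.≤ n
  p^k∣n⇒p≤n {p} (suc k) pp h =
    ℕ.≤-trans (ℕ.m≤m*n p (p ℕ.^ k) {{nonZero-^ (prime⇒nonZero pp) k}}) (ℕ.∣⇒≤ h)

  KFree? : ∀ k .{{_ : ℕ.NonZero k}} → Decidable (KFree k)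
  KFree? k zero      = no λ h → h 2 prime[2] (_ ℕ.∣0)
  KFree? k n@(suc _) = map′
    (λ h p pp d → All.lookup h (∈-primes pp (p^k∣n⇒p≤n k pp d)) d)
    (λ h → All.map (λ {p} pp → h p pp) (primes-prime n))
    (All.all? (λ p → ¬? (p ℕ.^ k ∣ℕ? n)) (primes n))

positives : ℕ → List ℕ
positives N = map suc (downFrom N)

abstract
  -- Agreement of f with the indicator of P is required on [1, N] only, because a sieve by finitely
  -- many primes cannot detect k-freeness everywhere.
  length-filter≡∑ : ∀ {P : Pred ℕ 0ℓ} (P? : Decidable P) f N →
    (∀ n .{{_ : ℕ.NonZero n}} → n ℕ.≤ N → P n → f n ≡ 1ℚ) →
    (∀ n .{{_ : ℕ.NonZero n}} → n ℕ.≤ N → ¬ P n → f n ≡ 0ℚ) →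
    fromℕ (length (filter P? (positives N))) ≡ ∑ f N
  length-filter≡∑ P? f zero    h₁ h₀ = refl
  length-filter≡∑ {P} P? f (suc N) h₁ h₀ = helper (P? (suc N))
    where
    ih : fromℕ (length (filter P? (positives N))) ≡ ∑ f N
    ih = length-filter≡∑ P? f N (λ n n≤N → h₁ n (ℕ.m≤n⇒m≤1+n n≤N)) (λ n n≤N → h₀ n (ℕ.m≤n⇒m≤1+n n≤N))
    helper : Dec (P (suc N)) → fromℕ (length (filter P? (positives (suc N)))) ≡ ∑ f (suc N)
    helper (yes p) = trans (cong (fromℕ ∘ length) (List.filter-accept P? p))
      (trans (suc/ (length (filter P? (positives N))) 0) (cong₂ _+_ ih (sym (h₁ (suc N) ℕ.≤-refl p))))
    helper (no ¬p) = trans (cong (fromℕ ∘ length) (List.filter-reject P? ¬p))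
      (trans ih (trans (sym (+-identityʳ (∑ f N))) (cong (λ t → ∑ f N + t) (sym (h₀ (suc N) ℕ.≤-refl ¬p)))))

  -- The sieve error does not involve z, so for fixed N the distance from P to 1/ζ(k) can be pushed
  -- into ε.
  kfree-density : ∀ s N R .{{_ : ℕ.NonZero N}} .{{_ : ℕ.NonZero R}} → N ℕ.≤ suc R ℕ.^ (2 ℕ.+ s) →
    ∀ ε → 0ℚ < ε → Σ[ M₀ ∈ ℕ ] ∀ M → M₀ ℕ.≤ M →
    ∣ fromℕ (length (filter (KFree? (2 ℕ.+ s)) (positives N))) * rec N - recipℚ (ζ-sum (2 ℕ.+ s) (suc M)) ∣
      ≤ (1ℚ + fromℕ 2 ^ (2 ℕ.+ s)) * (fromℕ R * rec N) + ε
  kfree-density s N R N≤ ε 0<ε =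
    let M₀ , h = eulerProduct≈1/ζ s z δ 0<δ in M₀ , λ M hM → final (recipℚ (ζ-sum k (suc M))) (h M hM)
    where
    open ≤-Reasoning
    k : ℕ
    k = 2 ℕ.+ s
    δ : ℚ
    δ = ε * ½
    0<δ : 0ℚ < δ
    0<δ = 0<half 0<ε
    -- z ≥ N makes the sieve exact on [1, N]; z > `↧ₙ δ` makes 1/z at most δ.
    z : ℕ
    z = suc (N ℕ.⊔ ↧ₙ δ)
    N≤z : N ℕ.≤ z
    N≤z = ℕ.m≤n⇒m≤1+n (ℕ.m≤m⊔n N (↧ₙ δ))
    rec-z≤δ : rec z ≤ δ
    rec-z≤δ = archimedes δ 0<δ (N ℕ.⊔ ↧ₙ δ) (ℕ.m≤n⊔m N (↧ₙ δ))
    L : List ℕ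
    L = map (ℕ._^ k) (primes z)
    Q P C : ℚ
    Q = fromℕ (length (filter (KFree? k) (positives N)))
    P = eulerProduct k (primes z)
    C = 1ℚ + fromℕ 2 ^ k
    kfree⇒miss : ∀ n → KFree k n → ∀ {q} → q ∈ L → ¬ q ∣ℕ n
    kfree⇒miss n free q∈L with ∈-map⁻ (ℕ._^ k) q∈L
    ... | p , p∈ , refl = free p (All.lookup (primes-prime z) p∈)
    ¬kfree⇒zero : ∀ n .{{_ : ℕ.NonZero n}} → n ℕ.≤ N → ¬ KFree k n → sift L (λ _ → 1ℚ) n ≡ 0ℚ
    -- The negation of `KFree` hands over no prime, so the value of the sieve is decided instead:
    -- were it nonzero, `sift-hit` would exclude every p^k.
    ¬kfree⇒zero n n≤N ¬free with sift L (λ _ → 1ℚ) n ≟ 0ℚ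
    ... | yes eq = eq
    ... | no  ≢0 = contradiction (λ p pp d → ≢0 (sift-hit (λ _ → 1ℚ)
      (∈-map⁺ (ℕ._^ k) (∈-primes pp (ℕ.≤-trans (p^k∣n⇒p≤n k pp d) (ℕ.≤-trans n≤N N≤z)))) d)) ¬free
    Q≡ : Q ≡ ∑ (sift L (λ _ → 1ℚ)) N
    Q≡ = length-filter≡∑ (KFree? k) (sift L (λ _ → 1ℚ)) N
      (λ n _ free → sift-miss (λ _ → 1ℚ) (kfree⇒miss n free)) ¬kfree⇒zero
    lem : ∀ Q P N r → Q * r - P * (N * r) ≡ (Q - P * N) * r
    lem = solve 4 (λ Q P N r → Q :* r :- P :* (N :* r) := (Q :- P :* N) :* r) refl where open +-*-Solver
    Q-P : ∣ Q * rec N - P ∣ ≤ C * (fromℕ R * rec N)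
    Q-P = begin
      ∣ Q * rec N - P ∣
        ≡⟨ cong (λ t → ∣ Q * rec N - t ∣) (trans (sym (*-identityʳ P)) (cong (P *_) (sym (fromℕ*rec N)))) ⟩
      ∣ Q * rec N - P * (fromℕ N * rec N) ∣    ≡⟨ cong ∣_∣ (lem Q P (fromℕ N) (rec N)) ⟩
      ∣ (Q - P * fromℕ N) * rec N ∣            ≡⟨ ∣p*q∣≡∣p∣*∣q∣ (Q - P * fromℕ N) (rec N) ⟩
      ∣ Q - P * fromℕ N ∣ * ∣ rec N ∣          ≡⟨ cong (∣ Q - P * fromℕ N ∣ *_) (0≤p⇒∣p∣≡p (0≤rec N)) ⟩
      ∣ Q - P * fromℕ N ∣ * rec N              ≡⟨ cong (λ t → ∣ t - P * fromℕ N ∣ * rec N) Q≡ ⟩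
      ∣ ∑ (sift L (λ _ → 1ℚ)) N - P * fromℕ N ∣ * rec N
        ≤⟨ *-monoʳ (rec N) (0≤rec N) (sift-count s N R (primes z) N≤ (primes-nonZero z)
             (All.map prime⇒≢1 (primes-prime z)) (primes-coprime z)) ⟩
      C * fromℕ R * rec N                      ≡⟨ *-assoc C (fromℕ R) (rec N) ⟩
      C * (fromℕ R * rec N)                    ∎
    tri : ∀ a b c → a - c ≡ (a - b) + (b - c)
    tri = solve 3 (λ a b c → a :- c := (a :- b) :+ (b :- c)) refl where open +-*-Solver
    final : ∀ y → ∣ P - y ∣ ≤ rec z + δ → ∣ Q * rec N - y ∣ ≤ C * (fromℕ R * rec N) + ε
    final y h = begin
      ∣ Q * rec N - y ∣                        ≡⟨ cong ∣_∣ (tri (Q * rec N) P y) ⟩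
      ∣ (Q * rec N - P) + (P - y) ∣            ≤⟨ ∣p+q∣≤∣p∣+∣q∣ (Q * rec N - P) (P - y) ⟩
      ∣ Q * rec N - P ∣ + ∣ P - y ∣            ≤⟨ +-mono-≤ Q-P (≤-trans h (+-monoˡ-≤ δ rec-z≤δ)) ⟩
      C * (fromℕ R * rec N) + (δ + δ)          ≡⟨ cong (λ t → C * (fromℕ R * rec N) + t) (half+half ε) ⟩
      C * (fromℕ R * rec N) + ε                ∎

  -- From N to N + 1 the root rises by at most 1.
  integerRoot : ∀ k .{{_ : ℕ.NonZero k}} N .{{_ : ℕ.NonZero N}} →
    Σ[ R ∈ ℕ ] (ℕ.NonZero R × R ℕ.^ k ℕ.≤ N × N ℕ.< suc R ℕ.^ k)
  integerRoot k (suc zero) = 1 , _ , ℕ.≤-reflexive (ℕ.^-zeroˡ k) ,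
    subst (ℕ._< 2 ℕ.^ k) (ℕ.^-zeroˡ k) (ℕ.^-monoˡ-< k {1} {2} ℕ.≤-refl)
  integerRoot k (suc N@(suc _)) with integerRoot k N
  ... | R , nz , lo , hi with suc R ℕ.^ k ℕ.≤? suc N
  ...   | yes h = suc R , _ , h , ℕ.≤-<-trans hi (ℕ.^-monoˡ-< k (ℕ.n<1+n (suc R)))
  ...   | no  h = R , nz , ℕ.m≤n⇒m≤1+n lo , ℕ.≰⇒> h

-- From the density to the ratio


abstract
  seq-^ᴿ : ∀ x n i → seq (x ^ᴿ n) i ≡ seq x i ^ n
  seq-^ᴿ x zero    i = refl
  seq-^ᴿ x (suc n) i = cong (seq x i *_) (seq-^ᴿ x n i)

  -- Valid without deciding a comparison of reals: a rational comparison is made at one index N from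
  -- which both sequences move by at most δ = ε/4. If y_N ≤ x_N + 2δ, then y ≤ x + 4δ from there on;
  -- otherwise x ≤ y, contrary to hypothesis.
  ≰ᴿ⇒≥ᴿ : ∀ x y → ¬ x ≤ᴿ y → y ≤ᴿ x
  ≰ᴿ⇒≥ᴿ x y x≰y ε 0<ε =
    let N₁ , hx = cauchy x δ 0<δ
        N₂ , hy = cauchy y δ 0<δ
        N       = N₁ ℕ.⊔ N₂
        hx′ = λ n (N≤n : N ℕ.≤ n) → hx N n (ℕ.m≤m⊔n N₁ N₂) (ℕ.m⊔n≤o⇒m≤o N₁ N₂ N≤n)
        hy′ = λ n (N≤n : N ℕ.≤ n) → hy N n (ℕ.m≤n⊔m N₁ N₂) (ℕ.m⊔n≤o⇒n≤o N₁ N₂ N≤n)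
    in N , λ n N≤n → helper N (λ n N≤n → hx′ n N≤n) (λ n N≤n → hy′ n N≤n) n N≤n
    where
    open ≤-Reasoning
    δ : ℚ
    δ = ε * ½ * ½
    0<δ : 0ℚ < δ
    0<δ = 0<half (0<half 0<ε)
    4δ≡ε : ∀ a → a + δ + (δ + δ) + δ ≡ a + ε
    4δ≡ε a = trans (lem a δ) (cong (λ t → a + t) (trans (cong₂ _+_ (half+half (ε * ½)) (half+half (ε * ½))) (half+half ε)))
      where
      lem : ∀ a δ → a + δ + (δ + δ) + δ ≡ a + (δ + δ + (δ + δ))
      lem = solve 2 (λ a δ → a :+ δ :+ (δ :+ δ) :+ δ := a :+ (δ :+ δ :+ (δ :+ δ))) refl where open +-*-Solver
    helper : ∀ N → (∀ n → N ℕ.≤ n → ∣ seq x N - seq x n ∣ ≤ δ) → (∀ n → N ℕ.≤ n → ∣ seq y N - seq y n ∣ ≤ δ) →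
      ∀ n → N ℕ.≤ n → seq y n ≤ seq x n + ε
    helper N hx hy n N≤n with seq y N ≤? seq x N + (δ + δ)
    ... | yes h = begin
      seq y n                              ≤⟨ ∣-∣≤⁻¹ (subst (_≤ δ) (∣-∣-comm (seq y N) (seq y n)) (hy n N≤n)) ⟩
      seq y N + δ                          ≤⟨ +-monoˡ-≤ δ h ⟩
      seq x N + (δ + δ) + δ                ≤⟨ +-monoˡ-≤ δ (+-monoˡ-≤ (δ + δ) (∣-∣≤⁻¹ {seq x N} {seq x n} (hx n N≤n))) ⟩
      seq x n + δ + (δ + δ) + δ            ≡⟨ 4δ≡ε (seq x n) ⟩
      seq x n + ε                          ∎
    ... | no  h = contradiction (λ ε′ 0<ε′ → N , λ m N≤m → ≤-trans (x≤y m N≤m) (p≤p+ (<⇒≤ 0<ε′))) x≰y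
      where
      x≤y : ∀ m → N ℕ.≤ m → seq x m ≤ seq y m
      x≤y m N≤m = ≮⇒≥ λ y<x → <-irrefl refl (begin-strict
        seq y m + δ          <⟨ +-monoˡ-< δ y<x ⟩
        seq x m + δ          ≤⟨ +-monoˡ-≤ δ (∣-∣≤⁻¹ {seq x m} {seq x N} (subst (_≤ δ) (∣-∣-comm (seq x N) (seq x m)) (hx m N≤m))) ⟩
        seq x N + δ + δ      ≡⟨ +-assoc (seq x N) δ δ ⟩
        seq x N + (δ + δ)    <⟨ ≰⇒> h ⟩
        seq y N              ≤⟨ ∣-∣≤⁻¹ (hy m N≤m) ⟩
        seq y m + δ          ∎)

  ≤greatest : ∀ {P : ℕ → Set} (P? : ∀ i → Dec (P i)) b {i} → P i → i ℕ.≤ b → i ℕ.≤ greatest P? b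
  ≤greatest P? zero    Pi z≤n = z≤n
  ≤greatest P? (suc b) Pi i≤b with P? (suc b)
  ... | yes _ = i≤b
  ... | no ¬p with ℕ.m≤n⇒m<n∨m≡n i≤b
  ...   | inj₁ (s≤s h) = ≤greatest P? b Pi h
  ...   | inj₂ refl    = contradiction Pi ¬p

  unique⇒length≡ : ∀ {A : Set} {xs ys : List A} → Unique xs → Unique ys →
    (∀ {x} → x ∈ xs ⇔ x ∈ ys) → length xs ≡ length ys
  unique⇒length≡ u v h = ↭-length (∼bag⇒↭ (unique∧set⇒bag u v h))

  ∈-positives⁻ : ∀ {n N} → n ∈ positives N → ℕ.NonZero n × n ℕ.≤ N
  ∈-positives⁻ {n} {N} h with ∈-map⁻ suc h
  ... | i , i∈ , refl = _ , ∈-downFrom⁻ i∈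

  ∈-positives⁺ : ∀ {n N} .{{_ : ℕ.NonZero n}} → n ℕ.≤ N → n ∈ positives N
  ∈-positives⁺ {suc n} h = ∈-map⁺ suc (∈-downFrom⁺ h)

  positives-unique : ∀ N → Unique (positives N)
  positives-unique N = Unique.map⁺ ℕ.suc-injective (Unique.downFrom⁺ N)

  length-positives : ∀ N → length (positives N) ≡ N
  length-positives N = trans (List.length-map suc (downFrom N)) (List.length-downFrom N)

  -- Reduces a comparison with a root to one of powers of rationals; 1/(k + 1) is the grid width of
  -- `rootℚ`.
  ≤rootℚ : ∀ n k {y q} → 0ℚ ≤ y → y ^ suc n ≤ q → y ≤ rootℚ (suc n) k q + + 1 / suc k
  ≤rootℚ n k {y} {q} 0≤y h = ≮⇒≥ λ r<y → <-irrefl refl (<-≤-trans (rootℚ-upper n k q)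
    (≤-trans (^-mono (suc n) (0≤+ (0≤rootℚ (suc n) k q) (0≤/ 1 k)) (<⇒≤ r<y)) h))

  rec≤recipℚ : ∀ {M p} .{{_ : ℕ.NonZero M}} → 0ℚ < p → p ≤ fromℕ M → rec M ≤ recipℚ p
  rec≤recipℚ {M} {p} 0<p p≤M = begin
    rec M                           ≡⟨ *-identityʳ (rec M) ⟨
    rec M * 1ℚ                      ≡⟨ cong (rec M *_) (p*recip 0<p) ⟨
    rec M * (p * recipℚ p)          ≤⟨ *-monoˡ (rec M) (0≤rec M) (*-monoʳ (recipℚ p) (<⇒≤ (0<recip 0<p)) p≤M) ⟩
    rec M * (fromℕ M * recipℚ p)    ≡⟨ lem (rec M) (fromℕ M) (recipℚ p) ⟩
    fromℕ M * rec M * recipℚ p      ≡⟨ trans (cong (_* recipℚ p) (fromℕ*rec M)) (*-identityˡ (recipℚ p)) ⟩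
    recipℚ p                        ∎
    where
    open ≤-Reasoning
    lem : ∀ r m y → r * (m * y) ≡ m * r * y
    lem = solve 3 (λ r m y → r :* (m :* y) := m :* r :* y) refl where open +-*-Solver

  x^n≤x : ∀ {x} n → 0ℚ ≤ x → x ≤ 1ℚ → x ^ suc n ≤ x
  x^n≤x {x} n 0≤x x≤1 = subst (x * x ^ n ≤_) (*-identityʳ x) (*-monoˡ x 0≤x (^≤1 n 0≤x x≤1))

  -- With ρ = R/N ≈ N^(1/k - 1), where R is the integer k-th root of N, and X ≤ K N^w:
  -- (ρ/K^a)^(gk) ≤ K^(-a) N^(-g(k-1)) = (K N^w)^(-a) ≤ X^(-a).
  ρ-bound : ∀ s g w a d K N R .{{_ : ℕ.NonZero K}} .{{_ : ℕ.NonZero N}} →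
    suc d ≡ g ℕ.* (2 ℕ.+ s) → a ℕ.* w ≡ g ℕ.* (1 ℕ.+ s) → R ℕ.^ (2 ℕ.+ s) ℕ.≤ N →
    ∀ X → 0ℚ < X → X ≤ fromℕ (K ℕ.* N ℕ.^ w) →
    (rec K ^ a * (fromℕ R * rec N)) ^ suc d ≤ recipℚ X ^ a
  ρ-bound s g w a d K N R d≡ aw≡ R≤ X 0<X X≤ = begin
    (rec K ^ a * ρ) ^ suc d               ≡⟨ ^-distribʳ-* (suc d) (rec K ^ a) ρ ⟩
    (rec K ^ a) ^ suc d * ρ ^ suc d
      ≤⟨ *-mono (0≤rec^ a K) (0≤^ (suc d) 0≤ρ) (x^n≤x d (0≤rec^ a K) (rec^≤1 a K)) ρ^≤ ⟩
    rec K ^ a * rec N ^ (a ℕ.* w)         ≡⟨ cong (rec K ^ a *_) (^-* (rec N) a w) ⟩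
    rec K ^ a * (rec N ^ w) ^ a           ≡⟨ ^-distribʳ-* a (rec K) (rec N ^ w) ⟨
    (rec K * rec N ^ w) ^ a               ≡⟨ cong (_^ a) (trans (rec-* K (N ℕ.^ w)) (cong (rec K *_) (rec-^ N w))) ⟨
    rec (K ℕ.* N ℕ.^ w) ^ a               ≤⟨ ^-mono a (0≤rec (K ℕ.* N ℕ.^ w)) (rec≤recipℚ {K ℕ.* N ℕ.^ w} 0<X X≤) ⟩
    recipℚ X ^ a                          ∎
    where
    open ≤-Reasoning
    instance
      N^w≢0 : ℕ.NonZero (N ℕ.^ w)
      N^w≢0 = ℕ.m^n≢0 N w
      KN^w≢0 : ℕ.NonZero (K ℕ.* N ℕ.^ w)
      KN^w≢0 = ℕ.m*n≢0 K (N ℕ.^ w)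
    k : ℕ
    k = 2 ℕ.+ s
    ρ : ℚ
    ρ = fromℕ R * rec N
    0≤ρ : 0ℚ ≤ ρ
    0≤ρ = 0≤* (0≤fromℕ R) (0≤rec N)
    ρ^k≤ : ρ ^ k ≤ rec N ^ (1 ℕ.+ s)
    ρ^k≤ = begin
      ρ ^ k                                   ≡⟨ ^-distribʳ-* k (fromℕ R) (rec N) ⟩
      fromℕ R ^ k * rec N ^ k                 ≡⟨ cong (_* rec N ^ k) (fromℕ-^ R k) ⟨
      fromℕ (R ℕ.^ k) * rec N ^ k             ≤⟨ *-monoʳ (rec N ^ k) (0≤rec^ k N) (fromℕ-mono-≤ R≤) ⟩
      fromℕ N * (rec N * rec N ^ (1 ℕ.+ s))   ≡⟨ *-assoc (fromℕ N) (rec N) (rec N ^ (1 ℕ.+ s)) ⟨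
      fromℕ N * rec N * rec N ^ (1 ℕ.+ s)
        ≡⟨ trans (cong (_* rec N ^ (1 ℕ.+ s)) (fromℕ*rec N)) (*-identityˡ (rec N ^ (1 ℕ.+ s))) ⟩
      rec N ^ (1 ℕ.+ s)                       ∎
    ρ^≤ : ρ ^ suc d ≤ rec N ^ (a ℕ.* w)
    ρ^≤ = begin
      ρ ^ suc d                       ≡⟨ cong (ρ ^_) d≡ ⟩
      ρ ^ (g ℕ.* k)                   ≡⟨ ^-* ρ g k ⟩
      (ρ ^ k) ^ g                     ≤⟨ ^-mono g (0≤^ k 0≤ρ) ρ^k≤ ⟩
      (rec N ^ (1 ℕ.+ s)) ^ g         ≡⟨ ^-* (rec N) g (1 ℕ.+ s) ⟨
      rec N ^ (g ℕ.* (1 ℕ.+ s))       ≡⟨ cong (rec N ^_) aw≡ ⟨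
      rec N ^ (a ℕ.* w)               ∎

-- What the three cases have in common, with F = ℰ[ j ], G = ℰ~[ j ] and k = 2 + s.
record TwistFamily (F G : Pred Curve 0ℓ) (h : Curve → ℝ) (s w : ℕ) : Set where
  field
    c           : ℤ → Curve
    c-injective : ∀ {t u} → c t ≡ c u → t ≡ u
    G-to        : ∀ {E} → G E → ∃[ t ] t ≢ 0ℤ × E ≡ c t
    G-from      : ∀ {t} → t ≢ 0ℤ → G (c t)
    F⊆G         : ∀ {E} → F E → G E
    F-to        : ∀ {t} → t ≢ 0ℤ → F (c t) → KFree (2 ℕ.+ s) ℤ.∣ t ∣
    F-from      : ∀ {t} → t ≢ 0ℤ → KFree (2 ℕ.+ s) ℤ.∣ t ∣ → F (c t)
    -- Stated for the approximations at every index and not for their limits, so that comparing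
    -- heights is arithmetic of rationals.
    h-scale     : ∀ t n → seq (h (c t)) n ≡ fromℕ (ℤ.∣ t ∣ ℕ.^ w) * seq (h (c (+ 1))) n
    h-lower     : Σ[ N ∈ ℕ ] ∀ n → N ℕ.≤ n → ½ ≤ seq (h (c (+ 1))) n

abstract
  fromℕ-cancel-≤ : ∀ {m n} → fromℕ m ≤ fromℕ n → m ℕ.≤ n
  fromℕ-cancel-≤ {m} {n} h = ℕ.≮⇒≥ λ n<m → <-irrefl refl (begin-strict
    fromℕ n         ≡⟨ +-identityʳ (fromℕ n) ⟨
    fromℕ n + 0ℚ    <⟨ +-monoʳ-< (fromℕ n) 0<1 ⟩
    fromℕ n + 1ℚ    ≡⟨ suc/ n 0 ⟨
    fromℕ (suc n)   ≤⟨ fromℕ-mono-≤ n<m ⟩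
    fromℕ m         ≤⟨ h ⟩
    fromℕ n         ∎)
    where open ≤-Reasoning

  n≤n^ : ∀ n k .{{_ : ℕ.NonZero k}} → n ℕ.≤ n ℕ.^ k
  n≤n^ zero      k       = z≤n
  n≤n^ n@(suc _) (suc k) = ℕ.m≤m*n n (n ℕ.^ k) {{ℕ.m^n≢0 n k}}

  ∣t∣≢0 : ∀ {t} → t ≢ 0ℤ → ℕ.NonZero ℤ.∣ t ∣
  ∣t∣≢0 {+ zero}  h = contradiction refl h
  ∣t∣≢0 {+ suc _} h = _
  ∣t∣≢0 { -[1+ _ ]} h = _

module _ (c : ℤ → Curve) where
  signed : List ℕ → List Curve
  signed ts = map (λ n → c (+ n)) ts ++ map (λ n → c (ℤ.- (+ n))) ts

  abstract
    length-signed : ∀ ts → length (signed ts) ≡ length ts ℕ.+ length ts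
    length-signed ts = trans (List.length-++ (map (λ n → c (+ n)) ts))
      (cong₂ ℕ._+_ (List.length-map (λ n → c (+ n)) ts) (List.length-map (λ n → c (ℤ.- (+ n))) ts))

    ∈-signed⁺ : ∀ {ts} t → ℤ.∣ t ∣ ∈ ts → c t ∈ signed ts
    ∈-signed⁺      (+ n)    h = ∈-++⁺ˡ (∈-map⁺ (λ n → c (+ n)) h)
    ∈-signed⁺ {ts} -[1+ n ] h = ∈-++⁺ʳ (map (λ n → c (+ n)) ts) (∈-map⁺ (λ n → c (ℤ.- (+ n))) h)

    ∈-signed⁻ : ∀ {ts E} → E ∈ signed ts → ∃[ t ] ℤ.∣ t ∣ ∈ ts × E ≡ c t
    ∈-signed⁻ {ts} E∈ with ∈-++⁻ (map (λ n → c (+ n)) ts) E∈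
    ... | inj₁ h = let n , n∈ , eq = ∈-map⁻ (λ n → c (+ n)) h in + n , n∈ , eq
    ... | inj₂ h = let n , n∈ , eq = ∈-map⁻ (λ n → c (ℤ.- (+ n))) h
                   in ℤ.- (+ n) , subst (_∈ ts) (sym (ℤ.∣-i∣≡∣i∣ (+ n))) n∈ , eq

    signed-unique : (∀ {t u} → c t ≡ c u → t ≡ u) → ∀ {ts} → All ℕ.NonZero ts → Unique ts → Unique (signed ts)
    signed-unique inj {ts} nz u = Unique.++⁺ (Unique.map⁺ (λ eq → ℤ.+-injective (inj eq)) u)
      (Unique.map⁺ (λ eq → ℤ.+-injective (ℤ.neg-injective (inj eq))) u) λ (E∈₁ , E∈₂) →
        let m , m∈ , eq₁ = ∈-map⁻ (λ n → c (+ n)) E∈₁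
            n , n∈ , eq₂ = ∈-map⁻ (λ n → c (ℤ.- (+ n))) E∈₂
        in ≢neg m n (All.lookup nz m∈) (All.lookup nz n∈) (inj (trans (sym eq₁) eq₂))
      where
      ≢neg : ∀ m n → ℕ.NonZero m → ℕ.NonZero n → + m ≢ ℤ.- (+ n)
      ≢neg (suc m) (suc n) _ _ ()

module _ {F G h s w} (fam : TwistFamily F G h s w) {{w≢0 : ℕ.NonZero w}} where
  open TwistFamily fam

  private
    H₁ : ℝ
    H₁ = h (c (+ 1))

  -- N is the integer part of (X / H₁)^(1/w), given by its defining property because it is not
  -- computable from X.
  Cutoff : ℝ → ℕ → Set
  Cutoff X N = ∀ t → t ≢ 0ℤ → (h (c t) ≤ᴿ X) ⇔ (ℤ.∣ t ∣ ℕ.≤ N)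

  abstract
    h-mono : ∀ X t u → ℤ.∣ t ∣ ℕ.≤ ℤ.∣ u ∣ → h (c u) ≤ᴿ X → h (c t) ≤ᴿ X
    h-mono X t u t≤u hu ε 0<ε =
      let N₁ , lo = h-lower
          N₂ , up = hu ε 0<ε
      in N₁ ℕ.⊔ N₂ , λ n hn → ≤-trans
        (subst₂ _≤_ (sym (h-scale t n)) (sym (h-scale u n))
          (*-monoʳ (seq H₁ n) (≤-trans (nonNegative⁻¹ ½) (lo n (ℕ.m⊔n≤o⇒m≤o N₁ N₂ hn))) (fromℕ-mono-≤ (ℕ.^-monoˡ-≤ w t≤u))))
        (up n (ℕ.m⊔n≤o⇒n≤o N₁ N₂ hn))

    parameter-bound : ∀ X → Σ[ b ∈ ℕ ] ∀ t → h (c t) ≤ᴿ X → ℤ.∣ t ∣ ℕ.≤ b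
    parameter-bound X =
      let B , _ , N₁ , hB = bounded {seq X} (cauchy X)
          N₂ , lo = h-lower
      -- At a late index ½ |t|^w ≤ X + 1 ≤ B + 1, so |t| ≤ |t|^w ≤ 2 (B + 1), and a rational is at
      -- most the absolute value of its numerator.
      in ℤ.∣ ↥ (fromℕ 2 * (B + 1ℚ)) ∣ , λ t ht →
        let N₃ , up = ht 1ℚ 0<1
            n = N₁ ℕ.⊔ (N₂ ℕ.⊔ N₃)
        in go B t n (hB n (ℕ.m≤m⊔n N₁ (N₂ ℕ.⊔ N₃)))
             (lo n (ℕ.≤-trans (ℕ.m≤m⊔n N₂ N₃) (ℕ.m≤n⊔m N₁ (N₂ ℕ.⊔ N₃))))
             (up n (ℕ.≤-trans (ℕ.m≤n⊔m N₂ N₃) (ℕ.m≤n⊔m N₁ (N₂ ℕ.⊔ N₃))))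
      where
      open ≤-Reasoning
      go : ∀ B t n → ∣ seq X n ∣ ≤ B → ½ ≤ seq H₁ n → seq (h (c t)) n ≤ seq X n + 1ℚ →
        ℤ.∣ t ∣ ℕ.≤ ℤ.∣ ↥ (fromℕ 2 * (B + 1ℚ)) ∣
      go B t n hB lo up = fromℕ-cancel-≤ (begin
        fromℕ ℤ.∣ t ∣                       ≤⟨ fromℕ-mono-≤ (n≤n^ ℤ.∣ t ∣ w) ⟩
        T                                   ≡⟨ trans (sym (*-identityˡ T)) (*-assoc (fromℕ 2) ½ T) ⟩
        fromℕ 2 * (½ * T)                   ≤⟨ *-monoˡ (fromℕ 2) (0≤fromℕ 2) (begin
          ½ * T                               ≤⟨ *-monoʳ T (0≤fromℕ (ℤ.∣ t ∣ ℕ.^ w)) lo ⟩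
          seq H₁ n * T                        ≡⟨ *-comm (seq H₁ n) T ⟩
          T * seq H₁ n                        ≡⟨ h-scale t n ⟨
          seq (h (c t)) n                     ≤⟨ up ⟩
          seq X n + 1ℚ                        ≤⟨ +-monoˡ-≤ 1ℚ (≤-trans (p≤∣p∣ (seq X n)) hB) ⟩
          B + 1ℚ                              ∎) ⟩
        fromℕ 2 * (B + 1ℚ)                  ≤⟨ ≤∣↥∣ (fromℕ 2 * (B + 1ℚ)) ⟩
        fromℕ ℤ.∣ ↥ (fromℕ 2 * (B + 1ℚ)) ∣  ∎)
        where
        T : ℚ
        T = fromℕ (ℤ.∣ t ∣ ℕ.^ w)

    -- Membership of `c (+ i)` in the list `Es` is decidable even though `h (c t) ≤ᴿ X` is not, so
    -- the greatest such i can be searched for. The assumption on X puts `c (+ 1)` into the list,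
    -- which excludes the default value 0 of `greatest`.
    cutoff : ∀ X n → H₁ ≤ᴿ X → HasCard (G ⟨ X ⨾ h ⟩) n → Σ[ N ∈ ℕ ] (ℕ.NonZero N × Cutoff X N)
    cutoff X n H₁≤X (Es , _ , hEs , _) = N , ℕ.>-nonZero 1≤N , λ t t≢0 → mk⇔ (to t t≢0) (from t)
      where
      open DecMembership (≡-dec ℤ._≟_ ℤ._≟_) using (_∈?_)
      P? : ∀ i → Dec (c (+ i) ∈ Es)
      P? i = c (+ i) ∈? Es
      b : ℕ
      b = proj₁ (parameter-bound X)
      N : ℕ
      N = greatest P? b
      in-Es : ∀ t → t ≢ 0ℤ → h (c t) ≤ᴿ X → c t ∈ Es
      in-Es t t≢0 ht = Equivalence.from (hEs (c t)) (G-from t≢0 , ht)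
      to : ∀ t → t ≢ 0ℤ → h (c t) ≤ᴿ X → ℤ.∣ t ∣ ℕ.≤ N
      to t t≢0 ht = ≤greatest P? b
        (in-Es (+ ℤ.∣ t ∣) (λ eq → t≢0 (ℤ.∣i∣≡0⇒i≡0 (ℤ.+-injective eq))) (h-mono X (+ ℤ.∣ t ∣) t ℕ.≤-refl ht))
        (proj₂ (parameter-bound X) t ht)
      1≤N : 1 ℕ.≤ N
      1≤N = to (+ 1) (λ ()) H₁≤X
      N∈ : c (+ N) ∈ Es
      N∈ with greatest-holds P? b
      ... | inj₁ N≡0 = contradiction (subst (1 ℕ.≤_) N≡0 1≤N) λ ()
      ... | inj₂ p   = p
      from : ∀ t → ℤ.∣ t ∣ ℕ.≤ N → h (c t) ≤ᴿ X
      from t t≤N = h-mono X t (+ N) t≤N (proj₂ (Equivalence.to (hEs (c (+ N))) N∈))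

    card-G : ∀ X {N n} → Cutoff X N → HasCard (G ⟨ X ⨾ h ⟩) n → n ≡ N ℕ.+ N
    card-G X {N} cut (Es , u , hEs , refl) = trans
      (unique⇒length≡ u (signed-unique c c-injective (All.tabulate (proj₁ ∘ ∈-positives⁻)) (positives-unique N))
        λ {E} → mk⇔ (to E) (from E))
      (trans (length-signed c (positives N)) (cong₂ ℕ._+_ (length-positives N) (length-positives N)))
      where
      to : ∀ E → E ∈ Es → E ∈ signed c (positives N)
      to E E∈ with Equivalence.to (hEs E) E∈
      ... | GE , hE with G-to GE
      ...   | t , t≢0 , refl = ∈-signed⁺ c t (∈-positives⁺ {{∣t∣≢0 t≢0}} (Equivalence.to (cut t t≢0) hE))
      from : ∀ E → E ∈ signed c (positives N) → E ∈ Es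
      from E E∈ with ∈-signed⁻ c {positives N} E∈
      ... | t , t∈ , refl =
        let nz , t≤N = ∈-positives⁻ {N = N} t∈
            t≢0 = λ { refl → ℕ.≢-nonZero⁻¹ 0 {{nz}} refl }
        in Equivalence.from (hEs (c t)) (G-from t≢0 , Equivalence.from (cut t t≢0) t≤N)

    card-F : ∀ X {N m} → Cutoff X N → HasCard (F ⟨ X ⨾ h ⟩) m →
      let Q = length (filter (KFree? (2 ℕ.+ s)) (positives N)) in m ≡ Q ℕ.+ Q
    card-F X {N} cut (Es , u , hEs , refl) = trans
      (unique⇒length≡ u (signed-unique c c-injective (All.tabulate (λ t∈ → proj₁ (∈-positives⁻ {N = N} (proj₁ (∈-filter⁻ k? t∈)))))
          (Unique.filter⁺ k? (positives-unique N)))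
        λ {E} → mk⇔ (to E) (from E))
      (length-signed c (filter k? (positives N)))
      where
      k? : Decidable (KFree (2 ℕ.+ s))
      k? = KFree? (2 ℕ.+ s)
      to : ∀ E → E ∈ Es → E ∈ signed c (filter k? (positives N))
      to E E∈ with Equivalence.to (hEs E) E∈
      ... | FE , hE with G-to (F⊆G FE)
      ...   | t , t≢0 , refl = ∈-signed⁺ c t
        (∈-filter⁺ k? (∈-positives⁺ {{∣t∣≢0 t≢0}} (Equivalence.to (cut t t≢0) hE)) (F-to t≢0 FE))
      from : ∀ E → E ∈ signed c (filter k? (positives N)) → E ∈ Es
      from E E∈ with ∈-signed⁻ c {filter k? (positives N)} E∈
      ... | t , t∈ , refl =
        let t∈′ , free = ∈-filter⁻ k? {xs = positives N} t∈
            nz , t≤N = ∈-positives⁻ t∈′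
            t≢0 = λ { refl → ℕ.≢-nonZero⁻¹ 0 {{nz}} refl }
        in Equivalence.from (hEs (c t)) (F-from t≢0 free , Equivalence.from (cut t t≢0) t≤N)

    -- N + 1 exceeds the cutoff, so X ≤ (N + 1)^w H₁ by `≰ᴿ⇒≥ᴿ`. With N + 1 ≤ 2 N and H₁ ≤ b this is
    -- at most 2^w b N^w, and the slack 1 of the approximations is absorbed by N^w ≥ 1; the factor
    -- 2^w b + 1 does not depend on X.
    cutoff-lower : Σ[ K ∈ ℕ ] ∀ X N .{{_ : ℕ.NonZero N}} → Cutoff X N →
      Σ[ n₀ ∈ ℕ ] ∀ n → n₀ ℕ.≤ n → seq X n ≤ fromℕ (suc K ℕ.* N ℕ.^ w)
    cutoff-lower =
      let B , _ , N₁ , hB = bounded {seq H₁} (cauchy H₁)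
          b = ℤ.∣ ↥ B ∣
      in 2 ℕ.^ w ℕ.* b , λ X N cut →
        let N₂ , hX = ≰ᴿ⇒≥ᴿ (h (c (+ suc N))) X
              (λ le → ℕ.<-irrefl refl (Equivalence.to (cut (+ suc N) (λ ())) le)) 1ℚ 0<1
        in N₁ ℕ.⊔ N₂ , λ n hn → go X N b n (ℕ.>-nonZero⁻¹ N)
             (≤-trans (p≤∣p∣ (seq H₁ n)) (≤-trans (hB n (ℕ.m⊔n≤o⇒m≤o N₁ N₂ hn)) (≤∣↥∣ B)))
             (hX n (ℕ.m⊔n≤o⇒n≤o N₁ N₂ hn))
      where
      open ≤-Reasoning
      go : ∀ X N b n → 1 ℕ.≤ N → seq H₁ n ≤ fromℕ b → seq X n ≤ seq (h (c (+ suc N))) n + 1ℚ →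
        seq X n ≤ fromℕ (suc (2 ℕ.^ w ℕ.* b) ℕ.* N ℕ.^ w)
      go X N b n 1≤N H₁≤b X≤ = begin
        seq X n                                        ≤⟨ X≤ ⟩
        seq (h (c (+ suc N))) n + 1ℚ                   ≡⟨ cong (_+ 1ℚ) (h-scale (+ suc N) n) ⟩
        fromℕ (suc N ℕ.^ w) * seq H₁ n + 1ℚ
          ≤⟨ +-mono-≤ (*-monoˡ (fromℕ (suc N ℕ.^ w)) (0≤fromℕ (suc N ℕ.^ w)) H₁≤b)
               (fromℕ-mono-≤ {1} (ℕ.m^n>0 N {{ℕ.>-nonZero 1≤N}} w)) ⟩
        fromℕ (suc N ℕ.^ w) * fromℕ b + fromℕ (N ℕ.^ w)
          ≡⟨ trans (fromℕ-+ (suc N ℕ.^ w ℕ.* b) (N ℕ.^ w)) (cong (_+ fromℕ (N ℕ.^ w)) (fromℕ-* (suc N ℕ.^ w) b)) ⟨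
        fromℕ (suc N ℕ.^ w ℕ.* b ℕ.+ N ℕ.^ w)
          ≤⟨ fromℕ-mono-≤ (ℕ.+-monoˡ-≤ (N ℕ.^ w) (ℕ.*-monoˡ-≤ b (ℕ.≤-trans (ℕ.^-monoˡ-≤ w sucN≤2N)
               (ℕ.≤-reflexive (^ℕ-distribʳ-* w 2 N))))) ⟩
        fromℕ (2 ℕ.^ w ℕ.* N ℕ.^ w ℕ.* b ℕ.+ N ℕ.^ w)
          ≡⟨ cong fromℕ (lem (2 ℕ.^ w) (N ℕ.^ w) b) ⟩
        fromℕ (suc (2 ℕ.^ w ℕ.* b) ℕ.* N ℕ.^ w)        ∎
        where
        sucN≤2N : suc N ℕ.≤ 2 ℕ.* N
        sucN≤2N = subst (suc N ℕ.≤_) (cong (N ℕ.+_) (sym (ℕ.+-identityʳ N))) (ℕ.+-monoˡ-≤ N 1≤N)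
        lem : ∀ p x b → p ℕ.* x ℕ.* b ℕ.+ x ≡ suc (p ℕ.* b) ℕ.* x
        lem = ℕ+*.solve 3 (λ p x b → p :* x :* b :+ x := (con 1 :+ p :* b) :* x) refl where open ℕ+*

    -- The two equations say that (a + 1)/(d + 1) = (k - 1)/(k w). The multiplier g is needed
    -- because `mkℚ` wants this fraction in lowest terms.
    ratio-asymptotic : ∀ g a d .(cop : Coprime (suc a) (suc d)) →
      suc d ≡ g ℕ.* (2 ℕ.+ s) → suc a ℕ.* w ≡ g ℕ.* (1 ℕ.+ s) →
      RatioAsymptotic F G h (recip (ζ (2 ℕ.+ s)) (0<ζ (2 ℕ.+ s))) (mkℚ -[1+ a ] d cop)
    ratio-asymptotic g a d cop d≡ aw≡ =
      let K′ , hK = cutoff-lower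
          K = suc K′
          -- C₀ is the sieve constant, and the power of K undoes the loss in X ≤ K N^w. The
          -- threshold H₁ for X makes the curve with parameter 1 count, so the denominator is
          -- nonzero.
          C = C₀ * fromℕ K ^ suc a
      in fromℚ C , H₁ , λ X 0<X H₁≤X m n hm hn →
        let N , N≢0 , cut = cutoff X n H₁≤X hn
            R , R≢0 , R≤ , N< = integerRoot k N {{N≢0}}
        in nonZero-double N≢0 (card-G X cut hn) , λ ε 0<ε →
          let η , 0<η , (N₁ , hX₀) = 0<X
              N₂ , hXK = hK X N {{N≢0}} cut
              N₃ , hd = kfree-density s N R {{N≢0}} {{R≢0}} (ℕ.<⇒≤ N<) (ε * ½) (0<half 0<ε)
              -- δ is for the grid error 1/(i + 1) of the root at index i, which gets multiplied by
              -- C; the density takes the other half of ε.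
              δ , 0<δ , Cδ = shrink C (ε * ½) (0<C K′) (0<half 0<ε)
              M = (N₁ ℕ.⊔ N₂) ℕ.⊔ (N₃ ℕ.⊔ ↧ₙ δ)
          in M , λ i M≤i →
            let le₁₂ = ℕ.m⊔n≤o⇒m≤o (N₁ ℕ.⊔ N₂) (N₃ ℕ.⊔ ↧ₙ δ) M≤i
                le₃₄ = ℕ.m⊔n≤o⇒n≤o (N₁ ℕ.⊔ N₂) (N₃ ℕ.⊔ ↧ₙ δ) M≤i
            in pointwise X 0<X K′ N R {{N≢0}} ε δ i m n (nonZero-double N≢0 (card-G X cut hn)) R≤ Cδ
                 (card-F X cut hm) (card-G X cut hn)
                 (<-≤-trans (subst (0ℚ <_) (sym (+-identityˡ η)) 0<η) (hX₀ i (ℕ.m⊔n≤o⇒m≤o N₁ N₂ le₁₂)))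
                 (hXK i (ℕ.m⊔n≤o⇒n≤o N₁ N₂ le₁₂))
                 (hd i (ℕ.m⊔n≤o⇒m≤o N₃ (↧ₙ δ) le₃₄))
                 (archimedes δ 0<δ i (ℕ.m⊔n≤o⇒n≤o N₃ (↧ₙ δ) le₃₄))
      where
      open ≤-Reasoning
      k : ℕ
      k = 2 ℕ.+ s
      C₀ : ℚ
      C₀ = 1ℚ + fromℕ 2 ^ k
      0<C₀ : 0ℚ < C₀
      0<C₀ = <-≤-trans 0<1 (p≤p+ (0≤^ k (0≤fromℕ 2)))
      0<C : ∀ K′ → 0ℚ < C₀ * fromℕ (suc K′) ^ suc a
      0<C K′ = 0<* 0<C₀ (0<^ (suc a) (0<fromℕ (suc K′)))
      nonZero-double : ∀ {N n} → ℕ.NonZero N → n ≡ N ℕ.+ N → ℕ.NonZero n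
      nonZero-double {suc N} _ refl = _

      halve : ∀ Q N {m n} .{{_ : ℕ.NonZero n}} → m ≡ Q ℕ.+ Q → n ≡ N ℕ.+ N → + m / n ≡ fromℕ Q * rec N
      halve Q N {m} {n} m≡ n≡ = trans (/≡*rec m n) (trans
        (cong₂ (λ x y → fromℕ x * rec y) (trans m≡ (double Q)) (trans n≡ (double N)))
        (trans (cong₂ _*_ (fromℕ-* 2 Q) (rec-* 2 N)) (lem (fromℕ Q) (rec N))))
        where
        double : ∀ n → n ℕ.+ n ≡ 2 ℕ.* n
        double n = cong (n ℕ.+_) (sym (ℕ.+-identityʳ n))
        lem : ∀ q r → fromℕ 2 * q * (rec 2 * r) ≡ q * r
        lem = solve 2 (λ q r → con (fromℕ 2) :* q :* (con (rec 2) :* r) := q :* r) refl where open +-*-Solver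

      pointwise : ∀ X 0<X K′ N R .{{_ : ℕ.NonZero N}} ε δ i m n n≢0 →
        let K = suc K′
            C = C₀ * fromℕ K ^ suc a
            Q = length (filter (KFree? (2 ℕ.+ s)) (positives N)) in
        R ℕ.^ k ℕ.≤ N → C * δ ≡ ε * ½ → m ≡ Q ℕ.+ Q → n ≡ N ℕ.+ N →
        0ℚ < seq X i → seq X i ≤ fromℕ (K ℕ.* N ℕ.^ w) →
        ∣ fromℕ Q * rec N - recipℚ (ζ-sum k (suc i)) ∣ ≤ C₀ * (fromℕ R * rec N) + ε * ½ →
        + 1 / suc i ≤ δ →
        ∣ (+ m / n) {{n≢0}} - recipℚ (ζ-sum k (suc i)) ∣ ≤ C * seq (rpow X 0<X (mkℚ -[1+ a ] d cop)) i + ε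
      pointwise X 0<X K′ N R ε δ i m n n≢0 R≤ Cδ m≡ n≡ 0<Xᵢ Xᵢ≤ dens small = begin
        ∣ (+ m / n) {{n≢0}} - recipℚ (ζ-sum k (suc i)) ∣
          ≡⟨ cong (λ t → ∣ t - recipℚ (ζ-sum k (suc i)) ∣) (halve Q N {{n≢0}} m≡ n≡) ⟩
        ∣ fromℕ Q * rec N - recipℚ (ζ-sum k (suc i)) ∣      ≤⟨ dens ⟩
        C₀ * ρ + ε * ½                          ≡⟨ cong (λ t → C₀ * t + ε * ½) ρ≡ ⟩
        C₀ * (fromℕ K ^ suc a * y) + ε * ½      ≡⟨ cong (_+ ε * ½) (*-assoc C₀ (fromℕ K ^ suc a) y) ⟨
        C * y + ε * ½
          ≤⟨ +-monoˡ-≤ (ε * ½) (*-monoˡ C (<⇒≤ (0<C K′)) (≤-trans y≤ (+-monoʳ-≤ r small))) ⟩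
        C * (r + δ) + ε * ½                     ≡⟨ cong (_+ ε * ½) (trans (*-distribˡ-+ C r δ) (cong (λ t → C * r + t) Cδ)) ⟩
        C * r + ε * ½ + ε * ½                   ≡⟨ +-assoc (C * r) (ε * ½) (ε * ½) ⟩
        C * r + (ε * ½ + ε * ½)                 ≡⟨ cong (λ t → C * r + t) (half+half ε) ⟩
        C * r + ε                               ∎
        where
        K Q : ℕ
        K = suc K′
        Q = length (filter (KFree? (2 ℕ.+ s)) (positives N))
        C ρ y r : ℚ
        C = C₀ * fromℕ K ^ suc a
        ρ = fromℕ R * rec N
        y = rec K ^ suc a * ρ
        r = seq (rpow X 0<X (mkℚ -[1+ a ] d cop)) i
        0≤y : 0ℚ ≤ y
        0≤y = 0≤* (0≤rec^ (suc a) K) (0≤* (0≤fromℕ R) (0≤rec N))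
        -- y is ρ divided by K^(a+1): exactly the quantity whose power `ρ-bound` compares with
        -- X^(-(a+1)).
        y≤ : y ≤ r + + 1 / suc i
        y≤ = ≤rootℚ d i 0≤y (subst (y ^ suc d ≤_) (sym (seq-^ᴿ (recip X 0<X) (suc a) i))
          (ρ-bound s g w (suc a) d K N R d≡ aw≡ R≤ (seq X i) 0<Xᵢ Xᵢ≤))
        ρ≡ : ρ ≡ fromℕ K ^ suc a * y
        ρ≡ = begin-equality
          ρ                                                   ≡⟨ *-identityˡ ρ ⟨
          1ℚ * ρ                                              ≡⟨ cong (_* ρ) (1^ (suc a)) ⟨
          1ℚ ^ suc a * ρ                                      ≡⟨ cong (λ t → t ^ suc a * ρ) (fromℕ*rec K) ⟨
          (fromℕ K * rec K) ^ suc a * ρ                       ≡⟨ cong (_* ρ) (^-distribʳ-* (suc a) (fromℕ K) (rec K)) ⟩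
          fromℕ K ^ suc a * rec K ^ suc a * ρ                 ≡⟨ *-assoc (fromℕ K ^ suc a) (rec K ^ suc a) ρ ⟩
          fromℕ K ^ suc a * y                                 ∎

-- The j-invariant and the height

abstract
  *≢0 : ∀ {i j} → i ≢ 0ℤ → j ≢ 0ℤ → i ℤ.* j ≢ 0ℤ
  *≢0 {i} i≢0 j≢0 eq with ℤ.i*j≡0⇒i≡0∨j≡0 i eq
  ... | inj₁ i≡0 = i≢0 i≡0
  ... | inj₂ j≡0 = j≢0 j≡0

  ℤ-cancelˡ : ∀ {i j k} → k ≢ 0ℤ → k ℤ.* i ≡ k ℤ.* j → i ≡ j
  ℤ-cancelˡ {i} {j} {k} k≢0 = ℤ.*-cancelˡ-≡ k i j {{ℤ.≢-nonZero k≢0}}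

  /1-injective : ∀ {i j} → i / 1 ≡ j / 1 → i ≡ j
  /1-injective {i} {j} eq
    with ℚᵘ.≃-trans (ℚᵘ.≃-sym (toℚᵘ-fromℚᵘ (mkℚᵘ i 0)))
           (ℚᵘ.≃-trans (ℚᵘ.≃-reflexive (cong toℚᵘ eq)) (toℚᵘ-fromℚᵘ (mkℚᵘ j 0)))
  ... | ℚᵘ.*≡* h = trans (sym (ℤ.*-identityʳ i)) (trans h (ℤ.*-identityʳ j))

  /1-* : ∀ i j → (i ℤ.* j) / 1 ≡ i / 1 * (j / 1)
  /1-* i j = fromℚᵘ-homo-* (mkℚᵘ i 0) (mkℚᵘ j 0)

  j*↧j : ∀ j → j * (↧ j / 1) ≡ ↥ j / 1
  j*↧j j@record{} = trans (cong (_* (↧ j / 1)) (sym (fromℚᵘ-toℚᵘ j)))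
    (trans (sym (fromℚᵘ-homo-* (toℚᵘ j) (mkℚᵘ (↧ j) 0)))
      (fromℚᵘ-cong {toℚᵘ j ℚᵘ.* mkℚᵘ (↧ j) 0} {mkℚᵘ (↥ j) 0} (ℚᵘ.*≡*
        (trans (lem (↥ j) (↧ j)) (cong (λ t → ↥ j ℤ.* + suc t) (sym (ℕ.*-identityʳ _)))))))
    where
    lem : ∀ n d → n ℤ.* d ℤ.* + 1 ≡ n ℤ.* d
    lem = ℤ+*.solve 2 (λ n d → n :* d :* con (+ 1) := n :* d) refl where open ℤ+*

  /1≢0 : ∀ {i} → i ≢ 0ℤ → NonZero (i / 1)
  /1≢0 i≢0 = ≢-nonZero λ eq → i≢0 (/1-injective eq)

  cancel-/1 : ∀ {p p′ i} → i ≢ 0ℤ → p * (i / 1) ≡ p′ * (i / 1) → p ≡ p′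
  cancel-/1 {p} {p′} {i} i≢0 eq = begin
    p                                ≡⟨ undo p ⟨
    p * (i / 1) * 1/ (i / 1)         ≡⟨ cong (_* 1/ (i / 1)) eq ⟩
    p′ * (i / 1) * 1/ (i / 1)        ≡⟨ undo p′ ⟩
    p′                               ∎
    where
    open ≡-Reasoning
    instance
      i/1≢0 : NonZero (i / 1)
      i/1≢0 = /1≢0 i≢0
    undo : ∀ p → p * (i / 1) * 1/ (i / 1) ≡ p
    undo p = trans (*-assoc p (i / 1) (1/ (i / 1))) (trans (cong (p *_) (*-inverseʳ (i / 1))) (*-identityʳ p))

disc : Curve → ℤ
disc (A , B) = + 4 ℤ.* A ℤ.^ 3 ℤ.+ + 27 ℤ.* B ℤ.^ 2

[1728-_]↧ : ℚ → ℤ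
[1728- j ]↧ = + 1728 ℤ.* ↧ j ℤ.- ↥ j

-- The equation j(E) = j with denominators cleared.
HasJ : ℚ → Curve → Set
HasJ j (A , B) = + 4 ℤ.* [1728- j ]↧ ℤ.* A ℤ.^ 3 ≡ + 27 ℤ.* ↥ j ℤ.* B ℤ.^ 2

abstract
  ℰ~⇒disc≢0 : ∀ E → ℰ~ E → disc E ≢ 0ℤ
  ℰ~⇒disc≢0 (A , B) Δ≢0 eq = Δ≢0 (trans (cong (ℤ.- (+ 16) ℤ.*_) eq) refl)

  disc≢0⇒ℰ~ : ∀ E → disc E ≢ 0ℤ → ℰ~ E
  disc≢0⇒ℰ~ E D≢0 = *≢0 {ℤ.- (+ 16)} (λ ()) D≢0

  cleared⇒HasJ : ∀ j A B → + 1728 ℤ.* (+ 4 ℤ.* A ℤ.^ 3) ℤ.* ↧ j ≡ ↥ j ℤ.* disc (A , B) → HasJ j (A , B)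
  cleared⇒HasJ j A B eq = trans (to₁ (↥ j) (↧ j) (A ℤ.^ 3))
    (trans (cong (λ t → t ℤ.- ↥ j ℤ.* (+ 4 ℤ.* A ℤ.^ 3)) eq) (to₂ (↥ j) (+ 4 ℤ.* A ℤ.^ 3) (B ℤ.^ 2)))
    where
    to₁ : ∀ n d a → + 4 ℤ.* (+ 1728 ℤ.* d ℤ.- n) ℤ.* a ≡ + 1728 ℤ.* (+ 4 ℤ.* a) ℤ.* d ℤ.- n ℤ.* (+ 4 ℤ.* a)
    to₁ = ℤ+*.solve 3 (λ n d a → con (+ 4) :* (con (+ 1728) :* d :- n) :* a :=
      con (+ 1728) :* (con (+ 4) :* a) :* d :- n :* (con (+ 4) :* a)) refl where open ℤ+*
    to₂ : ∀ n x b → n ℤ.* (x ℤ.+ + 27 ℤ.* b) ℤ.- n ℤ.* x ≡ + 27 ℤ.* n ℤ.* b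
    to₂ = ℤ+*.solve 3 (λ n x b → n :* (x :+ con (+ 27) :* b) :- n :* x := con (+ 27) :* n :* b) refl
      where open ℤ+*

  HasJ⇒cleared : ∀ j A B → HasJ j (A , B) → + 1728 ℤ.* (+ 4 ℤ.* A ℤ.^ 3) ℤ.* ↧ j ≡ ↥ j ℤ.* disc (A , B)
  HasJ⇒cleared j A B eq = trans (from₁ (↥ j) (↧ j) (A ℤ.^ 3))
    (trans (cong (λ t → t ℤ.+ ↥ j ℤ.* (+ 4 ℤ.* A ℤ.^ 3)) eq) (from₂ (↥ j) (+ 4 ℤ.* A ℤ.^ 3) (B ℤ.^ 2)))
    where
    from₁ : ∀ n d a → + 1728 ℤ.* (+ 4 ℤ.* a) ℤ.* d ≡ + 4 ℤ.* (+ 1728 ℤ.* d ℤ.- n) ℤ.* a ℤ.+ n ℤ.* (+ 4 ℤ.* a)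
    from₁ = ℤ+*.solve 3 (λ n d a → con (+ 1728) :* (con (+ 4) :* a) :* d :=
      con (+ 4) :* (con (+ 1728) :* d :- n) :* a :+ n :* (con (+ 4) :* a)) refl where open ℤ+*
    from₂ : ∀ n x b → + 27 ℤ.* n ℤ.* b ℤ.+ n ℤ.* x ≡ n ℤ.* (x ℤ.+ + 27 ℤ.* b)
    from₂ = ℤ+*.solve 3 (λ n x b → con (+ 27) :* n :* b :+ n :* x := n :* (x :+ con (+ 27) :* b)) refl
      where open ℤ+*

  module _ (A B : ℤ) (Δ≢0 : ℰ~ (A , B)) (j : ℚ) where
    private
      x y D n d : ℤ
      x = + 4 ℤ.* A ℤ.^ 3
      y = + 27 ℤ.* B ℤ.^ 2
      D = x ℤ.+ y
      n = ↥ j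
      d = ↧ j
      instance
        D/1≢0 : NonZero (D / 1)
        D/1≢0 = Δ≢0⇒nonZero A B Δ≢0
      q r : ℚ
      q = + 1728 / 1
      r = 1/ (D / 1)

      lem₁ : ∀ q x r D d → q * (x * r) * D * d ≡ q * x * d * (D * r)
      lem₁ = solve 5 (λ q x r D d → q :* (x :* r) :* D :* d := q :* x :* d :* (D :* r)) refl where open +-*-Solver

      jInv*D : jInv (A , B) Δ≢0 * (D / 1) * (d / 1) ≡ (+ 1728 ℤ.* x ℤ.* d) / 1
      jInv*D = trans (lem₁ q (x / 1) r (D / 1) (d / 1)) (trans (cong (q * (x / 1) * (d / 1) *_) (*-inverseʳ (D / 1)))
        (trans (*-identityʳ _) (sym (trans (/1-* (+ 1728 ℤ.* x) d) (cong (_* (d / 1)) (/1-* (+ 1728) x))))))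

      j*D : j * (D / 1) * (d / 1) ≡ (n ℤ.* D) / 1
      j*D = trans (lem₂ j (D / 1) (d / 1)) (trans (cong (_* (D / 1)) (j*↧j j)) (sym (/1-* n D)))
        where
        lem₂ : ∀ j D d → j * D * d ≡ j * d * D
        lem₂ = solve 3 (λ j D d → j :* D :* d := j :* d :* D) refl where open +-*-Solver

    jInv⇒HasJ : jInv (A , B) Δ≢0 ≡ j → HasJ j (A , B)
    jInv⇒HasJ eq = cleared⇒HasJ j A B (/1-injective (trans (sym jInv*D) (trans (cong (λ t → t * (D / 1) * (d / 1)) eq) j*D)))

    HasJ⇒jInv : HasJ j (A , B) → jInv (A , B) Δ≢0 ≡ j
    HasJ⇒jInv h = cancel-/1 (ℰ~⇒disc≢0 (A , B) Δ≢0) (cancel-/1 {i = d} (λ ())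
      (trans jInv*D (trans (cong (_/ 1) (HasJ⇒cleared j A B h)) (sym j*D))))

  i²≡∣i∣² : ∀ i → i ℤ.^ 2 ≡ + (ℤ.∣ i ∣ ℕ.^ 2)
  i²≡∣i∣² (+ n) = trans (cong (+ n ℤ.*_) (ℤ.*-identityʳ (+ n)))
    (trans (sym (ℤ.pos-* n n)) (cong (λ t → + (n ℕ.* t)) (sym (ℕ.*-identityʳ n))))
  i²≡∣i∣² -[1+ n ] = refl

  ↥≡0⇒≡0 : ∀ {j} → ↥ j ≡ 0ℤ → j ≡ 0ℚ
  ↥≡0⇒≡0 {j} eq = cancel-/1 {i = ↧ j} (λ ()) (trans (j*↧j j) (trans (cong (_/ 1) eq) (sym (*-zeroˡ (↧ j / 1)))))

  [1728-j]↧≡0⇔ : ∀ {j} → [1728- j ]↧ ≡ 0ℤ ⇔ j ≡ + 1728 / 1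
  [1728-j]↧≡0⇔ {j} = mk⇔
    (λ eq → cancel-/1 {i = ↧ j} (λ ()) (trans (j*↧j j)
      (trans (cong (_/ 1) (sym (ℤ.i-j≡0⇒i≡j (+ 1728 ℤ.* ↧ j) (↥ j) eq))) (/1-* (+ 1728) (↧ j)))))
    (λ eq → ℤ.i≡j⇒i-j≡0 (/1-injective {+ 1728 ℤ.* ↧ j} {↥ j} (trans (/1-* (+ 1728) (↧ j)) (trans (cong (_* (↧ j / 1)) (sym eq)) (j*↧j j)))))

  H-scale : ∀ α β m A B A′ B′ → ℤ.∣ A ∣ ℕ.^ 3 ≡ m ℕ.* ℤ.∣ A′ ∣ ℕ.^ 3 → ℤ.∣ B ∣ ℕ.^ 2 ≡ m ℕ.* ℤ.∣ B′ ∣ ℕ.^ 2 →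
    ∀ n → seq (H α β (A , B)) n ≡ fromℕ m * seq (H α β (A′ , B′)) n
  H-scale α β m A B A′ B′ hA hB n = begin
    a * fromℕ (ℤ.∣ A ∣ ℕ.^ 3) ⊔ b * (B ℤ.^ 2 / 1)
      ≡⟨ cong₂ (λ x y → a * x ⊔ b * y) (trans (cong fromℕ hA) (fromℕ-* m (ℤ.∣ A′ ∣ ℕ.^ 3)))
           (trans (cong (_/ 1) (i²≡∣i∣² B)) (trans (cong fromℕ hB) (fromℕ-* m (ℤ.∣ B′ ∣ ℕ.^ 2)))) ⟩
    a * (fromℕ m * x′) ⊔ b * (fromℕ m * y′)   ≡⟨ cong₂ _⊔_ (lem a (fromℕ m) x′) (lem b (fromℕ m) y′) ⟩
    fromℕ m * (a * x′) ⊔ fromℕ m * (b * y′)   ≡⟨ *-distribˡ-⊔-nonNeg (fromℕ m) {{nonNegative (0≤fromℕ m)}} (a * x′) (b * y′) ⟨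
    fromℕ m * (a * x′ ⊔ b * y′)               ≡⟨ cong (λ t → fromℕ m * (a * x′ ⊔ b * t)) (cong (_/ 1) (i²≡∣i∣² B′)) ⟨
    fromℕ m * (a * x′ ⊔ b * (B′ ℤ.^ 2 / 1))   ∎
    where
    open ≡-Reasoning
    a b x′ y′ : ℚ
    a = seq α n
    b = seq β n
    x′ = fromℕ (ℤ.∣ A′ ∣ ℕ.^ 3)
    y′ = fromℕ (ℤ.∣ B′ ∣ ℕ.^ 2)
    lem : ∀ a m x → a * (m * x) ≡ m * (a * x)
    lem = solve 3 (λ a m x → a :* (m :* x) := m :* (a :* x)) refl where open +-*-Solver

abstract
  -- A nonzero integer coordinate and α, β ≥ 1 make the height at least 1; its approximations
  -- eventually exceed any rational below 1, such as ½.
  H-lower : ∀ α β A B → 1ᴿ ≤ᴿ α → 1ᴿ ≤ᴿ β → A ≢ 0ℤ ⊎ B ≢ 0ℤ →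
    Σ[ N ∈ ℕ ] ∀ n → N ℕ.≤ n → ½ ≤ seq (H α β (A , B)) n
  H-lower α β A B 1≤α 1≤β A∨B = let N₁ , hα = 1≤α ½ (positive⁻¹ ½)
                                    N₂ , hβ = 1≤β ½ (positive⁻¹ ½)
    in N₁ ℕ.⊔ N₂ , λ n hn → go n (hα n (ℕ.m⊔n≤o⇒m≤o N₁ N₂ hn)) (hβ n (ℕ.m⊔n≤o⇒n≤o N₁ N₂ hn)) A∨B
    where
    open ≤-Reasoning
    ½≤* : ∀ a m → .{{ℕ.NonZero m}} → 1ℚ ≤ a + ½ → ½ ≤ a * fromℕ m
    ½≤* a m h = begin
      ½              ≤⟨ p≤q+e⇒p-q≤e {1ℚ} {½} (subst (1ℚ ≤_) (+-comm a ½) h) ⟩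
      a              ≤⟨ p≤q*p (≤-trans (nonNegative⁻¹ ½) (p≤q+e⇒p-q≤e {1ℚ} {½} (subst (1ℚ ≤_) (+-comm a ½) h))) (1≤fromℕ m) ⟩
      fromℕ m * a    ≡⟨ *-comm (fromℕ m) a ⟩
      a * fromℕ m    ∎
    go : ∀ n → 1ℚ ≤ seq α n + ½ → 1ℚ ≤ seq β n + ½ → A ≢ 0ℤ ⊎ B ≢ 0ℤ → ½ ≤ seq (H α β (A , B)) n
    go n hα hβ (inj₁ A≢0) = ≤-trans (½≤* (seq α n) (ℤ.∣ A ∣ ℕ.^ 3) {{ℕ.m^n≢0 ℤ.∣ A ∣ 3 {{∣t∣≢0 A≢0}}}} hα) (p≤p⊔q _ _)
    go n hα hβ (inj₂ B≢0) = ≤-trans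
      (subst (λ t → ½ ≤ seq β n * (t / 1)) (sym (i²≡∣i∣² B))
        (½≤* (seq β n) (ℤ.∣ B ∣ ℕ.^ 2) {{ℕ.m^n≢0 ℤ.∣ B ∣ 2 {{∣t∣≢0 B≢0}}}} hβ))
      (p≤q⊔p (seq α n * fromℕ (ℤ.∣ A ∣ ℕ.^ 3)) _)

-- The families for j = 0 and j = 1728

module _ (α β : ℝ) (1≤α : 1ᴿ ≤ᴿ α) (1≤β : 1ᴿ ≤ᴿ β) where

  -- The cleared equation forces A = 0. As p⁴ always divides 0, membership in `ℰ` depends on p⁶ ∤ B
  -- alone.
  family-0 : ∀ {j} → ↥ j ≡ 0ℤ → TwistFamily ℰ[ j ] ℰ~[ j ] (H α β) 4 2
  family-0 {j} n≡0 = record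
    { c           = λ t → 0ℤ , t
    ; c-injective = λ { refl → refl }
    ; G-to        = G-to
    ; G-from      = λ {t} t≢0 → in-ℰ~ t≢0 , j≡ {t} (in-ℰ~ t≢0)
    ; F⊆G         = λ (E∈ℰ , eq) → proj₁ E∈ℰ , eq
    ; F-to        = λ t≢0 ((_ , min) , _) p pp d → min (p , pp , (_ ℕ.∣0) , d)
    ; F-from      = λ {t} t≢0 free → (in-ℰ~ t≢0 , λ (p , pp , _ , d) → free p pp d) , j≡ {t} (in-ℰ~ t≢0)
    ; h-scale     = λ t → H-scale α β (ℤ.∣ t ∣ ℕ.^ 2) 0ℤ t 0ℤ (+ 1)
        (sym (ℕ.*-zeroʳ (ℤ.∣ t ∣ ℕ.^ 2))) (sym (ℕ.*-identityʳ (ℤ.∣ t ∣ ℕ.^ 2)))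
    ; h-lower     = H-lower α β 0ℤ (+ 1) 1≤α 1≤β (inj₂ λ ())
    }
    where
    j≢1728 : [1728- j ]↧ ≢ 0ℤ
    j≢1728 eq = *≢0 {+ 1728} {↧ j} (λ ()) (λ ()) (trans (ℤ.i-j≡0⇒i≡j (+ 1728 ℤ.* ↧ j) (↥ j) eq) n≡0)
    rhs≡0 : ∀ x → + 27 ℤ.* ↥ j ℤ.* x ≡ 0ℤ
    rhs≡0 x = cong (λ n → + 27 ℤ.* n ℤ.* x) n≡0
    G-to : ∀ {E} → ℰ~[ j ] E → ∃[ t ] t ≢ 0ℤ × E ≡ (0ℤ , t)
    G-to {A , B} (Δ≢0 , eq) = B ,
      (λ B≡0 → ℰ~⇒disc≢0 (A , B) Δ≢0 (cong₂ (λ A B → disc (A , B)) A≡0 B≡0)) , cong (_, B) A≡0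
      where
      A≡0 : A ≡ 0ℤ
      A≡0 = decidable-stable (A ℤ.≟ 0ℤ) λ A≢0 →
        *≢0 (*≢0 {+ 4} (λ ()) j≢1728) (λ A³≡0 → A≢0 (ℤ.i^n≡0⇒i≡0 A 3 A³≡0))
          (trans (jInv⇒HasJ A B Δ≢0 j eq) (rhs≡0 (B ℤ.^ 2)))
    in-ℰ~ : ∀ {t} → t ≢ 0ℤ → ℰ~ (0ℤ , t)
    in-ℰ~ {t} t≢0 = disc≢0⇒ℰ~ (0ℤ , t) λ eq → *≢0 {+ 27} (λ ()) (λ t²≡0 → t≢0 (ℤ.i^n≡0⇒i≡0 t 2 t²≡0))
      (trans (sym (ℤ.+-identityˡ (+ 27 ℤ.* t ℤ.^ 2))) eq)
    j≡ : ∀ {t} → (Δ≢0 : ℰ~ (0ℤ , t)) → jInv (0ℤ , t) Δ≢0 ≡ j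
    j≡ {t} Δ≢0 = HasJ⇒jInv 0ℤ t Δ≢0 j (trans (ℤ.*-zeroʳ (+ 4 ℤ.* [1728- j ]↧)) (sym (rhs≡0 (t ℤ.^ 2))))

  -- Now B = 0 is forced, and the remaining condition is p⁴ ∤ A.
  family-1728 : ∀ {j} → [1728- j ]↧ ≡ 0ℤ → TwistFamily ℰ[ j ] ℰ~[ j ] (H α β) 2 3
  family-1728 {j} u≡0 = record
    { c           = λ t → t , 0ℤ
    ; c-injective = λ { refl → refl }
    ; G-to        = G-to
    ; G-from      = λ {t} t≢0 → in-ℰ~ t≢0 , j≡ {t} (in-ℰ~ t≢0)
    ; F⊆G         = λ (E∈ℰ , eq) → proj₁ E∈ℰ , eq
    ; F-to        = λ t≢0 ((_ , min) , _) p pp d → min (p , pp , d , (_ ℕ.∣0))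
    ; F-from      = λ {t} t≢0 free → (in-ℰ~ t≢0 , λ (p , pp , d , _) → free p pp d) , j≡ {t} (in-ℰ~ t≢0)
    ; h-scale     = λ t → H-scale α β (ℤ.∣ t ∣ ℕ.^ 3) t 0ℤ (+ 1) 0ℤ
        (sym (ℕ.*-identityʳ (ℤ.∣ t ∣ ℕ.^ 3))) (sym (ℕ.*-zeroʳ (ℤ.∣ t ∣ ℕ.^ 3)))
    ; h-lower     = H-lower α β (+ 1) 0ℤ 1≤α 1≤β (inj₁ λ ())
    }
    where
    n≢0 : ↥ j ≢ 0ℤ
    n≢0 eq = *≢0 {+ 1728} {↧ j} (λ ()) (λ ()) (trans (ℤ.i-j≡0⇒i≡j (+ 1728 ℤ.* ↧ j) (↥ j) u≡0) eq)
    lhs≡0 : ∀ x → + 4 ℤ.* [1728- j ]↧ ℤ.* x ≡ 0ℤ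
    lhs≡0 x = cong (λ u → + 4 ℤ.* u ℤ.* x) u≡0
    G-to : ∀ {E} → ℰ~[ j ] E → ∃[ t ] t ≢ 0ℤ × E ≡ (t , 0ℤ)
    G-to {A , B} (Δ≢0 , eq) = A ,
      (λ A≡0 → ℰ~⇒disc≢0 (A , B) Δ≢0 (cong₂ (λ A B → disc (A , B)) A≡0 B≡0)) , cong (A ,_) B≡0
      where
      B≡0 : B ≡ 0ℤ
      B≡0 = decidable-stable (B ℤ.≟ 0ℤ) λ B≢0 →
        *≢0 (*≢0 {+ 27} (λ ()) n≢0) (λ B²≡0 → B≢0 (ℤ.i^n≡0⇒i≡0 B 2 B²≡0))
          (trans (sym (jInv⇒HasJ A B Δ≢0 j eq)) (lhs≡0 (A ℤ.^ 3)))
    in-ℰ~ : ∀ {t} → t ≢ 0ℤ → ℰ~ (t , 0ℤ)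
    in-ℰ~ {t} t≢0 = disc≢0⇒ℰ~ (t , 0ℤ) λ eq → *≢0 {+ 4} (λ ()) (λ t³≡0 → t≢0 (ℤ.i^n≡0⇒i≡0 t 3 t³≡0))
      (trans (sym (ℤ.+-identityʳ (+ 4 ℤ.* t ℤ.^ 3))) eq)
    j≡ : ∀ {t} → (Δ≢0 : ℰ~ (t , 0ℤ)) → jInv (t , 0ℤ) Δ≢0 ≡ j
    j≡ {t} Δ≢0 = HasJ⇒jInv t 0ℤ Δ≢0 j (trans (lhs≡0 (t ℤ.^ 3)) (sym (ℤ.*-zeroʳ (+ 27 ℤ.* ↥ j))))

-- Minimal curves and their twists

-- No twist can be divided out. This is stronger than the condition in `ℰ`, which forbids only w =
-- p²; it is what lets one curve produce all others of its j-invariant by integer twists.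
Minimal : ℕ → ℕ → Set
Minimal a b = ∀ w → w ℕ.^ 2 ∣ℕ a → w ℕ.^ 3 ∣ℕ b → w ≡ 1

abstract
  prime∤⇒coprime : ∀ {p s} → Prime p → ¬ p ∣ℕ s → Coprime p s
  prime∤⇒coprime pp p∤s (d∣p , d∣s) with prime⇒irreducible pp d∣p
  ... | inj₁ d≡1  = d≡1
  ... | inj₂ refl = contradiction d∣s p∤s

  coprime-divisorʳ : ∀ {m n o} → Coprime m n → m ∣ℕ o ℕ.* n → m ∣ℕ o
  coprime-divisorʳ {m} {n} {o} c h = Coprimality.coprime-divisor c (subst (m ∣ℕ_) (ℕ.*-comm o n) h)

  t²≡t^2 : ∀ t → t ℕ.* t ≡ t ℕ.^ 2
  t²≡t^2 t = cong (t ℕ.*_) (sym (ℕ.*-identityʳ t))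

  t³≡t^3 : ∀ t → t ℕ.* (t ℕ.* t) ≡ t ℕ.^ 3
  t³≡t^3 t = cong (t ℕ.*_) (t²≡t^2 t)

  -- With P/Q = p/q in lowest terms, q² divides a and q³ divides b.
  minimal⇒∣ : ∀ {a b A B P Q} .{{_ : ℕ.NonZero Q}} → Minimal a b →
    a ℕ.* (P ℕ.* P) ≡ A ℕ.* (Q ℕ.* Q) → b ℕ.* (P ℕ.* (P ℕ.* P)) ≡ B ℕ.* (Q ℕ.* (Q ℕ.* Q)) → Q ∣ℕ P
  minimal⇒∣ {a} {b} {A} {B} {P} {Q} min e₂ e₃ = subst (_∣ℕ P) (sym Q≡g) (gcd[m,n]∣m P Q)
    where
    g : ℕ
    g = gcd P Q
    instance
      g≢0 : ℕ.NonZero g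
      g≢0 = ℕ.≢-nonZero (gcd[m,n]≢0 P Q (inj₂ (ℕ.≢-nonZero⁻¹ Q)))
      gg≢0 : ℕ.NonZero (g ℕ.* g)
      gg≢0 = ℕ.m*n≢0 g g
      ggg≢0 : ℕ.NonZero (g ℕ.* (g ℕ.* g))
      ggg≢0 = ℕ.m*n≢0 g (g ℕ.* g)
    p q : ℕ
    p = P ℕ./ g
    q = Q ℕ./ g
    P≡ : P ≡ p ℕ.* g
    P≡ = sym (ℕ.m/n*n≡m (gcd[m,n]∣m P Q))
    Q≡ : Q ≡ q ℕ.* g
    Q≡ = sym (ℕ.m/n*n≡m (gcd[m,n]∣n P Q))
    lem₂ : ∀ a x g → a ℕ.* ((x ℕ.* g) ℕ.* (x ℕ.* g)) ≡ a ℕ.* (x ℕ.* x) ℕ.* (g ℕ.* g)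
    lem₂ = ℕ+*.solve 3 (λ a x g → a :* ((x :* g) :* (x :* g)) := a :* (x :* x) :* (g :* g)) refl where open ℕ+*
    lem₃ : ∀ a x g → a ℕ.* ((x ℕ.* g) ℕ.* ((x ℕ.* g) ℕ.* (x ℕ.* g))) ≡ a ℕ.* (x ℕ.* (x ℕ.* x)) ℕ.* (g ℕ.* (g ℕ.* g))
    lem₃ = ℕ+*.solve 3 (λ a x g → a :* ((x :* g) :* ((x :* g) :* (x :* g))) :=
      a :* (x :* (x :* x)) :* (g :* (g :* g))) refl where open ℕ+*
    f₂ : a ℕ.* (p ℕ.* p) ≡ A ℕ.* (q ℕ.* q)
    f₂ = ℕ.*-cancelʳ-≡ _ _ (g ℕ.* g) (trans (sym (lem₂ a p g)) (trans
      (subst₂ (λ x y → a ℕ.* (x ℕ.* x) ≡ A ℕ.* (y ℕ.* y)) P≡ Q≡ e₂) (lem₂ A q g)))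
    f₃ : b ℕ.* (p ℕ.* (p ℕ.* p)) ≡ B ℕ.* (q ℕ.* (q ℕ.* q))
    f₃ = ℕ.*-cancelʳ-≡ _ _ (g ℕ.* (g ℕ.* g)) (trans (sym (lem₃ b p g)) (trans
      (subst₂ (λ x y → b ℕ.* (x ℕ.* (x ℕ.* x)) ≡ B ℕ.* (y ℕ.* (y ℕ.* y))) P≡ Q≡ e₃) (lem₃ B q g)))
    q⊥p : Coprime q p
    q⊥p = Coprimality.sym (Coprimality.coprime-/gcd P Q)
    q≡1 : q ≡ 1
    q≡1 = min q
      (coprime-divisorʳ (coprime-^ 2 2 q⊥p) (subst₂ _∣ℕ_ (t²≡t^2 q) (cong (a ℕ.*_) (t²≡t^2 p)) (subst (q ℕ.* q ∣ℕ_) (sym f₂) (ℕ.n∣m*n A))))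
      (coprime-divisorʳ (coprime-^ 3 3 q⊥p) (subst₂ _∣ℕ_ (t³≡t^3 q) (cong (b ℕ.*_) (t³≡t^3 p)) (subst (q ℕ.* (q ℕ.* q) ∣ℕ_) (sym f₃) (ℕ.n∣m*n B))))
    Q≡g : Q ≡ g
    Q≡g = trans Q≡ (trans (cong (ℕ._* g) q≡1) (ℕ.*-identityˡ g))

  -- Only the case p ∣ t needs thought: t = s p with p ∤ s as t is squarefree.
  minimal-twist : ∀ {a b t p} → Minimal a b → KFree 2 t → Prime p →
    p ℕ.^ 4 ∣ℕ a ℕ.* (t ℕ.* t) → ¬ p ℕ.^ 6 ∣ℕ b ℕ.* (t ℕ.* (t ℕ.* t))
  minimal-twist {a} {b} {t} {p} min free pp p⁴∣ p⁶∣ with p ∣ℕ? t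
  -- Only the divisors p² and p³ are kept here; both are coprime to t, so they divide a and b.
  ... | no  p∤t = prime⇒≢1 pp (min p (strip 2 a p∤t (subst (p ℕ.^ 2 ∣ℕ_) (cong (a ℕ.*_) (t²≡t^2 t)) (ℕ.∣-trans (∣^ 2 2) p⁴∣)))
                                     (strip 3 b p∤t (subst (p ℕ.^ 3 ∣ℕ_) (cong (b ℕ.*_) (t³≡t^3 t)) (ℕ.∣-trans (∣^ 3 3) p⁶∣))))
    where
    strip : ∀ i a {s} → ¬ p ∣ℕ s → p ℕ.^ i ∣ℕ a ℕ.* s ℕ.^ i → p ℕ.^ i ∣ℕ a
    strip i a p∤s = coprime-divisorʳ (coprime-^ i i (prime∤⇒coprime pp p∤s))
    ∣^ : ∀ i j → p ℕ.^ i ∣ℕ p ℕ.^ (i ℕ.+ j)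
    ∣^ i j = subst (p ℕ.^ i ∣ℕ_) (sym (ℕ.^-distribˡ-+-* p i j)) (ℕ.m∣m*n (p ℕ.^ j))
  ... | yes (ℕ.divides s refl) = prime⇒≢1 pp (min p
      (strip 2 a (ℕ.*-cancelʳ-∣ (p ℕ.^ 2) {{nonZero-^ (prime⇒nonZero pp) 2}} (subst₂ _∣ℕ_ (ℕ.^-distribˡ-+-* p 2 2) (lem₂ a s p) p⁴∣)))
      (strip 3 b (ℕ.*-cancelʳ-∣ (p ℕ.^ 3) {{nonZero-^ (prime⇒nonZero pp) 3}} (subst₂ _∣ℕ_ (ℕ.^-distribˡ-+-* p 3 3) (lem₃ b s p) p⁶∣))))
    where
    p∤s : ¬ p ∣ℕ s
    p∤s p∣s = free p pp (subst (_∣ℕ s ℕ.* p) (t²≡t^2 p) (ℕ.*-monoˡ-∣ p p∣s))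
    strip : ∀ i a → p ℕ.^ i ∣ℕ a ℕ.* s ℕ.^ i → p ℕ.^ i ∣ℕ a
    strip i a = coprime-divisorʳ (coprime-^ i i (prime∤⇒coprime pp p∤s))
    lem₂ : ∀ a s p → a ℕ.* ((s ℕ.* p) ℕ.* (s ℕ.* p)) ≡ a ℕ.* s ℕ.^ 2 ℕ.* p ℕ.^ 2
    lem₂ = ℕ+*.solve 3 (λ a s p → a :* ((s :* p) :* (s :* p)) :=
      a :* (s :* (s :* con 1)) :* (p :* (p :* con 1))) refl where open ℕ+*
    lem₃ : ∀ a s p → a ℕ.* ((s ℕ.* p) ℕ.* ((s ℕ.* p) ℕ.* (s ℕ.* p))) ≡ a ℕ.* s ℕ.^ 3 ℕ.* p ℕ.^ 3
    lem₃ = ℕ+*.solve 3 (λ a s p → a :* ((s :* p) :* ((s :* p) :* (s :* p))) :=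
      a :* (s :* (s :* (s :* con 1))) :* (p :* (p :* (p :* con 1)))) refl where open ℕ+*

twist : Curve → ℤ → Curve
twist (a , b) t = a ℤ.* (t ℤ.* t) , b ℤ.* (t ℤ.* (t ℤ.* t))

MinimalCurve : Curve → Set
MinimalCurve (a , b) = Minimal ℤ.∣ a ∣ ℤ.∣ b ∣

abstract
  ∣twist∣₁ : ∀ a t → ℤ.∣ a ℤ.* (t ℤ.* t) ∣ ≡ ℤ.∣ a ∣ ℕ.* (ℤ.∣ t ∣ ℕ.* ℤ.∣ t ∣)
  ∣twist∣₁ a t = trans (ℤ.abs-* a (t ℤ.* t)) (cong (ℤ.∣ a ∣ ℕ.*_) (ℤ.abs-* t t))

  ∣twist∣₂ : ∀ b t → ℤ.∣ b ℤ.* (t ℤ.* (t ℤ.* t)) ∣ ≡ ℤ.∣ b ∣ ℕ.* (ℤ.∣ t ∣ ℕ.* (ℤ.∣ t ∣ ℕ.* ℤ.∣ t ∣))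
  ∣twist∣₂ b t = trans (ℤ.abs-* b (t ℤ.* (t ℤ.* t))) (cong (ℤ.∣ b ∣ ℕ.*_) (∣twist∣₁ t t))

  -- The largest v with v² ∣ A and v³ ∣ B is divided out: another factor w would make w v a larger
  -- candidate. The search may stop at |A| because v ≤ v² ≤ |A|.
  minimal-model : ∀ A B → A ≢ 0ℤ → B ≢ 0ℤ →
    Σ[ E ∈ Curve ] Σ[ t ∈ ℤ ] (t ≢ 0ℤ × (A , B) ≡ twist E t × MinimalCurve E)
  minimal-model A B A≢0 B≢0 = (a , b) , + v , (λ eq → ℕ.<⇒≢ 1≤v (sym (ℤ.+-injective eq))) , cong₂ _,_ A≡ B≡ , minimal
    where
    instance
      ∣A∣≢0 : ℕ.NonZero ℤ.∣ A ∣
      ∣A∣≢0 = ∣t∣≢0 A≢0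
    P : ℕ → Set
    P v = v ℕ.^ 2 ∣ℕ ℤ.∣ A ∣ × v ℕ.^ 3 ∣ℕ ℤ.∣ B ∣
    P? : ∀ v → Dec (P v)
    P? v = (v ℕ.^ 2 ∣ℕ? ℤ.∣ A ∣) ×-dec (v ℕ.^ 3 ∣ℕ? ℤ.∣ B ∣)
    v : ℕ
    v = greatest P? ℤ.∣ A ∣
    ≤v : ∀ {w} → P w → w ℕ.≤ v
    ≤v {w} h = ≤greatest P? ℤ.∣ A ∣ h (ℕ.≤-trans (n≤n^ w 2) (ℕ.∣⇒≤ (proj₁ h)))
    1≤v : 1 ℕ.≤ v
    1≤v = ≤v (ℕ.1∣ ℤ.∣ A ∣ , ℕ.1∣ ℤ.∣ B ∣)
    Pv : P v
    Pv with greatest-holds P? ℤ.∣ A ∣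
    ... | inj₁ v≡0 = contradiction (subst (1 ℕ.≤_) v≡0 1≤v) λ ()
    ... | inj₂ h   = h
    v²∣A : + v ℤ.* + v ℤ-Signed.∣ A
    v²∣A = ℤ-Signed.∣ᵤ⇒∣ (subst (_∣ℕ ℤ.∣ A ∣) (trans (sym (t²≡t^2 v)) (sym (ℤ.abs-* (+ v) (+ v)))) (proj₁ Pv))
    v³∣B : + v ℤ.* (+ v ℤ.* + v) ℤ-Signed.∣ B
    v³∣B = ℤ-Signed.∣ᵤ⇒∣ (subst (_∣ℕ ℤ.∣ B ∣) (trans (sym (t³≡t^3 v)) (sym (∣twist∣₁ (+ v) (+ v)))) (proj₂ Pv))
    a b : ℤ
    a = ℤ-Signed._∣_.quotient v²∣A
    b = ℤ-Signed._∣_.quotient v³∣B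
    A≡ : A ≡ a ℤ.* (+ v ℤ.* + v)
    A≡ = ℤ-Signed._∣_.equality v²∣A
    B≡ : B ≡ b ℤ.* (+ v ℤ.* (+ v ℤ.* + v))
    B≡ = ℤ-Signed._∣_.equality v³∣B
    minimal : Minimal ℤ.∣ a ∣ ℤ.∣ b ∣
    minimal w w²∣a w³∣b = ℕ.≤-antisym w≤1 (ℕ.n≢0⇒n>0 w≢0)
      where
      Pwv : P (w ℕ.* v)
      Pwv = subst₂ _∣ℕ_ (sym (^ℕ-distribʳ-* 2 w v)) (sym (trans (cong ℤ.∣_∣ A≡) (trans (∣twist∣₁ a (+ v)) (cong (ℤ.∣ a ∣ ℕ.*_) (t²≡t^2 v)))))
              (ℕ.*-pres-∣ w²∣a (ℕ.∣-refl {v ℕ.^ 2})) ,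
            subst₂ _∣ℕ_ (sym (^ℕ-distribʳ-* 3 w v)) (sym (trans (cong ℤ.∣_∣ B≡) (trans (∣twist∣₂ b (+ v)) (cong (ℤ.∣ b ∣ ℕ.*_) (t³≡t^3 v)))))
              (ℕ.*-pres-∣ w³∣b (ℕ.∣-refl {v ℕ.^ 3}))
      w≤1 : w ℕ.≤ 1
      w≤1 = ℕ.*-cancelʳ-≤ w 1 v {{ℕ.>-nonZero 1≤v}} (subst (w ℕ.* v ℕ.≤_) (sym (ℕ.*-identityˡ v)) (≤v Pwv))
      w≢0 : w ≢ 0
      w≢0 refl = A≢0 (ℤ.∣i∣≡0⇒i≡0 (ℕ.0∣⇒≡0 (proj₁ Pwv)))

  module _ (U V : ℤ) where
    private
      lem-A : ∀ U a t → U ℤ.* (a ℤ.* (t ℤ.* t)) ℤ.^ 3 ≡ t ℤ.^ 6 ℤ.* (U ℤ.* a ℤ.^ 3)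
      lem-A = ℤ+*.solve 3 (λ U a t →
        let a′ = a :* (t :* t) in
        U :* (a′ :* (a′ :* (a′ :* con (+ 1)))) :=
        t :* (t :* (t :* (t :* (t :* (t :* con (+ 1)))))) :* (U :* (a :* (a :* (a :* con (+ 1)))))) refl
        where open ℤ+*
      lem-B : ∀ V b t → V ℤ.* (b ℤ.* (t ℤ.* (t ℤ.* t))) ℤ.^ 2 ≡ t ℤ.^ 6 ℤ.* (V ℤ.* b ℤ.^ 2)
      lem-B = ℤ+*.solve 3 (λ V b t →
        let b′ = b :* (t :* (t :* t)) in
        V :* (b′ :* (b′ :* con (+ 1))) :=
        t :* (t :* (t :* (t :* (t :* (t :* con (+ 1)))))) :* (V :* (b :* (b :* con (+ 1))))) refl
        where open ℤ+*

    relation-twist : ∀ a b t → U ℤ.* a ℤ.^ 3 ≡ V ℤ.* b ℤ.^ 2 →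
      U ℤ.* (a ℤ.* (t ℤ.* t)) ℤ.^ 3 ≡ V ℤ.* (b ℤ.* (t ℤ.* (t ℤ.* t))) ℤ.^ 2
    relation-twist a b t eq = trans (lem-A U a t) (trans (cong (t ℤ.^ 6 ℤ.*_) eq) (sym (lem-B V b t)))

    relation-untwist : ∀ a b t → t ≢ 0ℤ →
      U ℤ.* (a ℤ.* (t ℤ.* t)) ℤ.^ 3 ≡ V ℤ.* (b ℤ.* (t ℤ.* (t ℤ.* t))) ℤ.^ 2 → U ℤ.* a ℤ.^ 3 ≡ V ℤ.* b ℤ.^ 2
    relation-untwist a b t t≢0 eq = ℤ-cancelˡ {k = t ℤ.^ 6} (λ h → t≢0 (ℤ.i^n≡0⇒i≡0 t 6 h))
      (trans (sym (lem-A U a t)) (trans eq (lem-B V b t)))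

    -- Crosswise multiplication of the two relations gives both sides the factor U V; after its
    -- cancellation j no longer occurs.
    relation-eliminate : U ≢ 0ℤ → V ≢ 0ℤ → ∀ a b A B → U ℤ.* a ℤ.^ 3 ≡ V ℤ.* b ℤ.^ 2 → U ℤ.* A ℤ.^ 3 ≡ V ℤ.* B ℤ.^ 2 →
      a ℤ.^ 3 ℤ.* B ℤ.^ 2 ≡ A ℤ.^ 3 ℤ.* b ℤ.^ 2
    relation-eliminate U≢0 V≢0 a b A B h h′ = ℤ-cancelˡ (*≢0 {U} U≢0 V≢0)
      (trans (lem U V (a ℤ.^ 3) (B ℤ.^ 2)) (trans (cong₂ ℤ._*_ h (sym h′)) (lem′ U V (A ℤ.^ 3) (b ℤ.^ 2))))
      where
      lem : ∀ U V x y → U ℤ.* V ℤ.* (x ℤ.* y) ≡ (U ℤ.* x) ℤ.* (V ℤ.* y)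
      lem = ℤ+*.solve 4 (λ U V x y → U :* V :* (x :* y) := (U :* x) :* (V :* y)) refl where open ℤ+*
      lem′ : ∀ U V x y → (V ℤ.* y) ℤ.* (U ℤ.* x) ≡ U ℤ.* V ℤ.* (x ℤ.* y)
      lem′ = ℤ+*.solve 4 (λ U V x y → (V :* y) :* (U :* x) := U :* V :* (x :* y)) refl where open ℤ+*

  -- From a³B² = A³b², the parameter is t = aB/(Ab); it is an integer by minimality of (a, b).
  untwist : ∀ a b A B → MinimalCurve (a , b) → b ≢ 0ℤ → A ≢ 0ℤ →
    a ℤ.^ 3 ℤ.* B ℤ.^ 2 ≡ A ℤ.^ 3 ℤ.* b ℤ.^ 2 → ∃[ t ] (A , B) ≡ twist (a , b) t
  untwist a b A B min b≢0 A≢0 eq = t ,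
      cong₂ _,_ (ℤ-cancelˡ (*≢0 {Q} Q≢0 Q≢0) (trans (swap (Q ℤ.* Q) A) (trans (sym e₂) (trans (cong (λ P → a ℤ.* (P ℤ.* P)) P≡) (lem-t₂ a t Q)))))
                (ℤ-cancelˡ (*≢0 {Q} Q≢0 (*≢0 {Q} Q≢0 Q≢0)) (trans (swap (Q ℤ.* (Q ℤ.* Q)) B)
                  (trans (sym e₃) (trans (cong (λ P → b ℤ.* (P ℤ.* (P ℤ.* P))) P≡) (lem-t₃ b t Q)))))
    where
    P Q : ℤ
    P = a ℤ.* B
    Q = A ℤ.* b
    Q≢0 : Q ≢ 0ℤ
    Q≢0 = *≢0 {A} A≢0 b≢0
    lem-P₂ : ∀ a B → a ℤ.* ((a ℤ.* B) ℤ.* (a ℤ.* B)) ≡ a ℤ.^ 3 ℤ.* B ℤ.^ 2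
    lem-P₂ = ℤ+*.solve 2 (λ a B → a :* ((a :* B) :* (a :* B)) :=
      (a :* (a :* (a :* con (+ 1)))) :* (B :* (B :* con (+ 1)))) refl where open ℤ+*
    lem-P₃ : ∀ a b B → b ℤ.* ((a ℤ.* B) ℤ.* ((a ℤ.* B) ℤ.* (a ℤ.* B))) ≡ b ℤ.* B ℤ.* (a ℤ.^ 3 ℤ.* B ℤ.^ 2)
    lem-P₃ = ℤ+*.solve 3 (λ a b B → b :* ((a :* B) :* ((a :* B) :* (a :* B))) :=
      b :* B :* ((a :* (a :* (a :* con (+ 1)))) :* (B :* (B :* con (+ 1))))) refl where open ℤ+*
    lem-Q₃ : ∀ A b B → b ℤ.* B ℤ.* (A ℤ.^ 3 ℤ.* b ℤ.^ 2) ≡ B ℤ.* ((A ℤ.* b) ℤ.* ((A ℤ.* b) ℤ.* (A ℤ.* b)))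
    lem-Q₃ = ℤ+*.solve 3 (λ A b B → b :* B :* ((A :* (A :* (A :* con (+ 1)))) :* (b :* (b :* con (+ 1)))) :=
      B :* ((A :* b) :* ((A :* b) :* (A :* b)))) refl where open ℤ+*
    lem-t₂ : ∀ a t Q → a ℤ.* ((t ℤ.* Q) ℤ.* (t ℤ.* Q)) ≡ Q ℤ.* Q ℤ.* (a ℤ.* (t ℤ.* t))
    lem-t₂ = ℤ+*.solve 3 (λ a t Q → a :* ((t :* Q) :* (t :* Q)) := Q :* Q :* (a :* (t :* t))) refl where open ℤ+*
    lem-t₃ : ∀ b t Q → b ℤ.* ((t ℤ.* Q) ℤ.* ((t ℤ.* Q) ℤ.* (t ℤ.* Q))) ≡ Q ℤ.* (Q ℤ.* Q) ℤ.* (b ℤ.* (t ℤ.* (t ℤ.* t)))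
    lem-t₃ = ℤ+*.solve 3 (λ b t Q → b :* ((t :* Q) :* ((t :* Q) :* (t :* Q))) :=
      Q :* (Q :* Q) :* (b :* (t :* (t :* t)))) refl where open ℤ+*
    swap : ∀ x y → x ℤ.* y ≡ y ℤ.* x
    swap = ℤ.*-comm
    -- `e₂` and `e₃` make (A, B) the twist of (a, b) by the fraction P/Q, which `minimal⇒∣` shows to
    -- be an integer.
    e₂ : a ℤ.* (P ℤ.* P) ≡ A ℤ.* (Q ℤ.* Q)
    e₂ = trans (lem-P₂ a B) (trans eq (sym (lem-P₂ A b)))
    e₃ : b ℤ.* (P ℤ.* (P ℤ.* P)) ≡ B ℤ.* (Q ℤ.* (Q ℤ.* Q))
    e₃ = trans (lem-P₃ a b B) (trans (cong (b ℤ.* B ℤ.*_) eq) (lem-Q₃ A b B))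
    Q∣P : Q ℤ-Signed.∣ P
    Q∣P = ℤ-Signed.∣ᵤ⇒∣ (minimal⇒∣ {ℤ.∣ a ∣} {ℤ.∣ b ∣} {ℤ.∣ A ∣} {ℤ.∣ B ∣} {{∣t∣≢0 Q≢0}} min
      (trans (sym (∣twist∣₁ a P)) (trans (cong ℤ.∣_∣ e₂) (∣twist∣₁ A Q)))
      (trans (sym (∣twist∣₂ b P)) (trans (cong ℤ.∣_∣ e₃) (∣twist∣₂ B Q))))
    t : ℤ
    t = ℤ-Signed._∣_.quotient Q∣P
    P≡ : P ≡ t ℤ.* Q
    P≡ = ℤ-Signed._∣_.equality Q∣P

  -- A nonzero parameter is recovered as t³ / t².
  twist-injective : ∀ a b → a ≢ 0ℤ → b ≢ 0ℤ → ∀ {t u} → twist (a , b) t ≡ twist (a , b) u → t ≡ u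
  twist-injective a b a≢0 b≢0 {t} {u} eq = by-cases (u ℤ.≟ 0ℤ)
    where
    t²≡u² : t ℤ.* t ≡ u ℤ.* u
    t²≡u² = ℤ-cancelˡ a≢0 (cong proj₁ eq)
    t³≡u³ : t ℤ.* (t ℤ.* t) ≡ u ℤ.* (u ℤ.* u)
    t³≡u³ = ℤ-cancelˡ b≢0 (cong proj₂ eq)
    by-cases : Dec (u ≡ 0ℤ) → t ≡ u
    by-cases (no u≢0) = ℤ-cancelˡ (*≢0 {u} u≢0 u≢0) (trans (ℤ.*-comm (u ℤ.* u) t)
      (trans (cong (t ℤ.*_) (sym t²≡u²)) (trans t³≡u³ (ℤ.*-comm u (u ℤ.* u)))))
    by-cases (yes u≡0) = trans (decidable-stable (t ℤ.≟ 0ℤ) λ t≢0 →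
      *≢0 {t} t≢0 t≢0 (trans t²≡u² (cong (λ u → u ℤ.* u) u≡0))) (sym u≡0)

abstract
  -- A vanishing discriminant would leave 1728 · 4A³ · `↧ j` = 0 in the cleared equation.
  HasJ⇒ℰ~ : ∀ j A B → A ≢ 0ℤ → HasJ j (A , B) → ℰ~ (A , B)
  HasJ⇒ℰ~ j A B A≢0 h = disc≢0⇒ℰ~ (A , B) λ D≡0 →
    *≢0 (*≢0 {+ 1728} (λ ()) (*≢0 {+ 4} (λ ()) (λ A³≡0 → A≢0 (ℤ.i^n≡0⇒i≡0 A 3 A³≡0)))) (λ ())
      (trans (HasJ⇒cleared j A B h) (trans (cong (↥ j ℤ.*_) D≡0) (ℤ.*-zeroʳ (↥ j))))

  -- The curve is y² = x³ + 3j(1728 - j)x + 2j(1728 - j)², rescaled to clear denominators.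
  minimal-curve : ∀ j → ↥ j ≢ 0ℤ → [1728- j ]↧ ≢ 0ℤ →
    Σ[ a ∈ ℤ ] Σ[ b ∈ ℤ ] (a ≢ 0ℤ × b ≢ 0ℤ × HasJ j (a , b) × MinimalCurve (a , b))
  minimal-curve j n≢0 u≢0 = from-model (minimal-model A₁ B₁ A₁≢0 B₁≢0)
    where
    n u A₁ B₁ : ℤ
    n = ↥ j
    u = [1728- j ]↧
    A₁ = + 3 ℤ.* n ℤ.* u
    B₁ = + 2 ℤ.* n ℤ.* (u ℤ.* u)
    A₁≢0 : A₁ ≢ 0ℤ
    A₁≢0 = *≢0 (*≢0 {+ 3} (λ ()) n≢0) u≢0
    B₁≢0 : B₁ ≢ 0ℤ
    B₁≢0 = *≢0 (*≢0 {+ 2} (λ ()) n≢0) (*≢0 {u} u≢0 u≢0)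
    lem : ∀ n u → + 4 ℤ.* u ℤ.* (+ 3 ℤ.* n ℤ.* u) ℤ.^ 3 ≡ + 27 ℤ.* n ℤ.* (+ 2 ℤ.* n ℤ.* (u ℤ.* u)) ℤ.^ 2
    lem = ℤ+*.solve 2 (λ n u →
      let A = con (+ 3) :* n :* u
          B = con (+ 2) :* n :* (u :* u) in
      con (+ 4) :* u :* (A :* (A :* (A :* con (+ 1)))) := con (+ 27) :* n :* (B :* (B :* con (+ 1)))) refl
      where open ℤ+*
    from-model : Σ[ E ∈ Curve ] Σ[ t ∈ ℤ ] (t ≢ 0ℤ × (A₁ , B₁) ≡ twist E t × MinimalCurve E) →
      Σ[ a ∈ ℤ ] Σ[ b ∈ ℤ ] (a ≢ 0ℤ × b ≢ 0ℤ × HasJ j (a , b) × MinimalCurve (a , b))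
    from-model ((a , b) , t , t≢0 , eq , min) = a , b ,
      (λ a≡0 → A₁≢0 (trans (cong proj₁ eq) (cong (λ a → a ℤ.* (t ℤ.* t)) a≡0))) ,
      (λ b≡0 → B₁≢0 (trans (cong proj₂ eq) (cong (λ b → b ℤ.* (t ℤ.* (t ℤ.* t))) b≡0))) ,
      relation-untwist (+ 4 ℤ.* u) (+ 27 ℤ.* n) a b t t≢0
        (subst (λ (A , B) → + 4 ℤ.* u ℤ.* A ℤ.^ 3 ≡ + 27 ℤ.* n ℤ.* B ℤ.^ 2) eq (lem n u)) ,
      min

-- The family for all other j

module _ (α β : ℝ) (1≤α : 1ᴿ ≤ᴿ α) (1≤β : 1ᴿ ≤ᴿ β) where

  -- If p² ∣ t, then p⁴ ∣ a t² and p⁶ ∣ b t³. The converse, that a squarefree t stays in `ℰ`, is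
  -- `minimal-twist` and rests on the minimality of (a, b).
  family-generic : ∀ {j} → ↥ j ≢ 0ℤ → [1728- j ]↧ ≢ 0ℤ → TwistFamily ℰ[ j ] ℰ~[ j ] (H α β) 0 6
  family-generic {j} n≢0 u≢0 = from-minimal (minimal-curve j n≢0 u≢0)
    where
    n u : ℤ
    n = ↥ j
    u = [1728- j ]↧
    U≢0 : + 4 ℤ.* u ≢ 0ℤ
    U≢0 = *≢0 {+ 4} (λ ()) u≢0
    V≢0 : + 27 ℤ.* n ≢ 0ℤ
    V≢0 = *≢0 {+ 27} (λ ()) n≢0
    from-minimal : Σ[ a ∈ ℤ ] Σ[ b ∈ ℤ ] (a ≢ 0ℤ × b ≢ 0ℤ × HasJ j (a , b) × MinimalCurve (a , b)) →
      TwistFamily ℰ[ j ] ℰ~[ j ] (H α β) 0 6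
    from-minimal (a , b , a≢0 , b≢0 , h , min) = record
      { c           = c
      ; c-injective = twist-injective a b a≢0 b≢0
      ; G-to        = G-to
      ; G-from      = λ {t} t≢0 → in-ℰ~ t t≢0 , j≡ t (in-ℰ~ t t≢0)
      ; F⊆G         = λ (E∈ℰ , eq) → proj₁ E∈ℰ , eq
      ; F-to        = λ {t} t≢0 ((_ , nop) , _) → F-to t nop
      ; F-from      = λ {t} t≢0 free → (in-ℰ~ t t≢0 , F-from t free) , j≡ t (in-ℰ~ t t≢0)
      ; h-scale     = λ t → H-scale α β (ℤ.∣ t ∣ ℕ.^ 6) (A t) (B t) (A (+ 1)) (B (+ 1)) (scale-A t) (scale-B t)
      ; h-lower     = H-lower α β (A (+ 1)) (B (+ 1)) 1≤α 1≤β (inj₁ (A≢0 (+ 1) λ ()))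
      }
      where
      c : ℤ → Curve
      c = twist (a , b)
      A B : ℤ → ℤ
      A t = proj₁ (c t)
      B t = proj₂ (c t)
      A≢0 : ∀ t → t ≢ 0ℤ → A t ≢ 0ℤ
      A≢0 t t≢0 = *≢0 a≢0 (*≢0 {t} t≢0 t≢0)
      has-j : ∀ t → HasJ j (c t)
      has-j t = relation-twist (+ 4 ℤ.* u) (+ 27 ℤ.* n) a b t h
      in-ℰ~ : ∀ t → t ≢ 0ℤ → ℰ~ (c t)
      in-ℰ~ t t≢0 = HasJ⇒ℰ~ j (A t) (B t) (A≢0 t t≢0) (has-j t)
      j≡ : ∀ t (Δ≢0 : ℰ~ (c t)) → jInv (c t) Δ≢0 ≡ j
      j≡ t Δ≢0 = HasJ⇒jInv (A t) (B t) Δ≢0 j (has-j t)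
      G-to : ∀ {E} → ℰ~[ j ] E → ∃[ t ] t ≢ 0ℤ × E ≡ c t
      G-to {A , B} (Δ≢0 , eq) =
        let t , E≡ = untwist a b A B min b≢0 A≢0′ (relation-eliminate (+ 4 ℤ.* u) (+ 27 ℤ.* n) U≢0 V≢0 a b A B h hAB)
        in t , (λ t≡0 → A≢0′ (trans (cong proj₁ E≡) (trans (cong (λ t → a ℤ.* (t ℤ.* t)) t≡0) (ℤ.*-zeroʳ a)))) , E≡
        where
        hAB : HasJ j (A , B)
        hAB = jInv⇒HasJ A B Δ≢0 j eq
        A≢0′ : A ≢ 0ℤ
        A≢0′ A≡0 = *≢0 {n} n≢0 (ℰ~⇒disc≢0 (A , B) Δ≢0)
          (trans (sym (HasJ⇒cleared j A B hAB)) (cong (λ A → + 1728 ℤ.* (+ 4 ℤ.* A ℤ.^ 3) ℤ.* ↧ j) A≡0))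
      F-to : ∀ t → ¬ (∃[ p ] Prime p × + (p ℕ.^ 4) ℤ.∣ A t × + (p ℕ.^ 6) ℤ.∣ B t) → KFree 2 ℤ.∣ t ∣
      F-to t nop p pp d = nop (p , pp ,
        subst₂ _∣ℕ_ (sym (ℕ.^-distribˡ-+-* p 2 2)) (sym (∣twist∣₁ a t)) (ℕ.∣n⇒∣m*n ℤ.∣ a ∣ (ℕ.*-pres-∣ d d)) ,
        subst₂ _∣ℕ_ (sym p⁶≡) (sym (∣twist∣₂ b t)) (ℕ.∣n⇒∣m*n ℤ.∣ b ∣ (ℕ.*-pres-∣ d (ℕ.*-pres-∣ d d))))
        where
        p⁶≡ : p ℕ.^ 6 ≡ p ℕ.^ 2 ℕ.* (p ℕ.^ 2 ℕ.* p ℕ.^ 2)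
        p⁶≡ = trans (ℕ.^-distribˡ-+-* p 2 4) (cong (p ℕ.^ 2 ℕ.*_) (ℕ.^-distribˡ-+-* p 2 2))
      F-from : ∀ t → KFree 2 ℤ.∣ t ∣ → ¬ (∃[ p ] Prime p × + (p ℕ.^ 4) ℤ.∣ A t × + (p ℕ.^ 6) ℤ.∣ B t)
      F-from t free (p , pp , d₄ , d₆) = minimal-twist {ℤ.∣ a ∣} {ℤ.∣ b ∣} min free pp
        (subst (p ℕ.^ 4 ∣ℕ_) (∣twist∣₁ a t) d₄) (subst (p ℕ.^ 6 ∣ℕ_) (∣twist∣₂ b t) d₆)
      scale-A : ∀ t → ℤ.∣ A t ∣ ℕ.^ 3 ≡ ℤ.∣ t ∣ ℕ.^ 6 ℕ.* ℤ.∣ A (+ 1) ∣ ℕ.^ 3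
      scale-A t = trans (cong (ℕ._^ 3) (∣twist∣₁ a t)) (trans (lem ℤ.∣ a ∣ ℤ.∣ t ∣)
        (cong (λ x → ℤ.∣ t ∣ ℕ.^ 6 ℕ.* x ℕ.^ 3) (sym (∣twist∣₁ a (+ 1)))))
        where
        lem : ∀ a t → (a ℕ.* (t ℕ.* t)) ℕ.^ 3 ≡ t ℕ.^ 6 ℕ.* (a ℕ.* (1 ℕ.* 1)) ℕ.^ 3
        lem = ℕ+*.solve 2 (λ a t →
          let a′ = a :* (t :* t)
              a″ = a :* (con 1 :* con 1) in
          a′ :* (a′ :* (a′ :* con 1)) :=
          t :* (t :* (t :* (t :* (t :* (t :* con 1))))) :* (a″ :* (a″ :* (a″ :* con 1)))) refl
          where open ℕ+*
      scale-B : ∀ t → ℤ.∣ B t ∣ ℕ.^ 2 ≡ ℤ.∣ t ∣ ℕ.^ 6 ℕ.* ℤ.∣ B (+ 1) ∣ ℕ.^ 2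
      scale-B t = trans (cong (ℕ._^ 2) (∣twist∣₂ b t)) (trans (lem ℤ.∣ b ∣ ℤ.∣ t ∣)
        (cong (λ x → ℤ.∣ t ∣ ℕ.^ 6 ℕ.* x ℕ.^ 2) (sym (∣twist∣₂ b (+ 1)))))
        where
        lem : ∀ b t → (b ℕ.* (t ℕ.* (t ℕ.* t))) ℕ.^ 2 ≡ t ℕ.^ 6 ℕ.* (b ℕ.* (1 ℕ.* (1 ℕ.* 1))) ℕ.^ 2
        lem = ℕ+*.solve 2 (λ b t →
          let b′ = b :* (t :* (t :* t))
              b″ = b :* (con 1 :* (con 1 :* con 1)) in
          b′ :* (b′ :* con 1) :=
          t :* (t :* (t :* (t :* (t :* (t :* con 1))))) :* (b″ :* (b″ :* con 1))) refl
          where open ℕ+*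

theorem2p11 : (α β : ℝ) → 1ᴿ ≤ᴿ α → 1ᴿ ≤ᴿ β → (j : ℚ) →
    (j ≡ 0ℚ →
    RatioAsymptotic ℰ[ j ] ℰ~[ j ] (H α β) (recip (ζ 6) (0<ζ 6)) (- (+ 5 / 12))) ×
    (j ≡ + 1728 / 1 →
    RatioAsymptotic ℰ[ j ] ℰ~[ j ] (H α β) (recip (ζ 4) (0<ζ 4)) (- (+ 1 / 4))) ×
    (j ≢ 0ℚ → j ≢ + 1728 / 1 →
    RatioAsymptotic ℰ[ j ] ℰ~[ j ] (H α β) (recip (ζ 2) (0<ζ 2)) (- (+ 1 / 12)))
theorem2p11 α β 1≤α 1≤β j =
  -- The numerals are g, a and d. The closing `refl`s check d + 1 = g k and (a + 1) w = g (k - 1):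
  -- 12 = 2 · 6 and 5 · 2 = 2 · 5, then 4 = 1 · 4 and 1 · 3 = 1 · 3, then 12 = 6 · 2 and 1 · 6 = 6 ·
  -- 1.
  (λ j≡0 → ratio-asymptotic (family-0 α β 1≤α 1≤β (cong ↥_ j≡0)) 2 4 11 (Coprimality.gcd≡1⇒coprime refl) refl refl) ,
  (λ j≡1728 → ratio-asymptotic (family-1728 α β 1≤α 1≤β (Equivalence.from [1728-j]↧≡0⇔ j≡1728)) 1 0 3 (Coprimality.gcd≡1⇒coprime refl) refl refl) ,
  (λ j≢0 j≢1728 → ratio-asymptotic (family-generic α β 1≤α 1≤β
    (λ n≡0 → j≢0 (↥≡0⇒≡0 n≡0)) (λ u≡0 → j≢1728 (Equivalence.to [1728-j]↧≡0⇔ u≡0))) 6 0 11 (Coprimality.gcd≡1⇒coprime refl) refl refl)
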